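{- For every $k\ge1$, the ring of Laurent polynomials $\mathbb Z[x_1,x_1^{ -1},\ldots,x_k,x_k^{ -1}]$ is regularly bi-interpretable with the ring $\mathbb Z$.
   Context: A regular interpretation $(\Gamma,\phi)$ of $\mathbb A$ in $\mathbb B$ is a code of $L(\mathbb B)$-formulas with parameters $\bar y$ defining a subset of $B^n$, an equivalence relation on it and the operations of $\mathbb A$ on the quotient, together with a formula $\phi(\bar y)$ with $\phi(\mathbb B)\ne\emptyset$, such that the resulting structure $\Gamma(\mathbb B,\bar p)\cong\mathbb A$ for every $\bar p\in\phi(\mathbb B)$; a coordinate map is a surjection from the defined subset onto $A$ inducing such an isomorphism. $\mathbb A$ and $\mathbb B$ are regularly bi-interpretable if there are regular interpretations $(\Gamma,\phi)$ of $\mathbb A$ in $\mathbb B$ and $(\Delta,\psi)$ of $\mathbb B$ in $\mathbb A$ and formulas $\theta_{\mathbb A},\theta_{\mathbb B}$ such that for every admissible parameter tuple $\bar r_0$ of the composite interpretation $\Gamma\circ\Delta$ of $\mathbb A$ in $\mathbb A$, $\theta_{\mathbb A}(\bar u,x,\bar r_0)$ defines a coordinate map $\Gamma\circ\Delta(\mathbb A,\bar r_0)\to\mathbb A$, and symmetrically for $\Delta\circ\Gamma$ and $\theta_{\mathbb B}$. -}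

module Defs where

open import Data.Nat using (ℕ; zero; suc; _+_; _*_)
open import Data.Fin using (Fin; zero; suc; _↑ˡ_; _↑ʳ_; combine; splitAt; quotRem)
open import Data.Integer as ℤ using (ℤ)
open import Data.Vec as V using (Vec)
open import Data.Vec.Properties using (≡-dec)
open import Data.Vec.Functional using (Vector; _++_; concat; []; _∷_)
open import Data.List as L using (List)
open import Data.Product using (Σ; _×_; _,_; proj₁; proj₂)
open import Data.Sum using (_⊎_; [_,_]′)
open import Data.Unit using (⊤)
open import Data.Empty using (⊥)
open import Function using (_∘_; _⇔_)
open import Relation.Nullary using (¬_; yes; no)
open import Relation.Binary.PropositionalEquality using (_≡_)

data Op : Set where
  add mul neg zer one : Op

arity : Op → ℕ
arity add = 2
arity mul = 2
arity neg = 1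
arity zer = 0
arity one = 0

-- An L-structure: a carrier with its equality (a setoid equality, so that
-- quotient-like carriers such as Laurent polynomials can be represented)
-- and the interpretation of the operation symbols.
record Structure : Set₁ where
  field
    Carrier : Set
    _≈_     : Carrier → Carrier → Set
    ⟦_⟧     : (f : Op) → Vector Carrier (arity f) → Carrier
open Structure public

-- Unnested first-order formulas with k free variables (de Bruijn,
-- the quantifiers bind variable 0).  Every first-order formula is
-- equivalent to an unnested one, so definable sets are unaffected.

data Formula (k : ℕ) : Set where
  tt ff   : Formula k
  _≐_     : Fin k → Fin k → Formula k
  app     : (f : Op) → Vector (Fin k) (arity f) → Fin k → Formula k
  _∧'_ _∨'_ _⇒'_ : Formula k → Formula k → Formula k
  ¬'_     : Formula k → Formula k
  ∃' ∀'   : Formula (suc k) → Formula k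

Sat : (M : Structure) {k : ℕ} → Formula k → Vector (Carrier M) k → Set
Sat M tt ρ = ⊤
Sat M ff ρ = ⊥
Sat M (i ≐ j) ρ = _≈_ M (ρ i) (ρ j)
Sat M (app f xs y) ρ = _≈_ M (⟦_⟧ M f (ρ ∘ xs)) (ρ y)
Sat M (φ ∧' ψ) ρ = Sat M φ ρ × Sat M ψ ρ
Sat M (φ ∨' ψ) ρ = Sat M φ ρ ⊎ Sat M ψ ρ
Sat M (φ ⇒' ψ) ρ = Sat M φ ρ → Sat M ψ ρ
Sat M (¬' φ) ρ = ¬ Sat M φ ρ
Sat M (∃' φ) ρ = Σ (Carrier M) λ a → Sat M φ (a ∷ ρ)
Sat M (∀' φ) ρ = (a : Carrier M) → Sat M φ (a ∷ ρ)

lift : {k k' : ℕ} → (Fin k → Fin k') → Fin (suc k) → Fin (suc k')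
lift ρ zero = zero
lift ρ (suc i) = suc (ρ i)

rename : {k k' : ℕ} → (Fin k → Fin k') → Formula k → Formula k'
rename ρ tt = tt
rename ρ ff = ff
rename ρ (i ≐ j) = ρ i ≐ ρ j
rename ρ (app f xs y) = app f (ρ ∘ xs) (ρ y)
rename ρ (φ ∧' ψ) = rename ρ φ ∧' rename ρ ψ
rename ρ (φ ∨' ψ) = rename ρ φ ∨' rename ρ ψ
rename ρ (φ ⇒' ψ) = rename ρ φ ⇒' rename ρ ψ
rename ρ (¬' φ) = ¬' rename ρ φ
rename ρ (∃' φ) = ∃' (rename (lift ρ) φ)
rename ρ (∀' φ) = ∀' (rename (lift ρ) φ)

-- block quantifiers: the first d variables of the body are the new ones
∃ⁿ : {K : ℕ} (d : ℕ) → Formula (d + K) → Formula K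
∃ⁿ zero φ = φ
∃ⁿ (suc d) φ = ∃ⁿ d (∃' φ)

∀ⁿ : {K : ℕ} (d : ℕ) → Formula (d + K) → Formula K
∀ⁿ zero φ = φ
∀ⁿ (suc d) φ = ∀ⁿ d (∀' φ)

⋀ : {k : ℕ} (n : ℕ) → Vector (Formula k) n → Formula k
⋀ zero φs = tt
⋀ (suc n) φs = φs zero ∧' ⋀ n (φs ∘ suc)

-- Interpretation codes.  Variable layout: object tuples first, then the
-- parameter tuple ȳ (of length par).

record Interp : Set where
  field
    dim par : ℕ
    dom : Formula (dim + par)
    eqv : Formula (dim + dim + par)
    rel : (f : Op) → Formula (arity f * dim + dim + par)
                                                    -- f(x̄₁,…,x̄ₐ) = x̄₀ ; ȳ
open Interp public

record CoordMap (Γ : Interp) (B : Structure) (p : Vector (Carrier B) (par Γ))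
                (A : Structure) : Set where
  field
    π : (x : Vector (Carrier B) (dim Γ)) → Sat B (dom Γ) (x ++ p) → Carrier A
    surj : (a : Carrier A) →
      Σ (Vector (Carrier B) (dim Γ)) λ x → Σ (Sat B (dom Γ) (x ++ p)) λ d →
        _≈_ A (π x d) a
    π-eqv : (x x' : Vector (Carrier B) (dim Γ))
      (d : Sat B (dom Γ) (x ++ p)) (d' : Sat B (dom Γ) (x' ++ p)) →
      Sat B (eqv Γ) ((x ++ x') ++ p) ⇔ _≈_ A (π x d) (π x' d')
    π-op : (f : Op) (xs : Vector (Vector (Carrier B) (dim Γ)) (arity f))
      (ds : (i : Fin (arity f)) → Sat B (dom Γ) (xs i ++ p))
      (x : Vector (Carrier B) (dim Γ)) (d : Sat B (dom Γ) (x ++ p)) →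
      Sat B (rel Γ f) ((concat xs ++ x) ++ p)
        ⇔ _≈_ A (⟦_⟧ A f (λ i → π (xs i) (ds i))) (π x d)

record IsRegularInterp (Γ : Interp) (φ : Formula (par Γ))
                       (A B : Structure) : Set where
  field
    nonempty : Σ (Vector (Carrier B) (par Γ)) λ p → Sat B φ p
    iso : (p : Vector (Carrier B) (par Γ)) → Sat B φ p → CoordMap Γ B p A

-- θ(ū , x ; p̄) defines a coordinate map  Γ(B, p̄) → A  (in B, where here
-- B is the structure in which Γ is evaluated and A the target; for the
-- composite interpretations both are the same structure)
DefinesCoordMap : (Γ : Interp) (M : Structure) (p : Vector (Carrier M) (par Γ))
  (θ : Formula (dim Γ + 1 + par Γ)) → Set
DefinesCoordMap Γ M p θ =
  Σ (CoordMap Γ M p M) λ c →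
    (u : Vector (Carrier M) (dim Γ)) (d : Sat M (dom Γ) (u ++ p))
    (a : Carrier M) →
    Sat M θ ((u ++ (a ∷ [])) ++ p) ⇔ _≈_ M (CoordMap.π c u d) a

module Translate (Δ : Interp) where
  private
    d = dim Δ
    q = par Δ

  domAt : {K : ℕ} → (Fin d → Fin K) → (Fin q → Fin K) → Formula K
  domAt b pz = rename (b ++ pz) (dom Δ)

  tr : {k K : ℕ} → Formula k → (Fin k → Fin d → Fin K) → (Fin q → Fin K)
     → Formula K
  tr tt σ pz = tt
  tr ff σ pz = ff
  tr (i ≐ j) σ pz = rename ((σ i ++ σ j) ++ pz) (eqv Δ)
  tr (app f xs y) σ pz = rename ((concat (σ ∘ xs) ++ σ y) ++ pz) (rel Δ f)
  tr (φ ∧' ψ) σ pz = tr φ σ pz ∧' tr ψ σ pz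
  tr (φ ∨' ψ) σ pz = tr φ σ pz ∨' tr ψ σ pz
  tr (φ ⇒' ψ) σ pz = tr φ σ pz ⇒' tr ψ σ pz
  tr (¬' φ) σ pz = ¬' tr φ σ pz
  tr {K = K} (∃' φ) σ pz =
    ∃ⁿ d (domAt (λ j → j ↑ˡ K) ((d ↑ʳ_) ∘ pz)
          ∧' tr φ (σ' σ) ((d ↑ʳ_) ∘ pz))
    where
      σ' : {k : ℕ} → (Fin k → Fin d → Fin K) → Fin (suc k) → Fin d → Fin (d + K)
      σ' σ zero = λ j → j ↑ˡ K
      σ' σ (suc i) = (d ↑ʳ_) ∘ σ i
  tr {K = K} (∀' φ) σ pz =
    ∀ⁿ d (domAt (λ j → j ↑ˡ K) ((d ↑ʳ_) ∘ pz)
          ⇒' tr φ (σ' σ) ((d ↑ʳ_) ∘ pz))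
    where
      σ' : {k : ℕ} → (Fin k → Fin d → Fin K) → Fin (suc k) → Fin d → Fin (d + K)
      σ' σ zero = λ j → j ↑ˡ K
      σ' σ (suc i) = (d ↑ʳ_) ∘ σ i

-- Composite interpretation Γ ∘ Δ  (Γ interprets A in B, Δ interprets B
-- in A; Γ ∘ Δ interprets A in A).  An object of Γ ∘ Δ is a tuple of
-- dim Γ blocks of length dim Δ (block i, coordinate j at index
-- combine i j).  Parameters of Γ ∘ Δ: the Δ-parameters z̄ followed by
-- par Γ blocks of length dim Δ coding the Γ-parameters.

module Compose (Γ : Interp) (φ : Formula (par Γ))
               (Δ : Interp) (ψ : Formula (par Δ)) where
  open Translate Δ
  private
    n = dim Γ
    m = par Γ
    d = dim Δ
    q = par Δ

  P : ℕ
  P = q + m * d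

  zIx : {N : ℕ} → Fin q → Fin (N + P)
  zIx {N} i = N ↑ʳ (i ↑ˡ (m * d))

  yIx : {N : ℕ} → Fin m → Fin d → Fin (N + P)
  yIx {N} i j = N ↑ʳ (q ↑ʳ combine i j)

  σdom : Fin (n + m) → Fin d → Fin (n * d + P)
  σdom v j = [ (λ i → combine i j ↑ˡ P) , (λ p → yIx {n * d} p j) ]′ (splitAt n v)

  σeqv : Fin (n + n + m) → Fin d → Fin (n * d + n * d + P)
  σeqv v j =
    [ (λ w → [ (λ i → (combine i j ↑ˡ (n * d)) ↑ˡ P)
             , (λ i → ((n * d) ↑ʳ combine i j) ↑ˡ P) ]′ (splitAt n w))
    , (λ p → yIx {n * d + n * d} p j) ]′ (splitAt (n + n) v)

  σrel : (f : Op) → Fin (arity f * n + n + m) → Fin d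
       → Fin (arity f * (n * d) + n * d + P)
  σrel f v j =
    [ (λ w → [ (λ u → (combine (proj₂ (quotRem {arity f} n u))
                                (combine (proj₁ (quotRem {arity f} n u)) j)
                         ↑ˡ (n * d)) ↑ˡ P)
             , (λ i → ((arity f * (n * d)) ↑ʳ combine i j) ↑ˡ P)
             ]′ (splitAt (arity f * n) w))
    , (λ p → yIx {arity f * (n * d) + n * d} p j) ]′ (splitAt (arity f * n + n) v)

  ΓΔ : Interp
  ΓΔ = record
    { dim = n * d
    ; par = P
    ; dom = ⋀ n (λ i → domAt (λ j → combine i j ↑ˡ P) (zIx {n * d}))
            ∧' tr (dom Γ) σdom (zIx {n * d})
    ; eqv = tr (eqv Γ) σeqv (zIx {n * d + n * d})
    ; rel = λ f → tr (rel Γ f) (σrel f) (zIx {arity f * (n * d) + n * d})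
    }

  φΓΔ : Formula P
  φΓΔ = rename (λ i → i ↑ˡ (m * d)) ψ
        ∧' (⋀ m (λ i → domAt (yIx {0} i) (zIx {0}))
        ∧' tr φ (yIx {0}) (zIx {0}))

record RegularlyBiInterpretable (A B : Structure) : Set where
  field
    Γ : Interp
    φ : Formula (par Γ)
    Δ : Interp
    ψ : Formula (par Δ)
    Γ-reg : IsRegularInterp Γ φ A B
    Δ-reg : IsRegularInterp Δ ψ B A
    θA : Formula (dim (Compose.ΓΔ Γ φ Δ ψ) + 1 + par (Compose.ΓΔ Γ φ Δ ψ))
    θB : Formula (dim (Compose.ΓΔ Δ ψ Γ φ) + 1 + par (Compose.ΓΔ Δ ψ Γ φ))
    θA-coord : (r : Vector (Carrier A) (par (Compose.ΓΔ Γ φ Δ ψ))) →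
      Sat A (Compose.φΓΔ Γ φ Δ ψ) r →
      DefinesCoordMap (Compose.ΓΔ Γ φ Δ ψ) A r θA
    θB-coord : (r : Vector (Carrier B) (par (Compose.ΓΔ Δ ψ Γ φ))) →
      Sat B (Compose.φΓΔ Δ ψ Γ φ) r →
      DefinesCoordMap (Compose.ΓΔ Δ ψ Γ φ) B r θB

ℤ-ring : Structure
ℤ-ring = record
  { Carrier = ℤ
  ; _≈_ = _≡_
  ; ⟦_⟧ = op
  }
  where
    op : (f : Op) → Vector ℤ (arity f) → ℤ
    op add xs = xs zero ℤ.+ xs (suc zero)
    op mul xs = xs zero ℤ.* xs (suc zero)
    op neg xs = ℤ.- xs zero
    op zer xs = ℤ.0ℤ
    op one xs = ℤ.1ℤ

-- The Laurent polynomial ring ℤ[x₁,x₁⁻¹,…,x_k,x_k⁻¹] = group ring ℤ[ℤᵏ].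
-- A Laurent polynomial is represented by a finite list of monomials
-- (coefficient , exponent vector in ℤᵏ); two representations are equal
-- iff they have the same coefficient at every exponent vector.

Monomial : ℕ → Set
Monomial k = ℤ × Vec ℤ k

coeff : {k : ℕ} → List (Monomial k) → Vec ℤ k → ℤ
coeff L.[] e = ℤ.0ℤ
coeff ((c , e') L.∷ p) e with ≡-dec ℤ._≟_ e' e
... | yes _ = c ℤ.+ coeff p e
... | no _ = coeff p e

Laurent : ℕ → Structure
Laurent k = record
  { Carrier = List (Monomial k)
  ; _≈_ = λ p p' → (e : Vec ℤ k) → coeff p e ≡ coeff p' e
  ; ⟦_⟧ = op
  }
  where
    times : List (Monomial k) → List (Monomial k) → List (Monomial k)
    times p p' = L.concatMap (λ { (c , e) →
                   L.map (λ { (c' , e') → (c ℤ.* c' , V.zipWith ℤ._+_ e e') }) p' }) p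
    op : (f : Op) → Vector (List (Monomial k)) (arity f) → List (Monomial k)
    op add xs = xs zero L.++ xs (suc zero)
    op mul xs = times (xs zero) (xs (suc zero))
    op neg xs = L.map (λ { (c , e) → (ℤ.- c , e) }) (xs zero)
    op zer xs = L.[]
    op one xs = (ℤ.1ℤ , V.replicate k ℤ.0ℤ) L.∷ L.[]

{-# OPTIONS --safe #-}

-- An integer, written in base 3 + 2k, is read as a program that builds a Laurent polynomial from 0 by
-- adding ±1 and multiplying by the variables and their inverses. A Laurent polynomial is determined by
-- its values modulo N at the points M of ℤᵏ invertible modulo N (Kronecker substitution), so equality
-- and the ring operations on programs are definable in ℤ as soon as the evaluation of programs is, and a
-- run is coded by a finite set of pairs through a Gödel-style divisibility trick. Conversely, since the
-- units are the signed monomials, ℤ is the set of those a for which every unit s has a unit congruent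
-- to 1 + a(s - 1) modulo (s - 1)², which stands for s ^ a. The polynomial decoded from a program is
-- recognised in the Laurent ring by its residues modulo the ideals (N , xᵢ - Mᵢ). The variables enter as
-- parameters t, and t is declared admissible when decoding with t is a coordinate map: this is itself
-- first order, so only t = x has to be examined and no automorphism is ever needed.
module Submission where

open import Defs
open import Data.Nat.Base as ℕ using (ℕ; zero; suc; _≤_; z≤n; s≤s)
open import Data.Integer.Base using (ℤ; +_; -[1+_]; _+_; _*_; -_; ∣_∣; 0ℤ; 1ℤ; _^_)
open import Data.Fin.Base using (Fin; zero; suc; _↑ˡ_; _↑ʳ_; combine; splitAt; join; quotRem; toℕ; opposite; fromℕ<)
open import Data.Vec.Base as V using (Vec)
open import Data.Vec.Functional using (Vector; _++_; concat; []; _∷_)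
open import Data.Vec.Functional.Properties using (lookup-++ˡ; lookup-++ʳ)
open import Data.List.Base as L using (List)
open import Data.Product.Base using (Σ; _×_; _,_; proj₁; proj₂)
open import Data.Sum.Base using (_⊎_; inj₁; inj₂; [_,_]′)
open import Data.Maybe.Base using (Maybe; just; nothing; maybe′)
open import Data.Empty using (⊥-elim)
open import Function.Base using (_∘_; id)
open import Function.Bundles using (_⇔_; mk⇔; Equivalence)
open import Relation.Nullary using (¬_; Dec; yes; no)
open import Relation.Binary.PropositionalEquality as ≡ using (_≡_; refl; cong; cong₂; subst; sym; trans)
import Data.Nat.Properties as ℕ
import Data.Integer.Properties as ℤ
import Data.Fin.Properties as Finₚ
import Data.Sum.Properties as Sumₚ
import Data.Nat.Divisibility as ℕ∣
open import Data.Integer.Tactic.RingSolver using (solve-∀)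
open import Data.List.Membership.Propositional using (_∈_)
open import Data.List.Relation.Unary.Any using (here; there)
import Data.List.Membership.DecPropositional as DecMembership
import Data.Product.Properties as Productₚ
import Data.Nat.DivMod as ℕ/
open import Data.Nat.Induction using (<-wellFounded)
open import Induction.WellFounded using (Acc; acc)
import Data.Vec.Properties as Vecₚ
import Data.List.Properties as Listₚ
open import Algebra.Bundles using (CommutativeRing)
open import Level using (0ℓ)
open import Data.Integer.Divisibility.Signed using (divides) renaming (_∣?_ to _∣ˢ?_)
import Algebra.Solver.Ring.NaturalCoefficients.Default as SemiringSolver
open Equivalence using (to; from)

-- An integer point gives no integer value to a monomial with negative exponents, so every
-- evaluation is taken modulo an `N` for which inverses `M'` of the coordinates exist; an `N` of the
-- form Bt - 1 already separates a given polynomial from 0. Programs serve as codes because every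
-- integer is then a code, and because each instruction commutes with ring homomorphisms: the same
-- run can be followed in ℤ, in the Laurent ring and modulo an ideal. That only integers satisfy the
-- condition on units is seen at s = x₁ ^ M with M large. There w is a signed monomial congruent to
-- 1 + a(s - 1) modulo (s - 1)², and pairing with functions supported on one residue class of the
-- first exponent modulo M isolates each coefficient of a at a nonzero exponent and shows that it is
-- 0. No formula of the ring substitutes a point into a polynomial directly, but membership in the
-- ideal of the point is first order, and these ideals separate polynomials. Satisfaction is
-- constructive: existential statements carry witnesses, so a coordinate map can be projected out of
-- the truth of a formula.

⇔-refl : {A : Set} → A ⇔ A
⇔-refl = mk⇔ id id

⇔-sym : {A B : Set} → A ⇔ B → B ⇔ A
⇔-sym e = mk⇔ (from e) (to e)

infixr 2 _⇔∘_
_⇔∘_ : {A B C : Set} → A ⇔ B → B ⇔ C → A ⇔ C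
e ⇔∘ e' = mk⇔ (to e' ∘ to e) (from e ∘ from e')

×-⇔ : {A A' B B' : Set} → A ⇔ A' → B ⇔ B' → (A × B) ⇔ (A' × B')
×-⇔ e e' = mk⇔ (λ (a , b) → to e a , to e' b) (λ (a , b) → from e a , from e' b)

⊎-⇔ : {A A' B B' : Set} → A ⇔ A' → B ⇔ B' → (A ⊎ B) ⇔ (A' ⊎ B')
⊎-⇔ e e' = mk⇔ [ inj₁ ∘ to e , inj₂ ∘ to e' ]′ [ inj₁ ∘ from e , inj₂ ∘ from e' ]′

→-⇔ : {A A' B B' : Set} → A ⇔ A' → B ⇔ B' → (A → B) ⇔ (A' → B')
→-⇔ e e' = mk⇔ (λ f → to e' ∘ f ∘ from e) (λ f → from e' ∘ f ∘ to e)

Σ-⇔ : {A : Set} {B B' : A → Set} → (∀ a → B a ⇔ B' a) → Σ A B ⇔ Σ A B'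
Σ-⇔ e = mk⇔ (λ (a , b) → a , to (e a) b) (λ (a , b) → a , from (e a) b)

Π-⇔ : {A : Set} {B B' : A → Set} → (∀ a → B a ⇔ B' a) → (∀ a → B a) ⇔ (∀ a → B' a)
Π-⇔ e = mk⇔ (λ f a → to (e a) (f a)) (λ f a → from (e a) (f a))

-- Concatenated tuples and tuples of blocks

∘-++ : {A B : Set} (f : A → B) {m n : ℕ} (u : Vector A m) (v : Vector A n) →
       ∀ i → f ((u ++ v) i) ≡ ((f ∘ u) ++ (f ∘ v)) i
∘-++ f {m} u v i = Sumₚ.[,]-∘ f (splitAt m i)

++-cong₂ : {A : Set} (_~_ : A → A → Set) {m n : ℕ} {u u' : Vector A m} {v v' : Vector A n} →
       (∀ i → u i ~ u' i) → (∀ i → v i ~ v' i) → ∀ i → (u ++ v) i ~ (u' ++ v') i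
++-cong₂ _~_ {m} e e' i with splitAt m i
... | inj₁ j = e j
... | inj₂ j = e' j

concat-combine : {A : Set} {m n : ℕ} (xs : Vector (Vector A m) n) (i : Fin n) (j : Fin m) →
                 concat xs (combine i j) ≡ xs i j
concat-combine xs i j = cong (λ (i , j) → xs i j) (Finₚ.remQuot-combine i j)

blocks : {A : Set} {m n : ℕ} → Vector A (n ℕ.* m) → Vector (Vector A m) n
blocks y i j = y (combine i j)

concat-blocks : {A : Set} {m n : ℕ} (y : Vector A (n ℕ.* m)) →
                ∀ i → concat (blocks {m = m} {n} y) i ≡ y i
concat-blocks {m = m} {n} y i = cong y (Finₚ.combine-remQuot {n} m i)

-- Satisfaction of formulas up to the equality of a structure

⋁ : {k : ℕ} (n : ℕ) → Vector (Formula k) n → Formula k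
⋁ zero φs = ff
⋁ (suc n) φs = φs zero ∨' ⋁ n (φs ∘ suc)

-- A `Structure` carries a bare relation as its equality, so the laws under which satisfaction
-- respects that equality are supplied here.
record IsSetoidAlgebra (M : Structure) : Set where
  field
    ≈-refl  : ∀ {x} → _≈_ M x x
    ≈-sym   : ∀ {x y} → _≈_ M x y → _≈_ M y x
    ≈-trans : ∀ {x y z} → _≈_ M x y → _≈_ M y z → _≈_ M x z
    op-cong : ∀ f {xs ys} → (∀ i → _≈_ M (xs i) (ys i)) → _≈_ M (⟦_⟧ M f xs) (⟦_⟧ M f ys)

  ≈-reflexive : ∀ {x y} → x ≡ y → _≈_ M x y
  ≈-reflexive refl = ≈-refl

  ≈-⇔ : ∀ {x x' y y'} → _≈_ M x x' → _≈_ M y y' → _≈_ M x y ⇔ _≈_ M x' y'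
  ≈-⇔ e e' = mk⇔ (λ p → ≈-trans (≈-sym e) (≈-trans p e'))
                 (λ p → ≈-trans e (≈-trans p (≈-sym e')))

module Semantics (M : Structure) (isSetoidAlgebra : IsSetoidAlgebra M) where
  open IsSetoidAlgebra isSetoidAlgebra public
  private
    C = Carrier M
    infix 4 _~_
    _~_ = _≈_ M

  ∷-cong : ∀ {n} {a a' : C} {ρ ρ' : Vector C n} → a ~ a' → (∀ i → ρ i ~ ρ' i) →
           ∀ i → (a ∷ ρ) i ~ (a' ∷ ρ') i
  ∷-cong e es zero = e
  ∷-cong e es (suc i) = es i

  Sat-cong : ∀ {k} (φ : Formula k) {ρ ρ' : Vector C k} → (∀ i → ρ i ~ ρ' i) →
             Sat M φ ρ ⇔ Sat M φ ρ'
  Sat-cong tt e = ⇔-refl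
  Sat-cong ff e = ⇔-refl
  Sat-cong (i ≐ j) e = ≈-⇔ (e i) (e j)
  Sat-cong (app f xs y) e = ≈-⇔ (op-cong f (e ∘ xs)) (e y)
  Sat-cong (φ ∧' ψ) e = ×-⇔ (Sat-cong φ e) (Sat-cong ψ e)
  Sat-cong (φ ∨' ψ) e = ⊎-⇔ (Sat-cong φ e) (Sat-cong ψ e)
  Sat-cong (φ ⇒' ψ) e = →-⇔ (Sat-cong φ e) (Sat-cong ψ e)
  Sat-cong (¬' φ) e = →-⇔ (Sat-cong φ e) ⇔-refl
  Sat-cong (∃' φ) e = Σ-⇔ λ a → Sat-cong φ (∷-cong ≈-refl e)
  Sat-cong (∀' φ) e = Π-⇔ λ a → Sat-cong φ (∷-cong ≈-refl e)

  Sat-cong≡ : ∀ {k} (φ : Formula k) {ρ ρ' : Vector C k} → (∀ i → ρ i ≡ ρ' i) →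
              Sat M φ ρ ⇔ Sat M φ ρ'
  Sat-cong≡ φ e = Sat-cong φ (≈-reflexive ∘ e)

  Sat-rename : ∀ {k l} (σ : Fin k → Fin l) (φ : Formula k) {ρ : Vector C l} →
               Sat M (rename σ φ) ρ ⇔ Sat M φ (ρ ∘ σ)
  Sat-rename σ tt = ⇔-refl
  Sat-rename σ ff = ⇔-refl
  Sat-rename σ (i ≐ j) = ⇔-refl
  Sat-rename σ (app f xs y) = ⇔-refl
  Sat-rename σ (φ ∧' ψ) = ×-⇔ (Sat-rename σ φ) (Sat-rename σ ψ)
  Sat-rename σ (φ ∨' ψ) = ⊎-⇔ (Sat-rename σ φ) (Sat-rename σ ψ)
  Sat-rename σ (φ ⇒' ψ) = →-⇔ (Sat-rename σ φ) (Sat-rename σ ψ)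
  Sat-rename σ (¬' φ) = →-⇔ (Sat-rename σ φ) ⇔-refl
  Sat-rename σ (∃' φ) {ρ} = Σ-⇔ λ a → Sat-rename (lift σ) φ ⇔∘
    Sat-cong≡ φ λ { zero → refl ; (suc i) → refl }
  Sat-rename σ (∀' φ) {ρ} = Π-⇔ λ a → Sat-rename (lift σ) φ ⇔∘
    Sat-cong≡ φ λ { zero → refl ; (suc i) → refl }

  uncons-++ : ∀ {m n} (v : Vector C (suc m)) (ρ : Vector C n) →
              ∀ i → (v zero ∷ ((v ∘ suc) ++ ρ)) i ≡ (v ++ ρ) i
  uncons-++ v ρ zero = refl
  uncons-++ {m} v ρ (suc i) with splitAt m i
  ... | inj₁ j = refl
  ... | inj₂ j = refl

  Sat-∃ⁿ : ∀ {k} (d : ℕ) (φ : Formula (d ℕ.+ k)) {ρ : Vector C k} →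
           Sat M (∃ⁿ d φ) ρ ⇔ Σ (Vector C d) λ v → Sat M φ (v ++ ρ)
  Sat-∃ⁿ zero φ = mk⇔ (λ s → [] , s) proj₂
  Sat-∃ⁿ (suc d) φ {ρ} = Sat-∃ⁿ d (∃' φ) ⇔∘ mk⇔
    (λ (v , a , s) → a ∷ v , to (Sat-cong≡ φ (uncons-++ (a ∷ v) ρ)) s)
    (λ (v , s) → v ∘ suc , v zero , from (Sat-cong≡ φ (uncons-++ v ρ)) s)

  Sat-∀ⁿ : ∀ {k} (d : ℕ) (φ : Formula (d ℕ.+ k)) {ρ : Vector C k} →
           Sat M (∀ⁿ d φ) ρ ⇔ (∀ (v : Vector C d) → Sat M φ (v ++ ρ))
  Sat-∀ⁿ zero φ = mk⇔ (λ s v → s) (λ s → s [])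
  Sat-∀ⁿ (suc d) φ {ρ} = Sat-∀ⁿ d (∀' φ) ⇔∘ mk⇔
    (λ s v → to (Sat-cong≡ φ (uncons-++ v ρ)) (s (v ∘ suc) (v zero)))
    (λ s v a → from (Sat-cong≡ φ (uncons-++ (a ∷ v) ρ)) (s (a ∷ v)))

  Sat-⋀ : ∀ {k} (n : ℕ) (φs : Vector (Formula k) n) {ρ : Vector C k} →
          Sat M (⋀ n φs) ρ ⇔ (∀ i → Sat M (φs i) ρ)
  Sat-⋀ zero φs = mk⇔ (λ _ ()) (λ _ → _)
  Sat-⋀ (suc n) φs = mk⇔
    (λ { (s , ss) zero → s ; (s , ss) (suc i) → to (Sat-⋀ n (φs ∘ suc)) ss i })
    (λ s → s zero , from (Sat-⋀ n (φs ∘ suc)) (s ∘ suc))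

  Sat-⋁ : ∀ {k} (n : ℕ) (φs : Vector (Formula k) n) {ρ : Vector C k} →
          Sat M (⋁ n φs) ρ ⇔ (Σ (Fin n) λ i → Sat M (φs i) ρ)
  Sat-⋁ zero φs = mk⇔ (λ ()) (λ ())
  Sat-⋁ (suc n) φs = ⊎-⇔ ⇔-refl (Sat-⋁ n (φs ∘ suc)) ⇔∘ mk⇔
    [ (zero ,_) , (λ (i , s) → suc i , s) ]′
    (λ { (zero , s) → inj₁ s ; (suc i , s) → inj₂ (i , s) })

-- Formulas with compound terms and an arbitrary set V of variables, whose
-- semantics Sem computes; compile turns them into unnested formulas.

data Term (V : Set) : Set where
  var : V → Term V
  op  : (f : Op) → (Fin (arity f) → Term V) → Term V

data Fml (V : Set) : Set₁ where
  eq        : Term V → Term V → Fml V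
  emb       : {m : ℕ} → Formula m → (Fin m → Term V) → Fml V
  inst      : {W : Set} → Fml W → (W → Term V) → Fml V
  _∧ᶠ_ _∨ᶠ_ _⇒ᶠ_ : Fml V → Fml V → Fml V
  ¬ᶠ_       : Fml V → Fml V
  ∃ᶠ ∀ᶠ     : Fml (Maybe V) → Fml V
  ∃ᶠⁿ ∀ᶠⁿ   : (d : ℕ) → Fml (Fin d ⊎ V) → Fml V
  ⋁ᶠ ⋀ᶠ     : (d : ℕ) → (Fin d → Fml V) → Fml V

infixr 3 _∧ᶠ_
infixr 2 _∨ᶠ_
infixr 1 _⇒ᶠ_

bindT : {V W : Set} → (V → Term W) → Term V → Term W
bindT σ (var v) = σ v
bindT σ (op f ts) = op f λ i → bindT σ (ts i)

mapT : {V W : Set} → (V → W) → Term V → Term W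
mapT σ = bindT (var ∘ σ)

-- Variable 0 names the value. Atomic formulas apply an operation to variables only, so a compound
-- term becomes existential quantifiers over the values of its subterms.
graph : {n : ℕ} → Term (Fin n) → Formula (suc n)
graph (var i) = suc i ≐ zero
graph {n} (op f ts) = ∃ⁿ (arity f)
  (⋀ (arity f) (λ i → rename ((i ↑ˡ suc n) ∷ (λ j → arity f ↑ʳ suc j)) (graph (ts i)))
   ∧' app f (_↑ˡ suc n) (arity f ↑ʳ zero))

-- Substitution by naming: the values of the terms are quantified and `φ` is only renamed, so terms
-- never have to enter `φ` itself.
plug : {m n : ℕ} → Formula m → (Fin m → Term (Fin n)) → Formula n
plug {m} {n} φ ts = ∃ⁿ m
  (⋀ m (λ i → rename ((i ↑ˡ n) ∷ (m ↑ʳ_)) (graph (ts i))) ∧' rename (_↑ˡ n) φ)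

compile : {V : Set} {n : ℕ} → Fml V → (V → Term (Fin n)) → Formula n
compile (eq s t) σ = plug (zero ≐ suc zero) (bindT σ s ∷ bindT σ t ∷ [])
compile (emb φ τ) σ = plug φ (bindT σ ∘ τ)
compile (inst φ τ) σ = compile φ (bindT σ ∘ τ)
compile (φ ∧ᶠ ψ) σ = compile φ σ ∧' compile ψ σ
compile (φ ∨ᶠ ψ) σ = compile φ σ ∨' compile ψ σ
compile (φ ⇒ᶠ ψ) σ = compile φ σ ⇒' compile ψ σ
compile (¬ᶠ φ) σ = ¬' compile φ σ
compile (∃ᶠ φ) σ = ∃' (compile φ (maybe′ (mapT suc ∘ σ) (var zero)))
compile (∀ᶠ φ) σ = ∀' (compile φ (maybe′ (mapT suc ∘ σ) (var zero)))
compile {n = n} (∃ᶠⁿ d φ) σ = ∃ⁿ d (compile φ [ var ∘ (_↑ˡ n) , mapT (d ↑ʳ_) ∘ σ ]′)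
compile {n = n} (∀ᶠⁿ d φ) σ = ∀ⁿ d (compile φ [ var ∘ (_↑ˡ n) , mapT (d ↑ʳ_) ∘ σ ]′)
compile (⋁ᶠ d φs) σ = ⋁ d λ i → compile (φs i) σ
compile (⋀ᶠ d φs) σ = ⋀ d λ i → compile (φs i) σ

-- Sealed, as comparing compiled formulas by unfolding is expensive.
abstract
  formula : {V : Set} {n : ℕ} → Fml V → (V → Term (Fin n)) → Formula n
  formula = compile

module RichSemantics (M : Structure) where
  private C = Carrier M

  eval : {V : Set} → Term V → (V → C) → C
  eval (var v) ρ = ρ v
  eval (op f ts) ρ = ⟦_⟧ M f λ i → eval (ts i) ρ

  Sem : {V : Set} → Fml V → (V → C) → Set
  Sem (eq s t) ρ = _≈_ M (eval s ρ) (eval t ρ)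
  Sem (emb φ τ) ρ = Sat M φ λ i → eval (τ i) ρ
  Sem (inst φ τ) ρ = Sem φ λ w → eval (τ w) ρ
  Sem (φ ∧ᶠ ψ) ρ = Sem φ ρ × Sem ψ ρ
  Sem (φ ∨ᶠ ψ) ρ = Sem φ ρ ⊎ Sem ψ ρ
  Sem (φ ⇒ᶠ ψ) ρ = Sem φ ρ → Sem ψ ρ
  Sem (¬ᶠ φ) ρ = ¬ Sem φ ρ
  Sem (∃ᶠ φ) ρ = Σ C λ a → Sem φ (maybe′ ρ a)
  Sem (∀ᶠ φ) ρ = (a : C) → Sem φ (maybe′ ρ a)
  Sem (∃ᶠⁿ d φ) ρ = Σ (Vector C d) λ v → Sem φ [ v , ρ ]′
  Sem (∀ᶠⁿ d φ) ρ = (v : Vector C d) → Sem φ [ v , ρ ]′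
  Sem (⋁ᶠ d φs) ρ = Σ (Fin d) λ i → Sem (φs i) ρ
  Sem (⋀ᶠ d φs) ρ = (i : Fin d) → Sem (φs i) ρ

module CompileCorrect (M : Structure) (isSetoidAlgebra : IsSetoidAlgebra M) where
  open Semantics M isSetoidAlgebra
  open RichSemantics M
  private
    C = Carrier M
    infix 4 _~_
    _~_ = _≈_ M

  eval-cong : {V : Set} (t : Term V) {ρ ρ' : V → C} → (∀ v → ρ v ~ ρ' v) → eval t ρ ~ eval t ρ'
  eval-cong (var v) e = e v
  eval-cong (op f ts) e = op-cong f λ i → eval-cong (ts i) e

  eval-bind : {V W : Set} (σ : V → Term W) (t : Term V) {ρ : W → C} →
              eval (bindT σ t) ρ ~ eval t (λ v → eval (σ v) ρ)
  eval-bind σ (var v) = ≈-refl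
  eval-bind σ (op f ts) = op-cong f λ i → eval-bind σ (ts i)

  Sem-cong : {V : Set} (φ : Fml V) {ρ ρ' : V → C} → (∀ v → ρ v ~ ρ' v) → Sem φ ρ ⇔ Sem φ ρ'
  Sem-cong (eq s t) e = ≈-⇔ (eval-cong s e) (eval-cong t e)
  Sem-cong (emb φ τ) e = Sat-cong φ λ i → eval-cong (τ i) e
  Sem-cong (inst φ τ) e = Sem-cong φ λ w → eval-cong (τ w) e
  Sem-cong (φ ∧ᶠ ψ) e = ×-⇔ (Sem-cong φ e) (Sem-cong ψ e)
  Sem-cong (φ ∨ᶠ ψ) e = ⊎-⇔ (Sem-cong φ e) (Sem-cong ψ e)
  Sem-cong (φ ⇒ᶠ ψ) e = →-⇔ (Sem-cong φ e) (Sem-cong ψ e)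
  Sem-cong (¬ᶠ φ) e = →-⇔ (Sem-cong φ e) ⇔-refl
  Sem-cong (∃ᶠ φ) e = Σ-⇔ λ a → Sem-cong φ λ { nothing → ≈-refl ; (just v) → e v }
  Sem-cong (∀ᶠ φ) e = Π-⇔ λ a → Sem-cong φ λ { nothing → ≈-refl ; (just v) → e v }
  Sem-cong (∃ᶠⁿ d φ) e = Σ-⇔ λ a → Sem-cong φ λ { (inj₁ i) → ≈-refl ; (inj₂ v) → e v }
  Sem-cong (∀ᶠⁿ d φ) e = Π-⇔ λ a → Sem-cong φ λ { (inj₁ i) → ≈-refl ; (inj₂ v) → e v }
  Sem-cong (⋁ᶠ d φs) e = Σ-⇔ λ i → Sem-cong (φs i) e
  Sem-cong (⋀ᶠ d φs) e = Π-⇔ λ i → Sem-cong (φs i) e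

  private
    -- The claim about the single terms is passed as an argument, since `Sat-graph` calls this at
    -- the immediate subterms of the term on which it recurses.
    ⋀-graphs : ∀ {m n N} (ts : Fin m → Term (Fin n)) (v : Vector C m) (ρ : Vector C N)
               (x : Fin m → Fin N) (y : Fin n → Fin N) (ρ' : Vector C n) →
               (∀ i → ρ (x i) ≡ v i) → (∀ j → ρ (y j) ≡ ρ' j) →
               (∀ i a → Sat M (graph (ts i)) (a ∷ ρ') ⇔ (eval (ts i) ρ' ~ a)) →
               Sat M (⋀ m λ i → rename (x i ∷ y) (graph (ts i))) ρ ⇔ (∀ i → eval (ts i) ρ' ~ v i)
    ⋀-graphs {m} ts v ρ x y ρ' ex ey ih = Sat-⋀ m _ ⇔∘ Π-⇔ λ i →
      Sat-rename (x i ∷ y) (graph (ts i)) ⇔∘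
      Sat-cong≡ (graph (ts i)) (λ { zero → ex i ; (suc j) → ey j }) ⇔∘ ih i (v i)

  Sat-graph : ∀ {n} (t : Term (Fin n)) (ρ : Vector C n) (a : C) →
              Sat M (graph t) (a ∷ ρ) ⇔ (eval t ρ ~ a)
  Sat-graph (var i) ρ a = ⇔-refl
  Sat-graph {n} (op f ts) ρ a = Sat-∃ⁿ (arity f) _ ⇔∘ mk⇔
    (λ (v , g , s) → ≈-trans (op-cong f (λ i → ≈-trans (to (gs v) g i)
        (≈-reflexive (sym (lookup-++ˡ v (a ∷ ρ) i)))))
      (≈-trans s (≈-reflexive (lookup-++ʳ v (a ∷ ρ) zero))))
    (λ e → let v = λ i → eval (ts i) ρ in v , from (gs v) (λ i → ≈-refl) ,
      ≈-trans (op-cong f λ i → ≈-reflexive (lookup-++ˡ v (a ∷ ρ) i))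
        (≈-trans e (≈-reflexive (sym (lookup-++ʳ v (a ∷ ρ) zero)))))
    where
    gs : ∀ v → _
    gs v = ⋀-graphs ts v (v ++ (a ∷ ρ)) (_↑ˡ suc n) (λ j → arity f ↑ʳ suc j) ρ
      (lookup-++ˡ v (a ∷ ρ)) (λ j → lookup-++ʳ v (a ∷ ρ) (suc j)) (λ i b → Sat-graph (ts i) ρ b)

  Sat-plug : ∀ {m n} (φ : Formula m) (ts : Fin m → Term (Fin n)) (ρ : Vector C n) →
             Sat M (plug φ ts) ρ ⇔ Sat M φ (λ i → eval (ts i) ρ)
  Sat-plug {m} {n} φ ts ρ = Sat-∃ⁿ m _ ⇔∘ mk⇔
    (λ (v , g , s) → from (Sat-cong φ (to (gs v) g)) (to (body v) s))
    (λ s → let v = λ i → eval (ts i) ρ in v , from (gs v) (λ i → ≈-refl) , from (body v) s)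
    where
    gs : ∀ v → _
    gs v = ⋀-graphs ts v (v ++ ρ) (_↑ˡ n) (m ↑ʳ_) ρ
      (lookup-++ˡ v ρ) (lookup-++ʳ v ρ) (λ i b → Sat-graph (ts i) ρ b)
    body : ∀ v → _
    body v = Sat-rename (_↑ˡ n) φ ⇔∘ Sat-cong≡ φ (lookup-++ˡ v ρ)

  Sat-compile : ∀ {V n} (φ : Fml V) (σ : V → Term (Fin n)) (ρ : Vector C n) →
                Sat M (compile φ σ) ρ ⇔ Sem φ (λ v → eval (σ v) ρ)
  Sat-compile (eq s t) σ ρ = Sat-plug (zero ≐ suc zero) (bindT σ s ∷ bindT σ t ∷ []) ρ ⇔∘
    ≈-⇔ (eval-bind σ s) (eval-bind σ t)
  Sat-compile (emb φ τ) σ ρ = Sat-plug φ (bindT σ ∘ τ) ρ ⇔∘ Sat-cong φ λ i → eval-bind σ (τ i)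
  Sat-compile (inst φ τ) σ ρ = Sat-compile φ (bindT σ ∘ τ) ρ ⇔∘ Sem-cong φ λ i → eval-bind σ (τ i)
  Sat-compile (φ ∧ᶠ ψ) σ ρ = ×-⇔ (Sat-compile φ σ ρ) (Sat-compile ψ σ ρ)
  Sat-compile (φ ∨ᶠ ψ) σ ρ = ⊎-⇔ (Sat-compile φ σ ρ) (Sat-compile ψ σ ρ)
  Sat-compile (φ ⇒ᶠ ψ) σ ρ = →-⇔ (Sat-compile φ σ ρ) (Sat-compile ψ σ ρ)
  Sat-compile (¬ᶠ φ) σ ρ = →-⇔ (Sat-compile φ σ ρ) ⇔-refl
  Sat-compile (∃ᶠ φ) σ ρ = Σ-⇔ λ a → Sat-compile φ _ (a ∷ ρ) ⇔∘
    Sem-cong φ λ { nothing → ≈-refl ; (just v) → eval-bind (var ∘ suc) (σ v) }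
  Sat-compile (∀ᶠ φ) σ ρ = Π-⇔ λ a → Sat-compile φ _ (a ∷ ρ) ⇔∘
    Sem-cong φ λ { nothing → ≈-refl ; (just v) → eval-bind (var ∘ suc) (σ v) }
  Sat-compile (∃ᶠⁿ d φ) σ ρ = Sat-∃ⁿ d _ ⇔∘ Σ-⇔ λ a → Sat-compile φ _ (a ++ ρ) ⇔∘
    Sem-cong φ λ { (inj₁ i) → ≈-reflexive (lookup-++ˡ a ρ i)
                 ; (inj₂ v) → ≈-trans (eval-bind (var ∘ (d ↑ʳ_)) (σ v))
                     (eval-cong (σ v) λ j → ≈-reflexive (lookup-++ʳ a ρ j)) }
  Sat-compile (∀ᶠⁿ d φ) σ ρ = Sat-∀ⁿ d _ ⇔∘ Π-⇔ λ a → Sat-compile φ _ (a ++ ρ) ⇔∘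
    Sem-cong φ λ { (inj₁ i) → ≈-reflexive (lookup-++ˡ a ρ i)
                 ; (inj₂ v) → ≈-trans (eval-bind (var ∘ (d ↑ʳ_)) (σ v))
                     (eval-cong (σ v) λ j → ≈-reflexive (lookup-++ʳ a ρ j)) }
  Sat-compile (⋁ᶠ d φs) σ ρ = Sat-⋁ d _ ⇔∘ Σ-⇔ λ i → Sat-compile (φs i) σ ρ
  Sat-compile (⋀ᶠ d φs) σ ρ = Sat-⋀ d _ ⇔∘ Π-⇔ λ i → Sat-compile (φs i) σ ρ

  abstract
    Sat-formula : ∀ {V n} (φ : Fml V) (σ : V → Term (Fin n)) (ρ : Vector C n) →
                  Sat M (formula φ σ) ρ ⇔ Sem φ (λ v → eval (σ v) ρ)
    Sat-formula = Sat-compile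

-- The reduction theorem for interpretations and the composite coordinate map

module CompositeCoordMap
  (A B C : Structure) (A-alg : IsSetoidAlgebra A) (B-alg : IsSetoidAlgebra B) (C-alg : IsSetoidAlgebra C)
  (Γ : Interp) (φ : Formula (par Γ)) (Δ : Interp) (ψ : Formula (par Δ)) where

  open Compose Γ φ Δ ψ
  open Translate Δ
  private
    module A = Semantics A A-alg
    module B = Semantics B B-alg
    module C = IsSetoidAlgebra C-alg
    n = dim Γ
    m = par Γ
    d = dim Δ
    q = par Δ

  module Through (z : Vector (Carrier A) q) (c : CoordMap Δ A z B) where
    open CoordMap c

    Represents : Vector (Carrier A) d → Carrier B → Set
    Represents x b = Σ (Sat A (dom Δ) (x ++ z)) λ dx → _≈_ B (π x dx) b

    -- Pointwise equal tuples are not identical, and `π` also takes a proof about its tuple. The two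
    -- images are therefore compared through `eqv Δ`: it relates `x` to itself, and satisfaction is
    -- invariant under pointwise equality.
    Represents-cong : ∀ {x x' b} → (∀ i → x i ≡ x' i) → Represents x b → Represents x' b
    Represents-cong {x} {x'} e (dx , p) = dx' ,
      B.≈-trans (B.≈-sym (to (π-eqv x x' dx dx')
        (to (A.Sat-cong≡ (eqv Δ) (++-cong₂ _≡_ {v = z} (++-cong₂ _≡_ {u = x} (λ _ → refl) e) λ _ → refl))
          (from (π-eqv x x dx dx) B.≈-refl)))) p
      where
      dx' = to (A.Sat-cong≡ (dom Δ) (++-cong₂ _≡_ e λ _ → refl)) dx

    Sat-domAt : ∀ {K} (b : Fin d → Fin K) (pz : Fin q → Fin K) (ρ : Vector (Carrier A) K) →
                (∀ i → ρ (pz i) ≡ z i) → Sat A (domAt b pz) ρ ⇔ Sat A (dom Δ) ((ρ ∘ b) ++ z)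
    Sat-domAt b pz ρ ez = A.Sat-rename (b ++ pz) (dom Δ) ⇔∘ A.Sat-cong≡ (dom Δ) λ i →
      trans (∘-++ ρ b pz i) (++-cong₂ _≡_ (λ _ → refl) ez i)

    -- The reduction theorem, by induction on `χ`. In the quantifier cases `surj` supplies a
    -- representative of an element of `B`, and conversely a tuple in the domain stands for its
    -- image under `π`. Negation and implication go through because the statement is an equivalence.
    Sat-tr : ∀ {k K} (χ : Formula k) (σ : Fin k → Fin d → Fin K) (pz : Fin q → Fin K)
             (ρ : Vector (Carrier A) K) (b : Vector (Carrier B) k) →
             (∀ i → ρ (pz i) ≡ z i) → (∀ i → Represents (ρ ∘ σ i) (b i)) →
             Sat A (tr χ σ pz) ρ ⇔ Sat B χ b
    Sat-tr tt σ pz ρ b ez reps = ⇔-refl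
    Sat-tr ff σ pz ρ b ez reps = ⇔-refl
    Sat-tr (i ≐ j) σ pz ρ b ez reps =
      A.Sat-rename _ (eqv Δ) ⇔∘
      A.Sat-cong≡ (eqv Δ) (λ v → trans (∘-++ ρ (σ i ++ σ j) pz v)
        (++-cong₂ _≡_ (∘-++ ρ (σ i) (σ j)) ez v)) ⇔∘
      π-eqv _ _ (proj₁ (reps i)) (proj₁ (reps j)) ⇔∘
      B.≈-⇔ (proj₂ (reps i)) (proj₂ (reps j))
    Sat-tr (app f xs y) σ pz ρ b ez reps =
      A.Sat-rename _ (rel Δ f) ⇔∘
      A.Sat-cong≡ (rel Δ f) (λ v → trans (∘-++ ρ (concat (σ ∘ xs) ++ σ y) pz v)
        (++-cong₂ _≡_ (∘-++ ρ (concat (σ ∘ xs)) (σ y)) ez v)) ⇔∘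
      π-op f (λ i → ρ ∘ σ (xs i)) (λ i → proj₁ (reps (xs i))) _ (proj₁ (reps y)) ⇔∘
      B.≈-⇔ (B.op-cong f λ i → proj₂ (reps (xs i))) (proj₂ (reps y))
    Sat-tr (χ ∧' χ') σ pz ρ b ez reps = ×-⇔ (Sat-tr χ σ pz ρ b ez reps) (Sat-tr χ' σ pz ρ b ez reps)
    Sat-tr (χ ∨' χ') σ pz ρ b ez reps = ⊎-⇔ (Sat-tr χ σ pz ρ b ez reps) (Sat-tr χ' σ pz ρ b ez reps)
    Sat-tr (χ ⇒' χ') σ pz ρ b ez reps = →-⇔ (Sat-tr χ σ pz ρ b ez reps) (Sat-tr χ' σ pz ρ b ez reps)
    Sat-tr (¬' χ) σ pz ρ b ez reps = →-⇔ (Sat-tr χ σ pz ρ b ez reps) ⇔-refl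
    Sat-tr {K = K} (∃' χ) σ pz ρ b ez reps = A.Sat-∃ⁿ d _ ⇔∘ mk⇔
      (λ (v , dv , s) → let dv' = to (dom-v v) dv in π v dv' , to (ih v (π v dv') (dv' , B.≈-refl)) s)
      (λ (a , s) → let (v , dv , e) = surj a in v , from (dom-v v) dv , from (ih v a (dv , e)) s)
      where
      ez' : ∀ v i → (v ++ ρ) (d ↑ʳ pz i) ≡ z i
      ez' v i = trans (lookup-++ʳ v ρ (pz i)) (ez i)
      dom-v : ∀ v → _ ⇔ Sat A (dom Δ) (v ++ z)
      dom-v v = Sat-domAt (_↑ˡ K) ((d ↑ʳ_) ∘ pz) (v ++ ρ) (ez' v) ⇔∘
        A.Sat-cong≡ (dom Δ) (++-cong₂ _≡_ (lookup-++ˡ v ρ) λ _ → refl)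
      ih : ∀ v a → Represents v a → _ ⇔ Sat B χ (a ∷ b)
      ih v a rep = Sat-tr χ _ _ (v ++ ρ) (a ∷ b) (ez' v)
        λ { zero → Represents-cong (λ j → sym (lookup-++ˡ v ρ j)) rep
          ; (suc i) → Represents-cong (λ j → sym (lookup-++ʳ v ρ (σ i j))) (reps i) }
    Sat-tr {K = K} (∀' χ) σ pz ρ b ez reps = A.Sat-∀ⁿ d _ ⇔∘ mk⇔
      (λ s a → let (v , dv , e) = surj a in to (ih v a (dv , e)) (s v (from (dom-v v) dv)))
      (λ s v dv → let dv' = to (dom-v v) dv in from (ih v (π v dv') (dv' , B.≈-refl)) (s (π v dv')))
      where
      ez' : ∀ v i → (v ++ ρ) (d ↑ʳ pz i) ≡ z i
      ez' v i = trans (lookup-++ʳ v ρ (pz i)) (ez i)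
      dom-v : ∀ v → _ ⇔ Sat A (dom Δ) (v ++ z)
      dom-v v = Sat-domAt (_↑ˡ K) ((d ↑ʳ_) ∘ pz) (v ++ ρ) (ez' v) ⇔∘
        A.Sat-cong≡ (dom Δ) (++-cong₂ _≡_ (lookup-++ˡ v ρ) λ _ → refl)
      ih : ∀ v a → Represents v a → _ ⇔ Sat B χ (a ∷ b)
      ih v a rep = Sat-tr χ _ _ (v ++ ρ) (a ∷ b) (ez' v)
        λ { zero → Represents-cong (λ j → sym (lookup-++ˡ v ρ j)) rep
          ; (suc i) → Represents-cong (λ j → sym (lookup-++ʳ v ρ (σ i j))) (reps i) }

  module _ (r : Vector (Carrier A) P) where
    objectParams : Vector (Carrier A) q
    objectParams i = r (i ↑ˡ (m ℕ.* d))

    codedParams : Vector (Vector (Carrier A) d) m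
    codedParams p j = r (q ↑ʳ combine p j)

    module _ (c₁ : CoordMap Δ A objectParams B) (bp : Vector (Carrier B) m)
             (params : ∀ p → Through.Represents objectParams c₁ (codedParams p) (bp p))
             (c₂ : CoordMap Γ B bp C) where
      open Through objectParams c₁
      private
        module c₁ = CoordMap c₁
        module c₂ = CoordMap c₂
        N = n ℕ.* d

        z-eq : ∀ {K} (x : Vector (Carrier A) K) i → (x ++ r) (zIx {K} i) ≡ objectParams i
        z-eq x i = lookup-++ʳ x r (i ↑ˡ (m ℕ.* d))

        y-rep : ∀ {K} (x : Vector (Carrier A) K) p → Represents ((x ++ r) ∘ yIx {K} p) (bp p)
        y-rep x p = Represents-cong (λ j → sym (lookup-++ʳ x r (q ↑ʳ combine p j))) (params p)

        Blocks : Vector (Carrier A) N → Vector (Carrier B) n → Set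
        Blocks x b = ∀ i → Represents (blocks x i) (b i)

        dom-rep : ∀ x b → Blocks x b → ∀ v → Represents ((x ++ r) ∘ σdom v) ((b ++ bp) v)
        dom-rep x b xb v with splitAt n v
        ... | inj₁ i = Represents-cong (λ j → sym (lookup-++ˡ x r (combine i j))) (xb i)
        ... | inj₂ p = y-rep x p

        eqv-rep : ∀ x x' b b' → Blocks x b → Blocks x' b' → ∀ v →
                  Represents (((x ++ x') ++ r) ∘ σeqv v) (((b ++ b') ++ bp) v)
        eqv-rep x x' b b' xb xb' v with splitAt (n ℕ.+ n) v
        ... | inj₂ p = y-rep (x ++ x') p
        ... | inj₁ w with splitAt n w
        ...   | inj₁ i = Represents-cong (λ j → sym (trans
                (lookup-++ˡ (x ++ x') r (combine i j ↑ˡ N)) (lookup-++ˡ x x' (combine i j)))) (xb i)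
        ...   | inj₂ i = Represents-cong (λ j → sym (trans
                (lookup-++ˡ (x ++ x') r (N ↑ʳ combine i j)) (lookup-++ʳ x x' (combine i j)))) (xb' i)

        rel-rep : ∀ f xs x bs b → (∀ i → Blocks (xs i) (bs i)) → Blocks x b → ∀ v →
                  Represents (((concat {n = arity f} xs ++ x) ++ r) ∘ σrel f v)
                             (((concat {n = arity f} bs ++ b) ++ bp) v)
        rel-rep f xs x bs b xbs xb v with splitAt (arity f ℕ.* n ℕ.+ n) v
        ... | inj₂ p = y-rep (concat xs ++ x) p
        ... | inj₁ w with splitAt (arity f ℕ.* n) w
        ...   | inj₂ i = Represents-cong (λ j → sym (trans
                (lookup-++ˡ (concat xs ++ x) r ((arity f ℕ.* N) ↑ʳ combine i j))
                (lookup-++ʳ (concat xs) x (combine i j)))) (xb i)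
        ...   | inj₁ u = Represents-cong (λ j → sym (trans
                (lookup-++ˡ (concat xs ++ x) r (combine l (combine i j) ↑ˡ N)) (trans
                (lookup-++ˡ (concat xs) x (combine l (combine i j)))
                (concat-combine xs l (combine i j))))) (xbs l i)
          where
          l = proj₂ (quotRem {arity f} n u)
          i = proj₁ (quotRem {arity f} n u)

      module _ (x : Vector (Carrier A) N) (D : Sat A (dom ΓΔ) (x ++ r)) where
        block-dom : ∀ i → Sat A (dom Δ) (blocks x i ++ objectParams)
        block-dom i = to (A.Sat-cong≡ (dom Δ) (++-cong₂ _≡_ (λ j → lookup-++ˡ x r (combine i j)) λ _ → refl))
          (to (Sat-domAt (λ j → combine i j ↑ˡ P) (zIx {N}) (x ++ r) (z-eq x))
            (to (A.Sat-⋀ n (λ i → domAt (λ j → combine i j ↑ˡ P) (zIx {N}))) (proj₁ D) i))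

        values : Vector (Carrier B) n
        values i = c₁.π (blocks x i) (block-dom i)

        values-rep : Blocks x values
        values-rep i = block-dom i , B.≈-refl

        values-dom : Sat B (dom Γ) (values ++ bp)
        values-dom = to (Sat-tr (dom Γ) σdom (zIx {N}) (x ++ r) (values ++ bp) (z-eq x)
                          (dom-rep x values values-rep)) (proj₂ D)

      -- The same detour as in `Represents-cong`: `eqv Γ` relates `b` to itself and is invariant
      -- under the equality of `B` in each coordinate.
      c₂-π-cong : ∀ b b' db db' → (∀ i → _≈_ B (b i) (b' i)) → _≈_ C (c₂.π b db) (c₂.π b' db')
      c₂-π-cong b b' db db' e = to (c₂.π-eqv b b' db db')
        (to (B.Sat-cong (eqv Γ) (++-cong₂ (_≈_ B) {v = bp} (++-cong₂ (_≈_ B) {u = b} (λ _ → B.≈-refl) e) λ _ → B.≈-refl))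
          (from (c₂.π-eqv b b db db) C.≈-refl))

      compositeMap : CoordMap ΓΔ A r C
      compositeMap = record
        { π = λ x D → c₂.π (values x D) (values-dom x D)
        ; surj = surj
        ; π-eqv = λ x x' D D' →
            Sat-tr (eqv Γ) σeqv (zIx {N ℕ.+ N}) ((x ++ x') ++ r) _ (z-eq (x ++ x'))
              (eqv-rep x x' _ _ (values-rep x D) (values-rep x' D')) ⇔∘
            c₂.π-eqv _ _ (values-dom x D) (values-dom x' D')
        ; π-op = λ f xs Ds x D →
            Sat-tr (rel Γ f) (σrel f) (zIx {arity f ℕ.* N ℕ.+ N}) ((concat xs ++ x) ++ r) _
              (z-eq (concat xs ++ x))
              (rel-rep f xs x (λ i → values (xs i) (Ds i)) _ (λ i → values-rep (xs i) (Ds i)) (values-rep x D)) ⇔∘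
            c₂.π-op f _ (λ i → values-dom (xs i) (Ds i)) _ (values-dom x D)
        }
        where
        surj : ∀ a → Σ (Vector (Carrier A) N) λ x → Σ (Sat A (dom ΓΔ) (x ++ r)) λ D →
               _≈_ C (c₂.π (values x D) (values-dom x D)) a
        surj a = x , D , C.≈-trans (c₂-π-cong _ b _ db values≈b) e
          where
          b = proj₁ (c₂.surj a)
          db = proj₁ (proj₂ (c₂.surj a))
          e = proj₂ (proj₂ (c₂.surj a))
          -- Representatives of the coordinates of `b`, laid side by side. The composite map
          -- recomputes the values from `D`; these agree with `b` only up to the equality of `B`,
          -- which `c₂-π-cong` absorbs.
          x = concat λ i → proj₁ (c₁.surj (b i))
          xb : Blocks x b
          xb i = Represents-cong (λ j → sym (concat-combine (λ i → proj₁ (c₁.surj (b i))) i j)) (proj₂ (c₁.surj (b i)))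
          D : Sat A (dom ΓΔ) (x ++ r)
          D = from (A.Sat-⋀ n (λ i → domAt (λ j → combine i j ↑ˡ P) (zIx {N})))
                (λ i → from (Sat-domAt (λ j → combine i j ↑ˡ P) (zIx {N}) (x ++ r) (z-eq x))
                  (to (A.Sat-cong≡ (dom Δ) (++-cong₂ _≡_ (λ j → sym (lookup-++ˡ x r (combine i j))) λ _ → refl))
                    (proj₁ (xb i)))) ,
              from (Sat-tr (dom Γ) σdom (zIx {N}) (x ++ r) (b ++ bp) (z-eq x) (dom-rep x b xb)) db
          values≈b : ∀ i → _≈_ B (values x D i) (b i)
          values≈b i = B.≈-trans
            (to (c₁.π-eqv _ _ (block-dom x D i) (proj₁ (xb i)))
              (from (c₁.π-eqv _ _ (block-dom x D i) (block-dom x D i)) B.≈-refl))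
            (proj₂ (xb i))

-- That θ(ū , x ; p̄) defines a coordinate map is itself a first-order property of p̄.

module CoordMapFormula (Λ : Interp) (θ : Formula (dim Λ ℕ.+ 1 ℕ.+ par Λ)) where
  private
    n = dim Λ
    P = par Λ

  domᶠ : {V : Set} → (Fin n → Term V) → (Fin P → Term V) → Fml V
  domᶠ u p = emb (dom Λ) (u ++ p)

  eqvᶠ : {V : Set} → (Fin n → Term V) → (Fin n → Term V) → (Fin P → Term V) → Fml V
  eqvᶠ u u' p = emb (eqv Λ) ((u ++ u') ++ p)

  relᶠ : {V : Set} (f : Op) → (Fin (arity f ℕ.* n) → Term V) → (Fin n → Term V) → (Fin P → Term V) → Fml V
  relᶠ f us u p = emb (rel Λ f) ((us ++ u) ++ p)

  θᶠ : {V : Set} → (Fin n → Term V) → Term V → (Fin P → Term V) → Fml V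
  θᶠ u a p = emb θ ((u ++ (a ∷ [])) ++ p)

  infix 1 _⇔ᶠ_
  _⇔ᶠ_ : {V : Set} → Fml V → Fml V → Fml V
  χ ⇔ᶠ χ' = (χ ⇒ᶠ χ') ∧ᶠ (χ' ⇒ᶠ χ)

  totalᶠ functionalᶠ surjectiveᶠ respects-eqvᶠ : Fml (Fin P)
  totalᶠ = ∀ᶠⁿ n (domᶠ (var ∘ inj₁) (var ∘ inj₂) ⇒ᶠ
    ∃ᶠ (θᶠ (var ∘ just ∘ inj₁) (var nothing) (var ∘ just ∘ inj₂)))
  functionalᶠ = ∀ᶠⁿ n (domᶠ (var ∘ inj₁) (var ∘ inj₂) ⇒ᶠ
    ∀ᶠ (∀ᶠ (θᶠ (var ∘ just ∘ just ∘ inj₁) (var (just nothing)) (var ∘ just ∘ just ∘ inj₂) ⇒ᶠ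
      θᶠ (var ∘ just ∘ just ∘ inj₁) (var nothing) (var ∘ just ∘ just ∘ inj₂) ⇒ᶠ
      eq (var (just nothing)) (var nothing))))
  surjectiveᶠ = ∀ᶠ (∃ᶠⁿ n (domᶠ (var ∘ inj₁) (var ∘ inj₂ ∘ just) ∧ᶠ
    θᶠ (var ∘ inj₁) (var (inj₂ nothing)) (var ∘ inj₂ ∘ just)))
  respects-eqvᶠ = ∀ᶠⁿ n (∀ᶠⁿ n (∀ᶠ (∀ᶠ (
    let u = var ∘ just ∘ just ∘ inj₂ ∘ inj₁
        u' = var ∘ just ∘ just ∘ inj₁
        a = var (just nothing)
        a' = var nothing
        p = var ∘ just ∘ just ∘ inj₂ ∘ inj₂
    in domᶠ u p ⇒ᶠ domᶠ u' p ⇒ᶠ θᶠ u a p ⇒ᶠ θᶠ u' a' p ⇒ᶠ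
       (eqvᶠ u u' p ⇔ᶠ eq a a')))))

  -- The arguments are quantified as one tuple of length `arity f * n`, the shape that `rel`
  -- receives, and are cut into blocks for the other conditions.
  respects-opᶠ : Op → Fml (Fin P)
  respects-opᶠ f = ∀ᶠⁿ (arity f ℕ.* n) (∀ᶠⁿ n (∀ᶠⁿ (arity f) (∀ᶠ (
    let us = var ∘ just ∘ inj₂ ∘ inj₂ ∘ inj₁
        u = var ∘ just ∘ inj₂ ∘ inj₁
        as = var ∘ just ∘ inj₁
        a = var nothing
        p = var ∘ just ∘ inj₂ ∘ inj₂ ∘ inj₂
    in ⋀ᶠ (arity f) (λ i → domᶠ (blocks us i) p) ⇒ᶠ domᶠ u p ⇒ᶠ
       ⋀ᶠ (arity f) (λ i → θᶠ (blocks us i) (as i) p) ⇒ᶠ θᶠ u a p ⇒ᶠ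
       (relᶠ f us u p ⇔ᶠ eq (op f as) a)))))

  coordMapᶠ : Fml (Fin P)
  coordMapᶠ = totalᶠ ∧ᶠ functionalᶠ ∧ᶠ surjectiveᶠ ∧ᶠ respects-eqvᶠ ∧ᶠ respects-opᶠ add ∧ᶠ
    respects-opᶠ mul ∧ᶠ respects-opᶠ neg ∧ᶠ respects-opᶠ zer ∧ᶠ respects-opᶠ one

  module _ (M : Structure) (alg : IsSetoidAlgebra M) where
    open Semantics M alg
    open RichSemantics M
    private
      C = Carrier M
      infix 4 _~_
      _~_ = _≈_ M

    module _ {V : Set} (ρ : V → C) where
      ⟪_⟫ : {m : ℕ} → (Fin m → Term V) → Vector C m
      ⟪ ts ⟫ i = eval (ts i) ρ

      Sem-dom : ∀ u p → Sem (domᶠ u p) ρ ⇔ Sat M (dom Λ) (⟪ u ⟫ ++ ⟪ p ⟫)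
      Sem-dom u p = Sat-cong≡ (dom Λ) (∘-++ (λ t → eval t ρ) u p)

      Sem-θ : ∀ u a p → Sem (θᶠ u a p) ρ ⇔ Sat M θ ((⟪ u ⟫ ++ (eval a ρ ∷ [])) ++ ⟪ p ⟫)
      Sem-θ u a p = Sat-cong≡ θ λ i → trans (∘-++ (λ t → eval t ρ) (u ++ (a ∷ [])) p i)
        (++-cong₂ _≡_ (λ j → trans (∘-++ (λ t → eval t ρ) u (a ∷ []) j)
          (++-cong₂ _≡_ {u = ⟪ u ⟫} (λ _ → refl) (λ { zero → refl }) j)) (λ _ → refl) i)

      Sem-eqv : ∀ u u' p → Sem (eqvᶠ u u' p) ρ ⇔ Sat M (eqv Λ) ((⟪ u ⟫ ++ ⟪ u' ⟫) ++ ⟪ p ⟫)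
      Sem-eqv u u' p = Sat-cong≡ (eqv Λ) λ i → trans (∘-++ (λ t → eval t ρ) (u ++ u') p i)
        (++-cong₂ _≡_ (∘-++ (λ t → eval t ρ) u u') (λ _ → refl) i)

      Sem-rel : ∀ f us u p → Sem (relᶠ f us u p) ρ ⇔
                Sat M (rel Λ f) ((concat {n = arity f} (blocks ⟪ us ⟫) ++ ⟪ u ⟫) ++ ⟪ p ⟫)
      Sem-rel f us u p = Sat-cong≡ (rel Λ f) λ i → trans (∘-++ (λ t → eval t ρ) (us ++ u) p i)
        (++-cong₂ _≡_ (λ j → trans (∘-++ (λ t → eval t ρ) us u j)
          (++-cong₂ _≡_ {v = ⟪ u ⟫} (λ k → sym (concat-blocks {m = n} {arity f} ⟪ us ⟫ k)) (λ _ → refl) j))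
          (λ _ → refl) i)

    definesCoordMap⇒Sem : ∀ p → DefinesCoordMap Λ M p θ → Sem coordMapᶠ p
    definesCoordMap⇒Sem p (c , θ⇔π) =
      (λ u d → let d' = to (Sem-dom _ _ _) d in π u d' , from (Sem-θ _ _ _ _) (from (θ⇔π u d' _) ≈-refl)) ,
      (λ u d a a' s s' → let d' = to (Sem-dom _ _ _) d in
        ≈-trans (≈-sym (Θ u d' a (to (Sem-θ _ _ _ _) s))) (Θ u d' a' (to (Sem-θ _ _ _ _) s'))) ,
      (λ a → let (u , d , e) = surj a in u , from (Sem-dom _ _ _) d , from (Sem-θ _ _ _ _) (from (θ⇔π u d a) e)) ,
      (λ u u' a a' d d' s s' →
        let e = eqv⇔ u u' a a' (to (Sem-dom _ _ _) d) (to (Sem-dom _ _ _) d')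
                  (to (Sem-θ _ _ _ _) s) (to (Sem-θ _ _ _ _) s')
        in (to e ∘ to (Sem-eqv _ _ _ _)) , (from (Sem-eqv _ _ _ _) ∘ from e)) ,
      ops add , ops mul , ops neg , ops zer , ops one
      where
      open CoordMap c
      Θ : ∀ u d a → Sat M θ ((u ++ (a ∷ [])) ++ p) → π u d ~ a
      Θ u d a = to (θ⇔π u d a)
      eqv⇔ : ∀ u u' a a' (d : Sat M (dom Λ) (u ++ p)) (d' : Sat M (dom Λ) (u' ++ p)) →
             Sat M θ ((u ++ (a ∷ [])) ++ p) → Sat M θ ((u' ++ (a' ∷ [])) ++ p) →
             Sat M (eqv Λ) ((u ++ u') ++ p) ⇔ a ~ a'
      eqv⇔ u u' a a' d d' s s' = π-eqv u u' d d' ⇔∘ ≈-⇔ (Θ u d a s) (Θ u' d' a' s')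
      ops : ∀ f → Sem (respects-opᶠ f) p
      ops f us u as a ds d ss s = (to e ∘ to (Sem-rel _ f _ _ _)) , (from (Sem-rel _ f _ _ _) ∘ from e)
        where
        e = π-op f (blocks us) (λ i → to (Sem-dom _ _ _) (ds i)) u (to (Sem-dom _ _ _) d) ⇔∘
          ≈-⇔ (op-cong f λ i → Θ _ _ _ (to (Sem-θ _ _ _ _) (ss i))) (Θ _ _ _ (to (Sem-θ _ _ _ _) s))

    -- A proof of `totalᶠ` is a function together with its witnesses, so `π` is a first projection
    -- and nothing is chosen. `functionalᶠ` then makes θ the graph of `π`.
    Sem⇒definesCoordMap : ∀ p → Sem coordMapᶠ p → DefinesCoordMap Λ M p θ
    Sem⇒definesCoordMap p (total , functional , surjective , r-eqv , r-add , r-mul , r-neg , r-zer , r-one) =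
      record
        { π = π
        ; surj = λ a → let (u , d , s) = surjective a
                           d' = to (Sem-dom [ u , _ ]′ _ _) d
                       in u , d' , functional u (from (Sem-dom [ u , p ]′ _ _) d') _ _
                            (from (Sem-θ (maybe′ (maybe′ [ u , p ]′ _) _) _ _ _) (πΘ u d'))
                            (from (Sem-θ (maybe′ (maybe′ [ u , p ]′ _) a) _ _ _)
                              (to (Sem-θ [ u , maybe′ p a ]′ _ _ _) s))
        ; π-eqv = λ u u' d d' →
            let ρ = maybe′ (maybe′ [ u' , [ u , p ]′ ]′ (π u d)) (π u' d')
                e = r-eqv u u' (π u d) (π u' d') (from (Sem-dom ρ _ _) d) (from (Sem-dom ρ _ _) d')
                     (from (Sem-θ ρ _ _ _) (πΘ u d)) (from (Sem-θ ρ _ _ _) (πΘ u' d'))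
            in mk⇔ (proj₁ e ∘ from (Sem-eqv ρ _ _ _)) (to (Sem-eqv ρ _ _ _) ∘ proj₂ e)
        ; π-op = ops
        } , λ u d a → mk⇔
          (λ s → functional u (from (Sem-dom [ u , p ]′ _ _) d) _ _
            (from (Sem-θ (maybe′ (maybe′ [ u , p ]′ _) _) _ _ _) (πΘ u d))
            (from (Sem-θ (maybe′ (maybe′ [ u , p ]′ _) a) _ _ _) s))
          (λ e → to (Sat-cong θ (++-cong₂ _~_ (++-cong₂ _~_ {u = u} (λ _ → ≈-refl) λ { zero → e }) λ _ → ≈-refl))
            (πΘ u d))
      where
      π : (u : Vector C n) → Sat M (dom Λ) (u ++ p) → C
      π u d = proj₁ (total u (from (Sem-dom [ u , p ]′ _ _) d))
      πΘ : ∀ u d → Sat M θ ((u ++ (π u d ∷ [])) ++ p)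
      πΘ u d = to (Sem-θ (maybe′ [ u , p ]′ (π u d)) _ _ _) (proj₂ (total u (from (Sem-dom [ u , p ]′ _ _) d)))
      r-op : ∀ f → Sem (respects-opᶠ f) p
      r-op add = r-add
      r-op mul = r-mul
      r-op neg = r-neg
      r-op zer = r-zer
      r-op one = r-one
      ops : ∀ f xs ds x d → Sat M (rel Λ f) ((concat {n = arity f} xs ++ x) ++ p) ⇔
                            ⟦_⟧ M f (λ i → π (xs i) (ds i)) ~ π x d
      ops f xs ds x d = mk⇔
        (λ s → proj₁ e (from (Sem-rel ρ f _ _ _) (from blk s)))
        (λ s → to blk (to (Sem-rel ρ f _ _ _) (proj₂ e s)))
        where
        us = concat {n = arity f} xs
        as = λ i → π (xs i) (ds i)
        ρ = maybe′ [ as , [ x , [ us , p ]′ ]′ ]′ (π x d)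
        blk : Sat M (rel Λ f) ((concat {n = arity f} (blocks us) ++ x) ++ p) ⇔
              Sat M (rel Λ f) ((us ++ x) ++ p)
        blk = Sat-cong≡ (rel Λ f) (++-cong₂ _≡_ (++-cong₂ _≡_ {v = x}
          (concat-blocks {m = n} {arity f} us) λ _ → refl) λ _ → refl)
        blocks-us : ∀ i j → xs i j ≡ blocks {m = n} {arity f} us i j
        blocks-us i j = sym (concat-combine xs i j)
        e = r-op f us x as (π x d)
          (λ i → from (Sem-dom ρ _ _) (to (Sat-cong≡ (dom Λ) (++-cong₂ _≡_ (blocks-us i) λ _ → refl)) (ds i)))
          (from (Sem-dom ρ _ _) d)
          (λ i → from (Sem-θ ρ _ _ _) (to (Sat-cong≡ θ
            (++-cong₂ _≡_ (++-cong₂ _≡_ {v = as i ∷ []} (blocks-us i) λ _ → refl) λ _ → refl)) (πΘ (xs i) (ds i))))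
          (from (Sem-θ ρ _ _ _) (πΘ x d))

-- Finite subsets of ℤ² as uniformly definable sets

infix 4 _∣ᶻ_
_∣ᶻ_ : ℤ → ℤ → Set
d ∣ᶻ x = Σ ℤ λ q → x ≡ d * q

-- An injection of ℤ into the nonzero integers: every integer, 0 included, is bounded once its image
-- divides a nonzero `D`.
odd : ℤ → ℤ
odd x = x + x + 1ℤ

odd≢0 : ∀ x → ¬ odd x ≡ 0ℤ
odd≢0 (+ n) p with trans (sym (ℕ.+-comm (n ℕ.+ n) 1)) (ℤ.+-injective p)
... | ()
odd≢0 -[1+ n ] ()

odd-injective : ∀ x y → odd x ≡ odd y → x ≡ y
odd-injective x y p = ℤ.*-cancelˡ-≡ (+ 2) x y
  (trans (double x) (trans (cong (_+ - 1ℤ) p) (sym (double y))))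
  where
  double : ∀ x → + 2 * x ≡ (x + x + 1ℤ) + - 1ℤ
  double = solve-∀

∣ᶻ⇒∣∣≤∣∣ : ∀ d {x} → ¬ x ≡ 0ℤ → d ∣ᶻ x → ∣ d ∣ ℕ.≤ ∣ x ∣
∣ᶻ⇒∣∣≤∣∣ d x≢0 (q , refl) = subst (∣ d ∣ ℕ.≤_) (sym (ℤ.abs-* d q))
  (ℕ.m≤m*n ∣ d ∣ ∣ q ∣ {{ℕ.≢-nonZero λ q≡0 → x≢0
    (trans (cong (d *_) (ℤ.∣i∣≡0⇒i≡0 q≡0)) (ℤ.*-zeroʳ d))}})

Comaximal : ℤ → ℤ → Set
Comaximal p q = Σ ℤ λ x → Σ ℤ λ y → x * p + y * q ≡ 1ℤ

-- Multiply the two Bézout identities; every term except the one in q * r contains `p`.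
comaximal-* : ∀ {p q r} → Comaximal p q → Comaximal p r → Comaximal p (q * r)
comaximal-* {p} {q} {r} (x , y , e) (x' , y' , e') =
  x * x' * p + x * y' * r + y * q * x' , y * y' ,
  trans (expand x y x' y' p q r) (cong₂ _*_ e e')
  where
  expand : ∀ x y x' y' p q r → (x * x' * p + x * y' * r + y * q * x') * p + y * y' * (q * r) ≡
                               (x * p + y * q) * (x' * p + y' * r)
  expand = solve-∀

comaximal-∣ : ∀ {p q} → Comaximal p q → p ∣ᶻ q → ∣ p ∣ ≡ 1
comaximal-∣ {p} (x , y , e) (k , refl) = ℕ∣.∣1⇒≡1 (ℕ∣.divides ∣ x + y * k ∣ (sym
  (trans (sym (ℤ.abs-* (x + y * k) p)) (cong ∣_∣ (trans (factor x y k p) e)))))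
  where
  factor : ∀ x y k p → (x + y * k) * p ≡ x * p + y * (p * k)
  factor = solve-∀

-- Gödel's moduli: if c - c' divides b, then 1 + bc and 1 + bc' are comaximal.
gödel-comaximal : ∀ b c c' → (c + - c') ∣ᶻ b → Comaximal (1ℤ + b * c) (1ℤ + b * c')
gödel-comaximal b c c' (z , e) = 1ℤ + c * z * c' , - (c * z * c) ,
  trans (expand b c c' z) (trans (cong (λ t → 1ℤ + b * c + - (c * t)) (sym e)) (collapse b c))
  where
  expand : ∀ b c c' z → (1ℤ + c * z * c') * (1ℤ + b * c) + - (c * z * c) * (1ℤ + b * c') ≡
                        1ℤ + b * c + - (c * ((c + - c') * z))
  expand = solve-∀
  collapse : ∀ b c → 1ℤ + b * c + - (c * b) ≡ 1ℤ
  collapse = solve-∀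

∣x∣≤X⇒x∣X! : ∀ X x → ¬ x ≡ 0ℤ → ∣ x ∣ ℕ.≤ X → x ∣ᶻ (+ (X ℕ.!))
∣x∣≤X⇒x∣X! X x x≢0 x≤X with ℕ∣.∣-trans (n∣n! ∣ x ∣ (x≢0 ∘ ℤ.∣i∣≡0⇒i≡0)) (ℕ∣.m≤n⇒m!∣n! x≤X)
  where
  n∣n! : ∀ n → ¬ n ≡ 0 → n ℕ∣.∣ n ℕ.!
  n∣n! zero n≢0 = ⊥-elim (n≢0 refl)
  n∣n! (suc n) _ = ℕ∣.m∣m*n (n ℕ.!)
... | ℕ∣.divides q e = quotient x refl
  where
  quotient : ∀ y → y ≡ x → x ∣ᶻ (+ (X ℕ.!))
  quotient (+ n) refl = + q , trans (cong +_ (trans e (ℕ.*-comm q n))) (ℤ.pos-* n q)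
  quotient -[1+ n ] refl = - + q , trans (cong +_ e)
    (trans (ℤ.pos-* q (suc n)) (move (+ q) (+ suc n)))
    where
    move : ∀ a b → a * b ≡ - b * - a
    move = solve-∀

-- A multiple of `e` of absolute value below `e` is 0. Every uniqueness of expansions below rests on
-- this: for coded pairs, for the digits of programs, for exponent vectors and for the coefficients
-- of a polynomial at a large point.
small-combination : ∀ (e : ℕ) x y → ∣ x ∣ ℕ.< e → x + + e * y ≡ 0ℤ → y ≡ 0ℤ × x ≡ 0ℤ
small-combination e x y x<e p = y≡0 , x≡0
  where
  isolate : ∀ x t → x ≡ - t + (x + t)
  isolate = solve-∀
  x≡ : x ≡ - (+ e * y)
  x≡ = trans (isolate x (+ e * y)) (trans (cong (λ s → - (+ e * y) + s) p) (ℤ.+-identityʳ _))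
  ∣x∣≡ : ∣ x ∣ ≡ e ℕ.* ∣ y ∣
  ∣x∣≡ = trans (cong ∣_∣ x≡) (trans (ℤ.∣-i∣≡∣i∣ (+ e * y)) (ℤ.abs-* (+ e) y))
  y≡0 : y ≡ 0ℤ
  y≡0 with ∣ y ∣ ℕ.≟ 0
  ... | yes q = ℤ.∣i∣≡0⇒i≡0 q
  ... | no q = ⊥-elim (ℕ.<⇒≱ x<e (subst (e ℕ.≤_) (sym ∣x∣≡) (ℕ.m≤m*n e ∣ y ∣ {{ℕ.≢-nonZero q}})))
  x≡0 : x ≡ 0ℤ
  x≡0 = trans x≡ (trans (cong (λ t → - (+ e * t)) y≡0) (cong -_ (ℤ.*-zeroʳ (+ e))))

-- For nonzero `D` the first two conditions confine the pair to a finite box. The pair is merged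
-- into the single number `odd u + e * odd v`, and its Gödel modulus is tested as a divisor of `a`.
-- Only divisibilities occur, so membership is first order.
Member : (D e b a u v : ℤ) → Set
Member D e b a u v = odd u ∣ᶻ D × odd v ∣ᶻ D × (1ℤ + b * (odd u + e * odd v)) ∣ᶻ a

∣i+j∣≤ : ∀ i j {m n} → ∣ i ∣ ℕ.≤ m → ∣ j ∣ ℕ.≤ n → ∣ i + j ∣ ℕ.≤ m ℕ.+ n
∣i+j∣≤ i j p q = ℕ.≤-trans (ℤ.∣i+j∣≤∣i∣+∣j∣ i j) (ℕ.+-mono-≤ p q)

∣i-j∣≤ : ∀ i j {m n} → ∣ i ∣ ℕ.≤ m → ∣ j ∣ ℕ.≤ n → ∣ i + - j ∣ ℕ.≤ m ℕ.+ n
∣i-j∣≤ i j {n = n} p q = ∣i+j∣≤ i (- j) p (subst (ℕ._≤ n) (sym (ℤ.∣-i∣≡∣i∣ j)) q)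

productOver : {A : Set} → (A → ℤ) → List A → ℤ
productOver f L.[] = 1ℤ
productOver f (x L.∷ xs) = f x * productOver f xs

∈⇒∣productOver : {A : Set} (f : A → ℤ) {x : A} (xs : List A) → x ∈ xs → f x ∣ᶻ productOver f xs
∈⇒∣productOver f (x L.∷ xs) (here refl) = productOver f xs , refl
∈⇒∣productOver f {x} (y L.∷ xs) (there x∈xs) =
  let (q , e) = ∈⇒∣productOver f xs x∈xs
  in f y * q , trans (cong (f y *_) e) (swap (f y) (f x) q)
  where
  swap : ∀ a b c → a * (b * c) ≡ b * (a * c)
  swap = solve-∀

productOver≢0 : {A : Set} (f : A → ℤ) → (∀ x → ¬ f x ≡ 0ℤ) → ∀ xs → ¬ productOver f xs ≡ 0ℤ
productOver≢0 f f≢0 (x L.∷ xs) p with ℤ.i*j≡0⇒i≡0∨j≡0 (f x) p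
... | inj₁ q = f≢0 x q
... | inj₂ q = productOver≢0 f f≢0 xs q

comaximal-productOver : {A : Set} (f : A → ℤ) (p : ℤ) (xs : List A) →
                        (∀ {x} → x ∈ xs → Comaximal p (f x)) → Comaximal p (productOver f xs)
comaximal-productOver f p L.[] h = 0ℤ , 1ℤ , refl
comaximal-productOver f p (x L.∷ xs) h =
  comaximal-* (h (here refl)) (comaximal-productOver f p xs (h ∘ there))

-- D bounds the box from which the elements are taken; within it the numbers
-- odd u + e * odd v are distinct and nonzero, and b is divisible by all their differences.
module FiniteSetCode (S : List (ℤ × ℤ)) where
  D : ℤ
  D = productOver (λ (u , v) → odd u * odd v) S

  -- `Y` bounds the weights on the box and `Y + Y` their differences. The summand 3 makes the
  -- factorial `b` at least 3, so that 1 + bc is not a unit for c ≠ 0. The factor `e` is 2B + 1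
  -- because two first entries differ by at most 2B.
  B Y X : ℕ
  B = ∣ D ∣
  Y = B ℕ.+ suc (B ℕ.+ B) ℕ.* B
  X = 3 ℕ.+ (Y ℕ.+ Y)

  e b : ℤ
  e = + suc (B ℕ.+ B)
  b = + (X ℕ.!)

  weight : ℤ × ℤ → ℤ
  weight (u , v) = odd u + e * odd v

  modulus : ℤ × ℤ → ℤ
  modulus s = 1ℤ + b * weight s

  a : ℤ
  a = productOver modulus S

  D≢0 : ¬ D ≡ 0ℤ
  D≢0 = productOver≢0 _ (λ (u , v) p → [ odd≢0 u , odd≢0 v ]′ (ℤ.i*j≡0⇒i≡0∨j≡0 (odd u) p)) S

  complete : ∀ {u v} → (u , v) ∈ S → Member D e b a u v
  complete {u} {v} s∈S with ∈⇒∣productOver (λ (u , v) → odd u * odd v) S s∈S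
  ... | q , p = (odd v * q , trans p (ℤ.*-assoc (odd u) (odd v) q)) ,
                (odd u * q , trans p (swap (odd u) (odd v) q)) ,
                ∈⇒∣productOver modulus S s∈S
    where
    swap : ∀ a b c → a * b * c ≡ b * (a * c)
    swap = solve-∀

  InBox : ℤ → Set
  InBox u = ∣ odd u ∣ ℕ.≤ B

  weight-bound : ∀ u v → InBox u → InBox v → ∣ weight (u , v) ∣ ℕ.≤ Y
  weight-bound u v hu hv = ∣i+j∣≤ (odd u) (e * odd v) hu
    (subst (ℕ._≤ suc (B ℕ.+ B) ℕ.* B) (sym (ℤ.abs-* e (odd v))) (ℕ.*-monoʳ-≤ (suc (B ℕ.+ B)) hv))

  weight≢0 : ∀ u v → InBox u → ¬ weight (u , v) ≡ 0ℤ
  weight≢0 u v hu p = odd≢0 v (proj₁ (small-combination (suc (B ℕ.+ B)) (odd u) (odd v)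
    (s≤s (ℕ.≤-trans hu (ℕ.m≤m+n B B))) p))

  weight-injective : ∀ u v u' v' → InBox u → InBox u' →
                     weight (u , v) + - weight (u' , v') ≡ 0ℤ → (u , v) ≡ (u' , v')
  weight-injective u v u' v' hu hu' p =
    let (q , r) = small-combination (suc (B ℕ.+ B)) (odd u + - odd u') (odd v + - odd v')
                    (s≤s (∣i-j∣≤ (odd u) (odd u') hu hu'))
                    (trans (regroup (odd u) (odd u') (odd v) (odd v') e) p)
    in cong₂ _,_ (odd-injective u u' (ℤ.i-j≡0⇒i≡j _ _ r)) (odd-injective v v' (ℤ.i-j≡0⇒i≡j _ _ q))
    where
    regroup : ∀ x x' y y' e → (x + - x') + e * (y + - y') ≡ (x + e * y) + - (x' + e * y')
    regroup = solve-∀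

  -- For a pair outside `S` its modulus is comaximal with each factor of `a`, hence with `a`, which
  -- it divides. It would then be ±1, so that |bc| ≤ 2 for the nonzero weight c, against b ≥ 3.
  sound : ∀ u v → Member D e b a u v → (u , v) ∈ S
  sound u v (hu , hv , ha) with DecMembership._∈?_ (Productₚ.≡-dec ℤ._≟_ ℤ._≟_) (u , v) S
  ... | yes s∈S = s∈S
  ... | no s∉S = ⊥-elim (ℕ.<⇒≱ 3≤∣bc∣ ∣bc∣≤2)
    where
    box : ∀ u → odd u ∣ᶻ D → InBox u
    box u = ∣ᶻ⇒∣∣≤∣∣ (odd u) D≢0
    c = weight (u , v)
    comax : ∀ {s} → s ∈ S → Comaximal (modulus (u , v)) (modulus s)
    comax {u' , v'} s∈S = let (hu' , hv' , _) = complete s∈S in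
      gödel-comaximal b c (weight (u' , v'))
        (∣x∣≤X⇒x∣X! X _ (λ p → s∉S (subst (_∈ S) (sym (weight-injective u v u' v' (box u hu) (box u' hu') p)) s∈S))
          (ℕ.≤-trans (∣i-j∣≤ c (weight (u' , v')) (weight-bound u v (box u hu) (box v hv))
            (weight-bound u' v' (box u' hu') (box v' hv'))) (ℕ.m≤n+m (Y ℕ.+ Y) 3)))
    ∣q∣≡1 : ∣ modulus (u , v) ∣ ≡ 1
    ∣q∣≡1 = comaximal-∣ (comaximal-productOver modulus (modulus (u , v)) S comax) ha
    isolate : ∀ t → t ≡ (1ℤ + t) + - 1ℤ
    isolate = solve-∀
    ∣bc∣≤2 : ∣ b * c ∣ ℕ.≤ 2
    ∣bc∣≤2 = subst (ℕ._≤ 2) (cong ∣_∣ (sym (isolate (b * c))))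
      (∣i-j∣≤ (modulus (u , v)) 1ℤ (ℕ.≤-reflexive ∣q∣≡1) ℕ.≤-refl)
    X!≥X : X ℕ.≤ X ℕ.!
    X!≥X = ℕ.m≤m*n X ((2 ℕ.+ (Y ℕ.+ Y)) ℕ.!) {{ℕ._!≢0 (2 ℕ.+ (Y ℕ.+ Y))}}
    3≤∣bc∣ : 3 ℕ.≤ ∣ b * c ∣
    3≤∣bc∣ = ℕ.≤-trans (ℕ.m≤m+n 3 (Y ℕ.+ Y)) (ℕ.≤-trans X!≥X
      (subst (X ℕ.! ℕ.≤_) (sym (ℤ.abs-* b c))
        (ℕ.m≤m*n (X ℕ.!) ∣ c ∣ {{ℕ.≢-nonZero (weight≢0 u v (box u hu) ∘ ℤ.∣i∣≡0⇒i≡0)}})))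

-- Integers as programs in base 3 + 2k

infixl 6 _⊕_
infixl 7 _⊗_
_⊕_ _⊗_ : {V : Set} → Term V → Term V → Term V
s ⊕ t = op add (s ∷ t ∷ [])
s ⊗ t = op mul (s ∷ t ∷ [])

⊝_ : {V : Set} → Term V → Term V
⊝ t = op neg (t ∷ [])

𝟘 𝟙 : {V : Set} → Term V
𝟘 = op zer []
𝟙 = op one []

numeral : {V : Set} → ℕ → Term V
numeral zero = 𝟘
numeral (suc n) = 𝟙 ⊕ numeral n

data Instr (k : ℕ) : Set where
  noop inc dec : Instr k
  times over   : Fin k → Instr k

module Programs (k : ℕ) where
  K : ℕ
  K = 3 ℕ.+ (k ℕ.+ k)

  Digit : Set
  Digit = Fin K

  -- Digit 0 has to be harmless: the expansion of an integer drops the zeros at the most significant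
  -- end of a word, which is the end executed last.
  decode : Digit → Instr k
  decode zero = noop
  decode (suc zero) = inc
  decode (suc (suc zero)) = dec
  decode (suc (suc (suc i))) = [ times , over ]′ (splitAt k i)

  encode : Instr k → Digit
  encode noop = zero
  encode inc = suc zero
  encode dec = suc (suc zero)
  encode (times i) = suc (suc (suc (i ↑ˡ k)))
  encode (over i) = suc (suc (suc (k ↑ʳ i)))

  decode-encode : ∀ i → decode (encode i) ≡ i
  decode-encode noop = refl
  decode-encode inc = refl
  decode-encode dec = refl
  decode-encode (times i) = cong [ times , over ]′ (Finₚ.splitAt-↑ˡ k i k)
  decode-encode (over i) = cong [ times , over ]′ (Finₚ.splitAt-↑ʳ k k i)

  Terminal : ℤ → Set
  Terminal u = u ≡ 0ℤ ⊎ u ≡ - 1ℤ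

  -- Division by K has the two fixed points 0 and -1, where the expansion stops.
  data Digits : ℤ → List Digit → Set where
    stop : ∀ {u} → Terminal u → Digits u L.[]
    step : ∀ {u rs} u' r → ¬ Terminal u → u ≡ + K * u' + + toℕ r → Digits u' rs → Digits u (r L.∷ rs)

  division-unique : ∀ q r q' r' → + K * q + + toℕ r ≡ + K * q' + + toℕ r' → q ≡ q' × r ≡ r'
  division-unique q r q' r' p =
    let (a , b) = small-combination K (+ toℕ r + - (+ toℕ r')) (q + - q') bound
                    (trans (regroup (+ K) q (+ toℕ r) q' (+ toℕ r')) (ℤ.i≡j⇒i-j≡0 p))
    in ℤ.i-j≡0⇒i≡j q q' a , Finₚ.toℕ-injective (ℤ.+-injective (ℤ.i-j≡0⇒i≡j (+ toℕ r) (+ toℕ r') b))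
    where
    regroup : ∀ K q r q' r' → (r + - r') + K * (q + - q') ≡ (K * q + r) + - (K * q' + r')
    regroup = solve-∀
    bound : ∣ + toℕ r + - (+ toℕ r') ∣ ℕ.< K
    bound = subst (ℕ._< K) (cong ∣_∣ (sym (ℤ.m-n≡m⊖n (toℕ r) (toℕ r'))))
      (ℕ.≤-<-trans (ℤ.∣m⊝n∣≤m⊔n (toℕ r) (toℕ r')) (ℕ.⊔-lub (Finₚ.toℕ<n r) (Finₚ.toℕ<n r')))

  private
    quotient< : ∀ n → suc n ℕ/./ K ℕ.< suc n
    quotient< n = ℕ/.m/n<m (suc n) K (s≤s (s≤s z≤n))

    digit : ∀ n → Digit
    digit n = fromℕ< (ℕ/.m%n<n n K)

    digit-eq : ∀ n → n ≡ toℕ (digit n) ℕ.+ (n ℕ/./ K) ℕ.* K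
    digit-eq n = trans (ℕ/.m≡m%n+[m/n]*n n K)
      (cong (ℕ._+ (n ℕ/./ K) ℕ.* K) (sym (Finₚ.toℕ-fromℕ< (ℕ/.m%n<n n K))))

    positive-eq : ∀ n → + n ≡ + K * + (n ℕ/./ K) + + toℕ (digit n)
    positive-eq n = trans (cong +_ (digit-eq n))
      (trans (cong (λ t → + toℕ (digit n) + t) (ℤ.pos-* (n ℕ/./ K) K)) (swap (+ toℕ (digit n)) (+ (n ℕ/./ K)) (+ K)))
      where
      swap : ∀ r q K → r + q * K ≡ K * q + r
      swap = solve-∀

    -- With n = qK + r, the digit of -(n + 1) is the complement K - 1 - r, and the quotient is -(q +
    -- 1).
    negative-eq : ∀ n → -[1+ n ] ≡ + K * -[1+ n ℕ/./ K ] + + toℕ (opposite (digit n))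
    negative-eq n = begin
      -[1+ n ]                                           ≡⟨ cong (λ t → - (1ℤ + + t)) (digit-eq n) ⟩
      - (1ℤ + + (r ℕ.+ q ℕ.* K))                          ≡⟨ cong (λ t → - (1ℤ + (+ r + t))) (ℤ.pos-* q K) ⟩
      - (1ℤ + (+ r + + q * + K))                          ≡⟨ cong (λ t → - (1ℤ + (+ r + + q * t))) K-eq ⟩
      - (1ℤ + (+ r + + q * (1ℤ + + r + + s)))             ≡⟨ rearrange (+ r) (+ q) (+ s) ⟩
      (1ℤ + + r + + s) * - (1ℤ + + q) + + s               ≡⟨ cong (λ t → t * - (1ℤ + + q) + + s) (sym K-eq) ⟩
      + K * -[1+ q ] + + s                                ∎
      where
      open ≡.≡-Reasoning
      q = n ℕ/./ K
      r = toℕ (digit n)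
      s = toℕ (opposite (digit n))
      K-eq : + K ≡ 1ℤ + + r + + s
      K-eq = cong +_ (sym (trans (cong (suc r ℕ.+_) (Finₚ.opposite-prop (digit n)))
        (ℕ.m+[n∸m]≡n (Finₚ.toℕ<n (digit n)))))
      rearrange : ∀ r q s → - (1ℤ + (r + q * (1ℤ + r + s))) ≡ (1ℤ + r + s) * - (1ℤ + q) + s
      rearrange = solve-∀

    digits-positive : ∀ n → Acc ℕ._<_ n → Σ (List Digit) (Digits (+ n))
    digits-positive zero _ = L.[] , stop (inj₁ refl)
    digits-positive (suc n) (acc rec) with digits-positive (suc n ℕ/./ K) (rec (quotient< n))
    ... | rs , d = _ , step (+ (suc n ℕ/./ K)) (digit (suc n)) (λ { (inj₁ ()) ; (inj₂ ()) }) (positive-eq (suc n)) d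

    digits-negative : ∀ n → Acc ℕ._<_ n → Σ (List Digit) (Digits -[1+ n ])
    digits-negative zero _ = L.[] , stop (inj₂ refl)
    digits-negative (suc n) (acc rec) with digits-negative (suc n ℕ/./ K) (rec (quotient< n))
    ... | rs , d = _ , step -[1+ suc n ℕ/./ K ] (opposite (digit (suc n))) (λ { (inj₁ ()) ; (inj₂ ()) }) (negative-eq (suc n)) d

  -- The well-founded recursion is sealed; where a particular expansion matters, `digits-unique`
  -- identifies it.
  abstract
    digits : ∀ u → Σ (List Digit) (Digits u)
    digits (+ n) = digits-positive n (<-wellFounded n)
    digits -[1+ n ] = digits-negative n (<-wellFounded n)

  program : ℤ → List Digit
  program u = proj₁ (digits u)

  module Run {X : Set} (exec : Instr k → X → X) where
    run : List Digit → X → X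
    run L.[] a = a
    run (r L.∷ rs) a = run rs (exec (decode r) a)

  -- Every word is the expansion of some integer, up to trailing noops.
  code : List Digit → ℕ
  code L.[] = 0
  code (r L.∷ rs) = toℕ r ℕ.+ K ℕ.* code rs

  data _↝_ : List Digit → List Digit → Set where
    nil   : L.[] ↝ L.[]
    strip : ∀ {rs} → rs ↝ L.[] → (zero L.∷ rs) ↝ L.[]
    keep  : ∀ {r rs rs'} → rs ↝ rs' → (r L.∷ rs) ↝ (r L.∷ rs')

  digits-code : ∀ rs → Σ (List Digit) λ rs' → Digits (+ code rs) rs' × (rs ↝ rs')
  digits-code L.[] = L.[] , stop (inj₁ refl) , nil
  digits-code (r L.∷ rs) with digits-code rs
  ... | rs' , d , rs↝rs' with code (r L.∷ rs) ℕ.≟ 0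
  ...   | no c≢0 = r L.∷ rs' , step (+ code rs) r (λ { (inj₁ e) → c≢0 (ℤ.+-injective e) ; (inj₂ ()) })
                     (trans (cong +_ (ℕ.+-comm (toℕ r) (K ℕ.* code rs)))
                       (cong (λ t → t + + toℕ r) (ℤ.pos-* K (code rs)))) d , keep rs↝rs'
  -- A word of code 0 consists of zeros only, so the expansion stops at once and the whole word is
  -- stripped.
  ...   | yes c≡0 = L.[] , stop (inj₁ (cong +_ c≡0)) ,
          stripped r (ℕ.m+n≡0⇒m≡0 (toℕ r) c≡0) (stopped d rs↝rs')
    where
    code≡0 : code rs ≡ 0
    code≡0 = [ (λ ()) , id ]′ (ℕ.m*n≡0⇒m≡0∨n≡0 K (ℕ.m+n≡0⇒n≡0 (toℕ r) c≡0))
    stopped : ∀ {rs'} → Digits (+ code rs) rs' → rs ↝ rs' → rs ↝ L.[]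
    stopped (stop _) p = p
    stopped (step _ _ ¬t _ _) _ = ⊥-elim (¬t (inj₁ (cong +_ code≡0)))
    stripped : ∀ r → toℕ r ≡ 0 → rs ↝ L.[] → (r L.∷ rs) ↝ L.[]
    stripped zero _ p = strip p

  digits-unique : ∀ {u rs rs'} → Digits u rs → Digits u rs' → rs ≡ rs'
  digits-unique (stop _) (stop _) = refl
  digits-unique (stop t) (step _ _ ¬t _ _) = ⊥-elim (¬t t)
  digits-unique (step _ _ ¬t _ _) (stop t) = ⊥-elim (¬t t)
  digits-unique (step u r _ p d) (step u' r' _ p' d') with division-unique u r u' r' (trans (sym p) p')
  ... | refl , refl = cong (r L.∷_) (digits-unique d d')

-- Evaluation of programs at integer points is definable in ℤ

ℤ-alg : IsSetoidAlgebra ℤ-ring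
ℤ-alg = record
  { ≈-refl = refl
  ; ≈-sym = sym
  ; ≈-trans = trans
  ; op-cong = λ
      { add e → cong₂ _+_ (e zero) (e (suc zero))
      ; mul e → cong₂ _*_ (e zero) (e (suc zero))
      ; neg e → cong -_ (e zero)
      ; zer e → refl
      ; one e → refl }
  }

-- Stated over two variables and then instantiated, so that the terms need no weakening under the
-- quantifier.
divᶠ : {V : Set} → Term V → Term V → Fml V
divᶠ s t = inst (∃ᶠ (eq (var (just (suc zero))) (var (just zero) ⊗ var nothing))) (s ∷ t ∷ [])

oddᵗ : {V : Set} → Term V → Term V
oddᵗ t = t ⊕ t ⊕ 𝟙

memberᶠ : {V : Set} → (D e b a u v : Term V) → Fml V
memberᶠ D e b a u v = divᶠ (oddᵗ u) D ∧ᶠ divᶠ (oddᵗ v) D ∧ᶠ divᶠ (𝟙 ⊕ b ⊗ (oddᵗ u ⊕ e ⊗ oddᵗ v)) a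

terminalᶠ : {V : Set} → Term V → Fml V
terminalᶠ u = eq u 𝟘 ∨ᶠ eq u (⊝ 𝟙)

module _ where
  open RichSemantics ℤ-ring

  eval-numeral : ∀ {V} n {ρ : V → ℤ} → eval (numeral n) ρ ≡ + n
  eval-numeral zero = refl
  eval-numeral (suc n) = cong (λ t → 1ℤ + t) (eval-numeral n)

module Evaluation (k : ℕ) where
  open Programs k

  exec : (M M' : Vector ℤ k) → Instr k → ℤ → ℤ
  exec M M' noop v = v
  exec M M' inc v = v + 1ℤ
  exec M M' dec v = v + - 1ℤ
  exec M M' (times i) v = M i * v
  exec M M' (over i) v = M' i * v

  evalAt : (M M' : Vector ℤ k) → ℤ → ℤ
  evalAt M M' u = Run.run (exec M M') (program u) 0ℤ

  execᵗ : {V : Set} → (M M' : Fin k → Term V) → Instr k → Term V → Term V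
  execᵗ M M' noop v = v
  execᵗ M M' inc v = v ⊕ 𝟙
  execᵗ M M' dec v = v ⊕ ⊝ 𝟙
  execᵗ M M' (times i) v = M i ⊗ v
  execᵗ M M' (over i) v = M' i ⊗ v

  data Slot : Set where
    uˢ vˢ   : Slot
    Mˢ M'ˢ : Fin k → Slot

  -- The run of the program u is witnessed by a finite set of pairs
  -- (remaining program, accumulator) closed under execution.
  evalᶠ : Fml Slot
  evalᶠ = ∃ᶠ (∃ᶠ (∃ᶠ (∃ᶠ (start ∧ᶠ ∀ᶠ (∀ᶠ (
      inSet ⇒ᶠ proceeds))))))
    module EvalFormula where
    start = memberᶠ (var (just (just (just nothing)))) (var (just (just nothing))) (var (just nothing))
      (var nothing) (var (just (just (just (just uˢ))))) 𝟘
    slot : Slot → Term (Maybe (Maybe (Maybe (Maybe (Maybe (Maybe Slot))))))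
    slot s = var (just (just (just (just (just (just s))))))
    D e b a u' v' : Term (Maybe (Maybe (Maybe (Maybe (Maybe (Maybe Slot))))))
    D = var (just (just (just (just (just nothing)))))
    e = var (just (just (just (just nothing))))
    b = var (just (just (just nothing)))
    a = var (just (just nothing))
    u' = var (just nothing)
    v' = var nothing
    inSet = memberᶠ D e b a u' v'
    next : Digit → Fml (Maybe (Maybe (Maybe (Maybe (Maybe (Maybe Slot))))))
    next r = ∃ᶠ (eq (mapT just u') (numeral K ⊗ var nothing ⊕ numeral (toℕ r)) ∧ᶠ
      memberᶠ (mapT just D) (mapT just e) (mapT just b) (mapT just a) (var nothing)
        (execᵗ (mapT just ∘ slot ∘ Mˢ) (mapT just ∘ slot ∘ M'ˢ) (decode r) (mapT just v')))
    proceeds = (terminalᶠ u' ∧ᶠ eq v' (slot vˢ)) ∨ᶠ (¬ᶠ terminalᶠ u' ∧ᶠ ⋁ᶠ K next)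

  open RichSemantics ℤ-ring

  eval-execᵗ : ∀ {V} (M M' : Fin k → Term V) i v {ρ : V → ℤ} →
               eval (execᵗ M M' i v) ρ ≡ exec (λ j → eval (M j) ρ) (λ j → eval (M' j) ρ) i (eval v ρ)
  eval-execᵗ M M' noop v = refl
  eval-execᵗ M M' inc v = refl
  eval-execᵗ M M' dec v = refl
  eval-execᵗ M M' (times i) v = refl
  eval-execᵗ M M' (over i) v = refl

  module _ (ρ : Slot → ℤ) where
    private
      ex : Instr k → ℤ → ℤ
      ex = exec (ρ ∘ Mˢ) (ρ ∘ M'ˢ)
      open Run ex

      eval-quotient : ∀ {V} (σ : V → ℤ) q (r : Digit) →
        eval (numeral K ⊗ var nothing ⊕ numeral (toℕ r)) (maybe′ σ q) ≡ + K * q + + toℕ r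
      eval-quotient σ q r = cong₂ (λ s t → s * q + t) (eval-numeral K {maybe′ σ q}) (eval-numeral (toℕ r) {maybe′ σ q})

      module _ (D e b a : ℤ) where
        env : ℤ → ℤ → Maybe (Maybe (Maybe (Maybe (Maybe (Maybe Slot))))) → ℤ
        env u v = maybe′ (maybe′ (maybe′ (maybe′ (maybe′ (maybe′ ρ D) e) b) a) u) v

        Proceeds : ℤ → ℤ → Set
        Proceeds u v = (Terminal u × v ≡ ρ vˢ) ⊎
          (¬ Terminal u × Σ Digit λ r → Σ ℤ λ u' →
            u ≡ + K * u' + + toℕ r × Member D e b a u' (ex (decode r) v))

        next-value : ∀ u v r q → eval (execᵗ (mapT just ∘ EvalFormula.slot ∘ Mˢ) (mapT just ∘ EvalFormula.slot ∘ M'ˢ)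
          (decode r) (var (just nothing))) (maybe′ (env u v) q) ≡ ex (decode r) v
        next-value u v r q = eval-execᵗ (mapT just ∘ EvalFormula.slot ∘ Mˢ) (mapT just ∘ EvalFormula.slot ∘ M'ˢ)
          (decode r) (var (just nothing)) {maybe′ (env u v) q}

        Sem-proceeds : ∀ u v → Sem EvalFormula.proceeds (env u v) ⇔ Proceeds u v
        Sem-proceeds u v = ⊎-⇔ ⇔-refl (×-⇔ ⇔-refl (Σ-⇔ λ r → Σ-⇔ λ q → mk⇔
          (λ (p , m) → trans p (eval-quotient (env u v) q r) , subst (Member D e b a q) (next-value u v r q) m)
          (λ (p , m) → trans p (sym (eval-quotient (env u v) q r)) ,
                       subst (Member D e b a q) (sym (next-value u v r q)) m)))

    -- The four witnesses may define any set, even an infinite one. It contains the initial state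
    -- and is closed under execution, so the run of the program stays inside it; induction on the
    -- finite expansion leads to a terminal state, where the accumulator has to be the value.
    evalᶠ-sound : Sem evalᶠ ρ → ρ vˢ ≡ evalAt (ρ ∘ Mˢ) (ρ ∘ M'ˢ) (ρ uˢ)
    evalᶠ-sound (D , e , b , a , start , closed) = follow (proj₂ (digits (ρ uˢ))) 0ℤ start
      where
      follow : ∀ {u rs} → Digits u rs → ∀ v → Member D e b a u v → ρ vˢ ≡ run rs v
      follow {u} d v m with d | to (Sem-proceeds D e b a u v) (closed u v m)
      ... | stop t | inj₁ (_ , p) = sym p
      ... | stop t | inj₂ (¬t , _) = ⊥-elim (¬t t)
      ... | step u' r ¬t p d' | inj₁ (t , _) = ⊥-elim (¬t t)
      ... | step u' r ¬t p d' | inj₂ (_ , r' , u'' , p' , m')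
        -- The formula supplies its own digit and quotient; uniqueness of division identifies them
        -- with those of the expansion.
        with division-unique u' r u'' r' (trans (sym p) p')
      ...   | refl , refl = follow d' _ m'

    -- The witnesses code the list of states of the actual run. By `sound` their set contains
    -- nothing else, so closure is checked along the run only.
    evalᶠ-complete : ρ vˢ ≡ evalAt (ρ ∘ Mˢ) (ρ ∘ M'ˢ) (ρ uˢ) → Sem evalᶠ ρ
    evalᶠ-complete p = D , e , b , a , complete (first (proj₂ (digits (ρ uˢ))) 0ℤ) , λ u v m →
      from (Sem-proceeds D e b a u v) (closed (proj₂ (digits (ρ uˢ))) 0ℤ p id u v (sound u v m))
      where
      states : ∀ {u rs} → Digits u rs → ℤ → List (ℤ × ℤ)
      states {u} (stop _) v = (u , v) L.∷ L.[]
      states {u} (step _ r _ _ d) v = (u , v) L.∷ states d (ex (decode r) v)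
      open FiniteSetCode (states (proj₂ (digits (ρ uˢ))) 0ℤ)
      first : ∀ {u rs} (d : Digits u rs) v → (u , v) ∈ states d v
      first (stop _) v = here refl
      first (step _ _ _ _ _) v = here refl
      closed : ∀ {u rs} (d : Digits u rs) w → ρ vˢ ≡ run rs w →
               (∀ {s} → s ∈ states d w → s ∈ states (proj₂ (digits (ρ uˢ))) 0ℤ) →
               ∀ u' v' → (u' , v') ∈ states d w → Proceeds D e b a u' v'
      closed (stop t) w q sub _ _ (here refl) = inj₁ (t , sym q)
      closed (step u₁ r ¬t q' d) w q sub _ _ (here refl) =
        inj₂ (¬t , r , u₁ , q' , complete (sub (there (first d _))))
      closed (step u₁ r ¬t q' d) w q sub u' v' (there s) = closed d _ q (sub ∘ there) u' v' s

    Sem-evalᶠ : Sem evalᶠ ρ ⇔ ρ vˢ ≡ evalAt (ρ ∘ Mˢ) (ρ ∘ M'ˢ) (ρ uˢ)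
    Sem-evalᶠ = mk⇔ evalᶠ-sound evalᶠ-complete

-- The Laurent polynomial ring through the pairing ⟨ p , h ⟩ = Σ c · h(e)

module LaurentRing (k : ℕ) where
  R : Set
  R = Carrier (Laurent k)

  Exponent : Set
  Exponent = Vec ℤ k

  infixl 6 _⊹_
  _⊹_ : Exponent → Exponent → Exponent
  _⊹_ = V.zipWith _+_

  𝟎 : Exponent
  𝟎 = V.replicate k 0ℤ

  ⊹-assoc : ∀ e f g → (e ⊹ f) ⊹ g ≡ e ⊹ (f ⊹ g)
  ⊹-assoc = Vecₚ.zipWith-assoc ℤ.+-assoc

  ⊹-comm : ∀ e f → e ⊹ f ≡ f ⊹ e
  ⊹-comm = Vecₚ.zipWith-comm ℤ.+-comm

  ⊹-identityˡ : ∀ e → 𝟎 ⊹ e ≡ e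
  ⊹-identityˡ = Vecₚ.zipWith-identityˡ ℤ.+-identityˡ

  _≟ᵉ_ : (e f : Exponent) → Dec (e ≡ f)
  _≟ᵉ_ = Vecₚ.≡-dec ℤ._≟_

  -- One polynomial has many lists. Testing a list against all functions on exponents turns ring
  -- identities into identities of integers; coefficients are the case h = δ, and evaluation at a
  -- point is the case h = `val M M'`.
  pair : R → (Exponent → ℤ) → ℤ
  pair L.[] h = 0ℤ
  pair ((c , e) L.∷ p) h = c * h e + pair p h

  δ : Exponent → Exponent → ℤ
  δ e e' with e' ≟ᵉ e
  ... | yes _ = 1ℤ
  ... | no _ = 0ℤ

  coeff-pair : ∀ p e → coeff p e ≡ pair p (δ e)
  coeff-pair L.[] e = refl
  coeff-pair ((c , e') L.∷ p) e with e' ≟ᵉ e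
  ... | yes _ = cong₂ _+_ (sym (ℤ.*-identityʳ c)) (coeff-pair p e)
  ... | no _ = trans (coeff-pair p e) (sym (trans (cong (λ t → t + pair p (δ e)) (ℤ.*-zeroʳ c)) (ℤ.+-identityˡ _)))

  pair-cong : ∀ p {h h'} → (∀ e → h e ≡ h' e) → pair p h ≡ pair p h'
  pair-cong L.[] hyp = refl
  pair-cong ((c , e) L.∷ p) hyp = cong₂ (λ s t → c * s + t) (hyp e) (pair-cong p hyp)

  pair-++ : ∀ p q h → pair (p L.++ q) h ≡ pair p h + pair q h
  pair-++ L.[] q h = sym (ℤ.+-identityˡ _)
  pair-++ ((c , e) L.∷ p) q h = trans (cong (λ t → c * h e + t) (pair-++ p q h))
    (sym (ℤ.+-assoc (c * h e) (pair p h) (pair q h)))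

  pair-zero : ∀ p → pair p (λ _ → 0ℤ) ≡ 0ℤ
  pair-zero L.[] = refl
  pair-zero ((c , e) L.∷ p) = cong₂ _+_ (ℤ.*-zeroʳ c) (pair-zero p)

  pair-linear : ∀ p h h' a b → pair p (λ e → a * h e + b * h' e) ≡ a * pair p h + b * pair p h'
  pair-linear L.[] h h' a b = sym (cong₂ _+_ (ℤ.*-zeroʳ a) (ℤ.*-zeroʳ b))
  pair-linear ((c , e) L.∷ p) h h' a b = trans (cong (λ t → c * (a * h e + b * h' e) + t) (pair-linear p h h' a b))
    (regroup c (h e) (h' e) a b (pair p h) (pair p h'))
    where
    regroup : ∀ c x x' a b y y' → c * (a * x + b * x') + (a * y + b * y') ≡ a * (c * x + y) + b * (c * x' + y')
    regroup = solve-∀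

  pair-scale : ∀ p h a → pair p (λ e → a * h e) ≡ a * pair p h
  pair-scale L.[] h a = sym (ℤ.*-zeroʳ a)
  pair-scale ((c , e) L.∷ p) h a = trans (cong (λ t → c * (a * h e) + t) (pair-scale p h a))
    (regroup c (h e) a (pair p h))
    where
    regroup : ∀ c x a y → c * (a * x) + a * y ≡ a * (c * x + y)
    regroup = solve-∀

  -- Exchange of two finite sums; commutativity of multiplication is an instance.
  pair-swap : ∀ p q (h : Exponent → Exponent → ℤ) →
              pair p (λ e → pair q (h e)) ≡ pair q (λ e' → pair p (λ e → h e e'))
  pair-swap L.[] q h = sym (pair-zero q)
  pair-swap ((c , e) L.∷ p) q h = trans (cong (λ t → c * pair q (h e) + t) (pair-swap p q h))
    (trans (regroup c (pair q (h e)) (pair q h'))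
      (trans (sym (pair-linear q (h e) h' c 1ℤ)) (pair-cong q λ e' → drop-one (c * h e e') (h' e'))))
    where
    h' = λ e' → pair p (λ e → h e e')
    regroup : ∀ c x y → c * x + y ≡ c * x + 1ℤ * y
    regroup = solve-∀
    drop-one : ∀ x y → x + 1ℤ * y ≡ x + y
    drop-one = solve-∀

  infix 4 _≈ᴸ_
  _≈ᴸ_ : R → R → Set
  _≈ᴸ_ = _≈_ (Laurent k)

  infixl 6 _+ᴸ_
  infixl 7 _*ᴸ_
  _+ᴸ_ _*ᴸ_ : R → R → R
  p +ᴸ q = ⟦_⟧ (Laurent k) add (p ∷ q ∷ [])
  p *ᴸ q = ⟦_⟧ (Laurent k) mul (p ∷ q ∷ [])

  infix 8 -ᴸ_
  -ᴸ_ : R → R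
  -ᴸ p = ⟦_⟧ (Laurent k) neg (p ∷ [])

  0ᴸ 1ᴸ : R
  0ᴸ = L.[]
  1ᴸ = ⟦_⟧ (Laurent k) one []

  monomial : ℤ → Exponent → R
  monomial c e = (c , e) L.∷ L.[]

  pair-monomial : ∀ c e h → pair (monomial c e) h ≡ c * h e
  pair-monomial c e h = ℤ.+-identityʳ (c * h e)

  pair-neg : ∀ p h → pair (-ᴸ p) h ≡ - pair p h
  pair-neg L.[] h = refl
  pair-neg ((c , e) L.∷ p) h = trans (cong (λ t → - c * h e + t) (pair-neg p h)) (regroup c (h e) (pair p h))
    where
    regroup : ∀ c x y → - c * x + - y ≡ - (c * x + y)
    regroup = solve-∀

  pair-one : ∀ h → pair 1ᴸ h ≡ h 𝟎
  pair-one h = trans (ℤ.+-identityʳ (1ℤ * h 𝟎)) (ℤ.*-identityˡ (h 𝟎))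

  private
    pair-shift : ∀ (f : Monomial k → Monomial k) c e → (∀ c' e' → f (c' , e') ≡ (c * c' , e ⊹ e')) →
                 ∀ q h → pair (L.map f q) h ≡ c * pair q (λ e' → h (e ⊹ e'))
    pair-shift f c e f-eq L.[] h = sym (ℤ.*-zeroʳ c)
    pair-shift f c e f-eq ((c' , e') L.∷ q) h = trans
      (cong₂ _+_ (cong (λ (c , e) → c * h e) (f-eq c' e')) (pair-shift f c e f-eq q h))
      (regroup c c' (h (e ⊹ e')) (pair q (λ e' → h (e ⊹ e'))))
      where
      regroup : ∀ c c' x y → c * c' * x + c * y ≡ c * (c' * x + y)
      regroup = solve-∀

  -- Multiplication is convolution, so a pairing with a product is an iterated pairing along
  -- addition of exponents. Associativity, commutativity and the unit law then come from the same
  -- laws in ℤᵏ.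
  pair-* : ∀ p q h → pair (p *ᴸ q) h ≡ pair p (λ e → pair q (λ e' → h (e ⊹ e')))
  pair-* L.[] q h = refl
  pair-* ((c , e) L.∷ p) q h = trans (pair-++ (L.map _ q) (p *ᴸ q) h)
    (cong₂ _+_ (pair-shift _ c e (λ _ _ → refl) q h) (pair-* p q h))

  private
    remove : Exponent → R → R
    remove e L.[] = L.[]
    remove e ((c , e') L.∷ p) with e' ≟ᵉ e
    ... | yes _ = remove e p
    ... | no _ = (c , e') L.∷ remove e p

    remove-length : ∀ e p → L.length (remove e p) ℕ.≤ L.length p
    remove-length e L.[] = z≤n
    remove-length e ((c , e') L.∷ p) with e' ≟ᵉ e
    ... | yes _ = ℕ.m≤n⇒m≤1+n (remove-length e p)
    ... | no _ = s≤s (remove-length e p)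

    pair-remove : ∀ e p h → pair p h ≡ coeff p e * h e + pair (remove e p) h
    pair-remove e L.[] h = refl
    pair-remove e ((c , e') L.∷ p) h with e' ≟ᵉ e
    ... | yes refl = trans (cong (λ t → c * h e + t) (pair-remove e p h))
                       (regroup c (coeff p e) (h e) (pair (remove e p) h))
      where
      regroup : ∀ c c' x y → c * x + (c' * x + y) ≡ (c + c') * x + y
      regroup = solve-∀
    ... | no _ = trans (cong (λ t → c * h e' + t) (pair-remove e p h))
                   (swap (c * h e') (coeff p e * h e) (pair (remove e p) h))
      where
      swap : ∀ x y z → x + (y + z) ≡ y + (x + z)
      swap = solve-∀

    remove-vanishes : ∀ e p → (∀ e' → coeff p e' ≡ 0ℤ) → ∀ e' → coeff (remove e p) e' ≡ 0ℤ
    remove-vanishes e p v e' = trans (coeff-pair (remove e p) e')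
      (trans (sym (ℤ.+-identityˡ _)) (trans
        (cong (λ t → t * δ e' e + pair (remove e p) (δ e')) (sym (v e)))
        (trans (sym (pair-remove e p (δ e'))) (trans (sym (coeff-pair p e')) (v e')))))

    -- Exponents may repeat in a list, so terms have to be collected. Removing all monomials at the
    -- first exponent takes away a term with coefficient 0 and leaves a shorter list, whose length
    -- is bounded by `n` for the recursion.
    vanishing : ∀ n p → L.length p ℕ.≤ n → (∀ e → coeff p e ≡ 0ℤ) → ∀ h → pair p h ≡ 0ℤ
    vanishing n L.[] l v h = refl
    vanishing (suc n) p₀@((c , e) L.∷ p) (s≤s l) v h = trans (pair-remove e p₀ h)
      (trans (cong (λ t → t * h e + pair (remove e p₀) h) (v e))
        (trans (ℤ.+-identityˡ _) (vanishing n (remove e p₀) (ℕ.≤-trans shorter l) (remove-vanishes e p₀ v) h)))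
      where
      shorter : L.length (remove e p₀) ℕ.≤ L.length p
      shorter with e ≟ᵉ e
      ... | yes _ = remove-length e p
      ... | no ¬p = ⊥-elim (¬p refl)

  -- Equality is given by coefficients, that is by the functions δ alone; applying `vanishing` to
  -- the difference extends it to every function on exponents.
  ≈⇒pair : ∀ {p q} → p ≈ᴸ q → ∀ h → pair p h ≡ pair q h
  ≈⇒pair {p} {q} p≈q h = ℤ.i-j≡0⇒i≡j _ _ (trans (sym (difference h))
    (vanishing _ (p +ᴸ -ᴸ q) ℕ.≤-refl (λ e → trans (coeff-pair (p +ᴸ -ᴸ q) e) (trans (difference (δ e))
      (ℤ.i≡j⇒i-j≡0 (trans (sym (coeff-pair p e)) (trans (p≈q e) (coeff-pair q e)))))) h))
    where
    difference : ∀ h → pair (p +ᴸ -ᴸ q) h ≡ pair p h + - pair q h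
    difference h = trans (pair-++ p (-ᴸ q) h) (cong (λ t → pair p h + t) (pair-neg q h))

  pair⇒≈ : ∀ p q → (∀ h → pair p h ≡ pair q h) → p ≈ᴸ q
  pair⇒≈ p q hyp e = trans (coeff-pair p e) (trans (hyp (δ e)) (sym (coeff-pair q e)))

  +ᴸ-cong : ∀ {p p' q q'} → p ≈ᴸ p' → q ≈ᴸ q' → p +ᴸ q ≈ᴸ p' +ᴸ q'
  +ᴸ-cong {p} {p'} {q} {q'} e e' = pair⇒≈ (p +ᴸ q) (p' +ᴸ q') λ h → trans (pair-++ p q h)
    (trans (cong₂ _+_ (≈⇒pair {p} {p'} e h) (≈⇒pair {q} {q'} e' h)) (sym (pair-++ p' q' h)))

  *ᴸ-cong : ∀ {p p' q q'} → p ≈ᴸ p' → q ≈ᴸ q' → p *ᴸ q ≈ᴸ p' *ᴸ q'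
  *ᴸ-cong {p} {p'} {q} {q'} e e' = pair⇒≈ (p *ᴸ q) (p' *ᴸ q') λ h → trans (pair-* p q h)
    (trans (≈⇒pair {p} {p'} e _) (trans (pair-cong p' λ f → ≈⇒pair {q} {q'} e' _) (sym (pair-* p' q' h))))

  -ᴸ-cong : ∀ {p p'} → p ≈ᴸ p' → -ᴸ p ≈ᴸ -ᴸ p'
  -ᴸ-cong {p} {p'} e = pair⇒≈ (-ᴸ p) (-ᴸ p') λ h → trans (pair-neg p h)
    (trans (cong -_ (≈⇒pair {p} {p'} e h)) (sym (pair-neg p' h)))

  Laurent-alg : IsSetoidAlgebra (Laurent k)
  Laurent-alg = record
    { ≈-refl = λ e → refl
    ; ≈-sym = λ p e → sym (p e)
    ; ≈-trans = λ p q e → trans (p e) (q e)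
    ; op-cong = λ
        { add {xs} {ys} e → +ᴸ-cong {xs zero} {ys zero} {xs (suc zero)} {ys (suc zero)} (e zero) (e (suc zero))
        ; mul {xs} {ys} e → *ᴸ-cong {xs zero} {ys zero} {xs (suc zero)} {ys (suc zero)} (e zero) (e (suc zero))
        ; neg {xs} {ys} e → -ᴸ-cong {xs zero} {ys zero} (e zero)
        ; zer e _ → refl
        ; one e _ → refl }
    }

  *ᴸ-comm : ∀ p q → p *ᴸ q ≈ᴸ q *ᴸ p
  *ᴸ-comm p q = pair⇒≈ (p *ᴸ q) (q *ᴸ p) λ h → trans (pair-* p q h) (trans (pair-swap p q _)
    (trans (pair-cong q λ e' → pair-cong p λ e → cong h (⊹-comm e e')) (sym (pair-* q p h))))

  *ᴸ-assoc : ∀ p q r → (p *ᴸ q) *ᴸ r ≈ᴸ p *ᴸ (q *ᴸ r)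
  *ᴸ-assoc p q r = pair⇒≈ ((p *ᴸ q) *ᴸ r) (p *ᴸ (q *ᴸ r)) λ h → trans (pair-* (p *ᴸ q) r h) (trans (pair-* p q _)
    (trans (pair-cong p λ e → trans
        (pair-cong q λ f → pair-cong r λ g → cong h (⊹-assoc e f g)) (sym (pair-* q r _)))
      (sym (pair-* p (q *ᴸ r) h))))

  *ᴸ-identityˡ : ∀ p → 1ᴸ *ᴸ p ≈ᴸ p
  *ᴸ-identityˡ p = pair⇒≈ (1ᴸ *ᴸ p) p λ h → trans (pair-* 1ᴸ p h) (trans (pair-one (λ e → pair p (λ e' → h (e ⊹ e'))))
    (pair-cong p λ e → cong h (⊹-identityˡ e)))

  *ᴸ-distribˡ : ∀ p q r → p *ᴸ (q +ᴸ r) ≈ᴸ p *ᴸ q +ᴸ p *ᴸ r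
  *ᴸ-distribˡ p q r = pair⇒≈ (p *ᴸ (q +ᴸ r)) (p *ᴸ q +ᴸ p *ᴸ r) λ h → trans (pair-* p (q +ᴸ r) h) (trans
    (pair-cong p λ e → trans (pair-++ q r _) (with-ones (pair q _) (pair r _))) (trans
    (pair-linear p (λ e → pair q (λ f → h (e ⊹ f))) (λ e → pair r (λ f → h (e ⊹ f))) 1ℤ 1ℤ) (trans
    (sym (with-ones (pair p λ e → pair q λ f → h (e ⊹ f)) (pair p λ e → pair r λ f → h (e ⊹ f)))) (trans
    (sym (cong₂ _+_ (pair-* p q h) (pair-* p r h))) (sym (pair-++ (p *ᴸ q) (p *ᴸ r) h))))))
    where
    with-ones : ∀ x y → x + y ≡ 1ℤ * x + 1ℤ * y
    with-ones = solve-∀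

  private
    ≈ᴸ-trans : ∀ {p q r} → p ≈ᴸ q → q ≈ᴸ r → p ≈ᴸ r
    ≈ᴸ-trans p q e = trans (p e) (q e)

    -ᴸ-inverseˡ : ∀ p → (-ᴸ p) +ᴸ p ≈ᴸ 0ᴸ
    -ᴸ-inverseˡ p = pair⇒≈ ((-ᴸ p) +ᴸ p) 0ᴸ λ h → trans (pair-++ (-ᴸ p) p h)
      (trans (cong (λ t → t + pair p h) (pair-neg p h)) (ℤ.+-inverseˡ (pair p h)))

    +ᴸ-comm : ∀ p q → p +ᴸ q ≈ᴸ q +ᴸ p
    +ᴸ-comm p q = pair⇒≈ (p +ᴸ q) (q +ᴸ p) λ h → trans (pair-++ p q h)
      (trans (ℤ.+-comm (pair p h) (pair q h)) (sym (pair-++ q p h)))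

  laurentRing : CommutativeRing 0ℓ 0ℓ
  laurentRing = record
    { Carrier = R
    ; _≈_ = _≈ᴸ_
    ; _+_ = _+ᴸ_
    ; _*_ = _*ᴸ_
    ; -_ = -ᴸ_
    ; 0# = 0ᴸ
    ; 1# = 1ᴸ
    ; isCommutativeRing = record
      { isRing = record
        { +-isAbelianGroup = record
          { isGroup = record
            { isMonoid = record
              { isSemigroup = record
                { isMagma = record
                  { isEquivalence = record
                    { refl = λ e → refl ; sym = λ p e → sym (p e) ; trans = λ p q e → trans (p e) (q e) }
                  ; ∙-cong = λ {p} {p'} {q} {q'} → +ᴸ-cong {p} {p'} {q} {q'} }
                ; assoc = λ p q r e → cong (λ s → coeff s e) (Listₚ.++-assoc p q r) }
              ; identity = (λ p e → refl) , (λ p e → cong (λ s → coeff s e) (Listₚ.++-identityʳ p)) }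
            ; inverse = -ᴸ-inverseˡ , λ p → ≈ᴸ-trans {p +ᴸ -ᴸ p} {(-ᴸ p) +ᴸ p} {0ᴸ} (+ᴸ-comm p (-ᴸ p)) (-ᴸ-inverseˡ p)
            ; ⁻¹-cong = λ {p} {p'} → -ᴸ-cong {p} {p'} }
          ; comm = +ᴸ-comm }
        ; *-cong = λ {p} {p'} {q} {q'} → *ᴸ-cong {p} {p'} {q} {q'}
        ; *-assoc = *ᴸ-assoc
        ; *-identity = *ᴸ-identityˡ , λ p → ≈ᴸ-trans {p *ᴸ 1ᴸ} {1ᴸ *ᴸ p} {p} (*ᴸ-comm p 1ᴸ) (*ᴸ-identityˡ p)
        ; distrib = *ᴸ-distribˡ , λ p q r → ≈ᴸ-trans {(q +ᴸ r) *ᴸ p} {p *ᴸ (q +ᴸ r)} {q *ᴸ p +ᴸ r *ᴸ p}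
            (*ᴸ-comm (q +ᴸ r) p) (≈ᴸ-trans {p *ᴸ (q +ᴸ r)} {p *ᴸ q +ᴸ p *ᴸ r} {q *ᴸ p +ᴸ r *ᴸ p} (*ᴸ-distribˡ p q r)
              (+ᴸ-cong {p *ᴸ q} {q *ᴸ p} {p *ᴸ r} {r *ᴸ p} (*ᴸ-comm p q) (*ᴸ-comm p r))) }
      ; *-comm = *ᴸ-comm }
    }

-- Congruences and dense integer polynomials

infix 4 _≡_[mod_]
_≡_[mod_] : ℤ → ℤ → ℤ → Set
a ≡ b [mod N ] = N ∣ᶻ (a + - b)

module Congruence (N : ℤ) where
  infix 4 _≋_
  _≋_ : ℤ → ℤ → Set
  a ≋ b = a ≡ b [mod N ]

  ≋-reflexive : ∀ {a b} → a ≡ b → a ≋ b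
  ≋-reflexive {a} refl = 0ℤ , trans (ℤ.+-inverseʳ a) (sym (ℤ.*-zeroʳ N))

  ≋-sym : ∀ a b → a ≋ b → b ≋ a
  ≋-sym a b (q , p) = - q , trans (flip a b) (trans (cong -_ p) (neg-out N q))
    where
    flip : ∀ a b → b + - a ≡ - (a + - b)
    flip = solve-∀
    neg-out : ∀ N q → - (N * q) ≡ N * - q
    neg-out = solve-∀

  ≋-trans : ∀ a b c → a ≋ b → b ≋ c → a ≋ c
  ≋-trans a b c (q , p) (q' , p') = q + q' , trans (split a b c) (trans (cong₂ _+_ p p') (sym (ℤ.*-distribˡ-+ N q q')))
    where
    split : ∀ a b c → a + - c ≡ (a + - b) + (b + - c)
    split = solve-∀

  ≋-+ : ∀ a b c d → a ≋ b → c ≋ d → a + c ≋ b + d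
  ≋-+ a b c d (q , p) (q' , p') = q + q' , trans (split a b c d) (trans (cong₂ _+_ p p') (sym (ℤ.*-distribˡ-+ N q q')))
    where
    split : ∀ a b c d → (a + c) + - (b + d) ≡ (a + - b) + (c + - d)
    split = solve-∀

  ≋-* : ∀ a b c d → a ≋ b → c ≋ d → a * c ≋ b * d
  ≋-* a b c d (q , p) (q' , p') = q * c + b * q' ,
    trans (split a b c d) (trans (cong₂ (λ s t → s * c + b * t) p p') (collect N q q' b c))
    where
    split : ∀ a b c d → a * c + - (b * d) ≡ (a + - b) * c + b * (c + - d)
    split = solve-∀
    collect : ∀ N q q' b c → N * q * c + b * (N * q') ≡ N * (q * c + b * q')
    collect = solve-∀

  ≋-neg : ∀ a b → a ≋ b → - a ≋ - b
  ≋-neg a b (q , p) = - q , trans (push a b) (trans (cong -_ p) (neg-out N q))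
    where
    push : ∀ a b → - a + - (- b) ≡ - (a + - b)
    push = solve-∀
    neg-out : ∀ N q → - (N * q) ≡ N * - q
    neg-out = solve-∀

  ≋-*ˡ : ∀ a c d → c ≋ d → a * c ≋ a * d
  ≋-*ˡ a c d = ≋-* a a c d (≋-reflexive {a} refl)

  ≋-⇔ : ∀ a a' b b' → a ≋ a' → b ≋ b' → (a ≋ b) ⇔ (a' ≋ b')
  ≋-⇔ a a' b b' p q = mk⇔
    (λ h → ≋-trans a' a b' (≋-sym a a' p) (≋-trans a b b' h q))
    (λ h → ≋-trans a a' b p (≋-trans a' b' b h (≋-sym b b' q)))

-- m ^ n for an integer exponent n, the inverse of m being supplied
zpow : ℤ → ℤ → ℤ → ℤ
zpow m m' (+ n) = m ^ n
zpow m m' -[1+ n ] = m' ^ suc n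

module _ (N m m' : ℤ) (inverse : m * m' ≡ 1ℤ [mod N ]) where
  open Congruence N

  private
    cancel : ∀ a x y → x * y ≋ 1ℤ → a ≋ x * (y * a)
    cancel a x y h = ≋-sym _ a (≋-trans (x * (y * a)) (1ℤ * a) a
      (≋-trans (x * (y * a)) (x * y * a) (1ℤ * a) (≋-reflexive (sym (ℤ.*-assoc x y a)))
        (≋-* (x * y) 1ℤ a a h (≋-reflexive {a} refl)))
      (≋-reflexive (ℤ.*-identityˡ a)))

    inverse' : m' * m ≋ 1ℤ
    inverse' = subst (_≋ 1ℤ) (ℤ.*-comm m m') inverse

    zpow-suc : ∀ n → zpow m m' (1ℤ + n) ≋ m * zpow m m' n
    zpow-suc (+ n) = ≋-reflexive {m ^ suc n} refl
    zpow-suc -[1+ zero ] = cancel 1ℤ m m' inverse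
    zpow-suc -[1+ suc n ] = cancel (m' ^ suc n) m m' inverse

    zpow-pred : ∀ n → zpow m m' (- 1ℤ + n) ≋ m' * zpow m m' n
    zpow-pred (+ zero) = ≋-reflexive {m' * 1ℤ} refl
    zpow-pred (+ suc n) = cancel (m ^ n) m' m inverse'
    zpow-pred -[1+ n ] = ≋-reflexive {m' ^ suc (suc n)} refl

    shift : ∀ x a a' b c → a ≋ x * a' → a' ≋ b * c → a ≋ x * b * c
    shift x a a' b c p q = ≋-trans a (x * a') (x * b * c) p
      (≋-trans (x * a') (x * (b * c)) (x * b * c) (≋-*ˡ x a' (b * c) q) (≋-reflexive (sym (ℤ.*-assoc x b c))))

  zpow-+ : ∀ i j → zpow m m' (i + j) ≡ zpow m m' i * zpow m m' j [mod N ]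
  zpow-+ (+ zero) j = ≋-reflexive (trans (cong (zpow m m') (ℤ.+-identityˡ j)) (sym (ℤ.*-identityˡ _)))
  zpow-+ (+ suc i) j = shift m (zpow m m' (+ suc i + j)) (zpow m m' (+ i + j)) (zpow m m' (+ i)) (zpow m m' j)
    (subst (λ t → zpow m m' t ≋ m * zpow m m' (+ i + j)) (sym (ℤ.+-assoc 1ℤ (+ i) j)) (zpow-suc (+ i + j)))
    (zpow-+ (+ i) j)
  zpow-+ -[1+ zero ] j = ≋-trans (zpow m m' (- 1ℤ + j)) (m' * zpow m m' j) (m' * 1ℤ * zpow m m' j) (zpow-pred j)
    (≋-reflexive (cong (_* zpow m m' j) (sym (ℤ.*-identityʳ m'))))
  zpow-+ -[1+ suc i ] j = shift m' (zpow m m' (-[1+ suc i ] + j)) (zpow m m' (-[1+ i ] + j)) (zpow m m' -[1+ i ]) (zpow m m' j)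
    (subst (λ t → zpow m m' t ≋ m' * zpow m m' (-[1+ i ] + j)) (sym (ℤ.+-assoc (- 1ℤ) -[1+ i ] j)) (zpow-pred (-[1+ i ] + j)))
    (zpow-+ -[1+ i ] j)

zpow-negative : ∀ m m' n → zpow m m' (- + n) ≡ m' ^ n
zpow-negative m m' zero = refl
zpow-negative m m' (suc n) = refl

zpow-^ : ∀ m m' W n → zpow (m ^ W) (m' ^ W) n ≡ zpow m m' (+ W * n)
zpow-^ m m' W (+ n) = trans (ℤ.^-*-assoc m W n) (cong (zpow m m') (ℤ.pos-* W n))
zpow-^ m m' W -[1+ n ] = trans (ℤ.^-*-assoc m' W (suc n)) (trans
  (sym (zpow-negative m m' (W ℕ.* suc n))) (cong (zpow m m')
    (trans (cong -_ (ℤ.pos-* W (suc n))) (ℤ.neg-distribʳ-* (+ W) (+ suc n)))))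

horner : List ℤ → ℤ → ℤ
horner L.[] x = 0ℤ
horner (d L.∷ ds) x = d + x * horner ds x

digitAt : List ℤ → ℕ → ℤ
digitAt L.[] n = 0ℤ
digitAt (d L.∷ ds) zero = d
digitAt (d L.∷ ds) (suc n) = digitAt ds n

norm : List ℤ → ℕ
norm L.[] = 0
norm (d L.∷ ds) = ∣ d ∣ ℕ.+ norm ds

addAt : ℤ → ℕ → List ℤ → List ℤ
addAt c zero L.[] = c L.∷ L.[]
addAt c zero (d L.∷ ds) = (c + d) L.∷ ds
addAt c (suc n) L.[] = 0ℤ L.∷ addAt c n L.[]
addAt c (suc n) (d L.∷ ds) = d L.∷ addAt c n ds

horner-addAt : ∀ c n ds x → horner (addAt c n ds) x ≡ c * x ^ n + horner ds x
horner-addAt c zero L.[] x = cong₂ _+_ (sym (ℤ.*-identityʳ c)) (ℤ.*-zeroʳ x)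
horner-addAt c zero (d L.∷ ds) x = regroup c d (x * horner ds x)
  where
  regroup : ∀ c d y → c + d + y ≡ c * 1ℤ + (d + y)
  regroup = solve-∀
horner-addAt c (suc n) L.[] x = trans (cong (λ t → 0ℤ + x * t) (horner-addAt c n L.[] x)) (regroup c x (x ^ n))
  where
  regroup : ∀ c x y → 0ℤ + x * (c * y + 0ℤ) ≡ c * (x * y) + 0ℤ
  regroup = solve-∀
horner-addAt c (suc n) (d L.∷ ds) x = trans (cong (λ t → d + x * t) (horner-addAt c n ds x))
  (regroup c d x (x ^ n) (horner ds x))
  where
  regroup : ∀ c d x y h → d + x * (c * y + h) ≡ c * (x * y) + (d + x * h)
  regroup = solve-∀

digitAt-addAt : ∀ c n ds → digitAt (addAt c n ds) n ≡ c + digitAt ds n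
digitAt-addAt c zero L.[] = sym (ℤ.+-identityʳ c)
digitAt-addAt c zero (d L.∷ ds) = refl
digitAt-addAt c (suc n) L.[] = digitAt-addAt c n L.[]
digitAt-addAt c (suc n) (d L.∷ ds) = digitAt-addAt c n ds

digitAt-addAt-≢ : ∀ c n ds m → ¬ n ≡ m → digitAt (addAt c n ds) m ≡ digitAt ds m
digitAt-addAt-≢ c zero ds zero n≢m = ⊥-elim (n≢m refl)
digitAt-addAt-≢ c zero L.[] (suc m) n≢m = refl
digitAt-addAt-≢ c zero (d L.∷ ds) (suc m) n≢m = refl
digitAt-addAt-≢ c (suc n) L.[] zero n≢m = refl
digitAt-addAt-≢ c (suc n) (d L.∷ ds) zero n≢m = refl
digitAt-addAt-≢ c (suc n) L.[] (suc m) n≢m = digitAt-addAt-≢ c n L.[] m (n≢m ∘ cong suc)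
digitAt-addAt-≢ c (suc n) (d L.∷ ds) (suc m) n≢m = digitAt-addAt-≢ c n ds m (n≢m ∘ cong suc)

norm-addAt : ∀ c n ds → norm (addAt c n ds) ℕ.≤ ∣ c ∣ ℕ.+ norm ds
norm-addAt c zero L.[] = ℕ.≤-refl
norm-addAt c zero (d L.∷ ds) = ℕ.≤-trans (ℕ.+-monoˡ-≤ (norm ds) (ℤ.∣i+j∣≤∣i∣+∣j∣ c d))
  (ℕ.≤-reflexive (ℕ.+-assoc ∣ c ∣ ∣ d ∣ (norm ds)))
norm-addAt c (suc n) L.[] = norm-addAt c n L.[]
norm-addAt c (suc n) (d L.∷ ds) = ℕ.≤-trans (ℕ.+-monoʳ-≤ ∣ d ∣ (norm-addAt c n ds))
  (ℕ.≤-reflexive (trans (sym (ℕ.+-assoc ∣ d ∣ ∣ c ∣ (norm ds)))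
    (trans (cong (ℕ._+ norm ds) (ℕ.+-comm ∣ d ∣ ∣ c ∣)) (ℕ.+-assoc ∣ c ∣ ∣ d ∣ (norm ds)))))

-- Coefficients smaller than `B` are signed digits of the value at `B`; `small-combination` forces
-- them to be 0 one after another, the constant one first.
digits-vanish : ∀ B ds → norm ds ℕ.< B → horner ds (+ B) ≡ 0ℤ → ∀ n → digitAt ds n ≡ 0ℤ
digits-vanish B L.[] l p n = refl
digits-vanish B (d L.∷ ds) l p n with small-combination B d (horner ds (+ B))
  (ℕ.≤-<-trans (ℕ.m≤m+n ∣ d ∣ (norm ds)) l) p
digits-vanish B (d L.∷ ds) l p zero | _ , d≡0 = d≡0
digits-vanish B (d L.∷ ds) l p (suc n) | q , _ =
  digits-vanish B ds (ℕ.≤-<-trans (ℕ.m≤n+m (norm ds) ∣ d ∣) l) q n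

Sign± : ℤ → Set
Sign± ε = ε ≡ 1ℤ ⊎ ε ≡ - 1ℤ

∣∣≡1⇒± : ∀ x → ∣ x ∣ ≡ 1 → Sign± x
∣∣≡1⇒± (+ 1) refl = inj₁ refl
∣∣≡1⇒± -[1+ 0 ] refl = inj₂ refl

±⇒∣∣≡1 : ∀ {x} → Sign± x → ∣ x ∣ ≡ 1
±⇒∣∣≡1 (inj₁ refl) = refl
±⇒∣∣≡1 (inj₂ refl) = refl

record IsSignedPower (P : List ℤ) : Set where
  constructor signedPower
  field
    sign     : ℤ
    exponent : ℕ
    isSign   : Sign± sign
    at       : digitAt P exponent ≡ sign
    off      : ∀ n → ¬ exponent ≡ n → digitAt P n ≡ 0ℤ

-- At every positive integer B the product of values is d * d' modulo B and also a positive power of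
-- B. Taking B = |d * d'| + 1 leaves only 0. Working with values spares a multiplication of dense
-- polynomials.
product-of-constants-vanishes : ∀ d d' P Q l → (∀ n → horner (d L.∷ P) (+ suc n) * horner (d' L.∷ Q) (+ suc n) ≡ (+ suc n) ^ suc l) →
                                d * d' ≡ 0ℤ
product-of-constants-vanishes d d' P Q l h = conclude ∣ d * d' ∣ refl
  where
  expand : ∀ d d' B p q t → d * d' + B * (d * q + p * d' + B * p * q + - t) ≡ (d + B * p) * (d' + B * q) + - (B * t)
  expand = solve-∀
  conclude : ∀ n → ∣ d * d' ∣ ≡ n → d * d' ≡ 0ℤ
  conclude n n-def = proj₂ (small-combination (suc n) (d * d') (d * q + p * d' + B * p * q + - t) (s≤s (ℕ.≤-reflexive n-def))
    (trans (expand d d' B p q t) (ℤ.i≡j⇒i-j≡0 (h n))))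
    where
    B = + suc n
    p = horner P B
    q = horner Q B
    t = B ^ l

horner-0∷ : ∀ d P x → d ≡ 0ℤ → horner (d L.∷ P) x ≡ x * horner P x
horner-0∷ d P x d≡0 = trans (cong (λ t → t + x * horner P x) d≡0) (ℤ.+-identityˡ (x * horner P x))

1^≢0 : ∀ l → ¬ 1ℤ ^ l ≡ 0ℤ
1^≢0 l h with trans (sym (ℤ.^-zeroˡ l)) h
... | ()

^-suc : ∀ x l → x ^ suc l ≡ x * x ^ l
^-suc x l = refl

cancel-power : ∀ l n p q p' → p' ≡ + suc n * p → p' * q ≡ (+ suc n) ^ suc l → p * q ≡ (+ suc n) ^ l
cancel-power l n p q p' e h = ℤ.*-cancelˡ-≡ (+ suc n) (p * q) ((+ suc n) ^ l)
  (trans (sym (ℤ.*-assoc (+ suc n) p q)) (trans (cong (λ t → t * q) (sym e))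
    (trans h (^-suc (+ suc n) l))))

-- Divisors of x ^ l among integer polynomials: strip factors x, then a
-- polynomial with value ±1 at one large point is ±1.
divides-power : ∀ l P Q → (∀ n → horner P (+ suc n) * horner Q (+ suc n) ≡ (+ suc n) ^ l) → IsSignedPower P
divides-power zero P Q h = signedPower ε 0 ε-sign (ℤ.i-j≡0⇒i≡j _ ε at₀) off₀
  where
  -- The polynomial P - ε has norm at most `norm P + 1`, and it vanishes at `B`, which is larger;
  -- hence it is 0.
  B = suc (suc (norm P))
  ε = horner P (+ B)
  ε-sign : Sign± ε
  ε-sign = ∣∣≡1⇒± ε (ℕ∣.∣1⇒≡1 (ℕ∣.divides ∣ horner Q (+ B) ∣ (sym
    (trans (ℕ.*-comm ∣ horner Q (+ B) ∣ ∣ ε ∣)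
      (trans (sym (ℤ.abs-* ε (horner Q (+ B)))) (cong ∣_∣ (h (suc (norm P)))))))))
  P' = addAt (- ε) 0 P
  small : norm P' ℕ.< B
  small = s≤s (ℕ.≤-trans (norm-addAt (- ε) 0 P)
    (ℕ.+-monoˡ-≤ (norm P) (ℕ.≤-reflexive (trans (ℤ.∣-i∣≡∣i∣ ε) (±⇒∣∣≡1 ε-sign)))))
  collapse : ∀ x → - x * 1ℤ + x ≡ 0ℤ
  collapse = solve-∀
  vanish : ∀ n → digitAt P' n ≡ 0ℤ
  vanish = digits-vanish B P' small (trans (horner-addAt (- ε) 0 P (+ B)) (collapse ε))
  at₀ : digitAt P 0 + - ε ≡ 0ℤ
  at₀ = trans (ℤ.+-comm _ (- ε)) (trans (sym (digitAt-addAt (- ε) 0 P)) (vanish 0))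
  off₀ : ∀ n → ¬ 0 ≡ n → digitAt P n ≡ 0ℤ
  off₀ n 0≢n = trans (sym (digitAt-addAt-≢ (- ε) 0 P n 0≢n)) (vanish n)
-- `h 0` concerns the point 1, where the zero polynomial would yield a power of 1.
divides-power (suc l) L.[] Q h = ⊥-elim (1^≢0 (suc l) (sym (h 0)))
divides-power (suc l) P@(_ L.∷ _) L.[] h = ⊥-elim (1^≢0 (suc l) (trans (sym (h 0)) (ℤ.*-zeroʳ (horner P 1ℤ))))
divides-power (suc l) (d L.∷ P) (d' L.∷ Q) h =
  [ (λ d≡0 → shiftPower d≡0 (divides-power l P (d' L.∷ Q) λ n → cancel-power l n (horner P (+ suc n))
      (horner (d' L.∷ Q) (+ suc n)) (horner (d L.∷ P) (+ suc n)) (horner-0∷ d P (+ suc n) d≡0) (h n)))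
  , (λ d'≡0 → divides-power l (d L.∷ P) Q λ n → trans (ℤ.*-comm (horner (d L.∷ P) (+ suc n)) (horner Q (+ suc n)))
      (cancel-power l n (horner Q (+ suc n)) (horner (d L.∷ P) (+ suc n)) (horner (d' L.∷ Q) (+ suc n))
        (horner-0∷ d' Q (+ suc n) d'≡0)
        (trans (ℤ.*-comm (horner (d' L.∷ Q) (+ suc n)) (horner (d L.∷ P) (+ suc n))) (h n))))
  ]′ (ℤ.i*j≡0⇒i≡0∨j≡0 d (product-of-constants-vanishes d d' P Q l h))
  where
  shiftPower : d ≡ 0ℤ → IsSignedPower P → IsSignedPower (d L.∷ P)
  shiftPower d≡0 (signedPower ε j s at off) = signedPower ε (suc j) s at
    λ { zero _ → d≡0 ; (suc n) j≢n → off n (j≢n ∘ cong suc) }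

-- Kronecker substitution: separation by points, and the units of the Laurent ring

val : ∀ {k} → (M M' : Vector ℤ k) → Vec ℤ k → ℤ
val M M' V.[] = 1ℤ
val M M' (x V.∷ e) = zpow (M zero) (M' zero) x * val (M ∘ suc) (M' ∘ suc) e

-- The exponent vector read as signed digits in base `W`: the exponent of `B` to which Kronecker
-- substitution sends the monomial.
weight : ∀ {k} → ℤ → Vec ℤ k → ℤ
weight W V.[] = 0ℤ
weight W (x V.∷ e) = x + W * weight W e

size : ∀ {k} → Vec ℤ k → ℕ
size V.[] = 0
size (x V.∷ e) = ∣ x ∣ ℕ.+ size e

-- The point with coordinates B, B ^ W, B ^ (W ^ 2) and so on. Raising the base at each step makes
-- the tail of the point again a Kronecker point, as the recursion in `val-kronecker` wants.
kronecker : ∀ {k} → ℕ → ℤ → Vector ℤ k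
kronecker W B zero = B
kronecker W B (suc i) = kronecker W (B ^ W) i

weight-+ : ∀ {k} W (e f : Vec ℤ k) → weight W (V.zipWith _+_ e f) ≡ weight W e + weight W f
weight-+ W V.[] V.[] = refl
weight-+ W (x V.∷ e) (y V.∷ f) = trans (cong (λ t → x + y + W * t) (weight-+ W e f))
  (regroup x y W (weight W e) (weight W f))
  where
  regroup : ∀ x y W a b → x + y + W * (a + b) ≡ x + W * a + (y + W * b)
  regroup = solve-∀

weight-𝟎 : ∀ k W → weight W (V.replicate k 0ℤ) ≡ 0ℤ
weight-𝟎 zero W = refl
weight-𝟎 (suc k) W = trans (ℤ.+-identityˡ (W * weight W (V.replicate k 0ℤ)))
  (trans (cong (λ t → W * t) (weight-𝟎 k W)) (ℤ.*-zeroʳ W))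

-- Entries differ by at most 2X, less than the base 2X + 1, so equal weights have equal digits.
weight-injective : ∀ {k} X (e f : Vec ℤ k) → size e ℕ.≤ X → size f ℕ.≤ X →
                   weight (+ suc (X ℕ.+ X)) e ≡ weight (+ suc (X ℕ.+ X)) f → e ≡ f
weight-injective X V.[] V.[] he hf p = refl
weight-injective X (x V.∷ e) (y V.∷ f) he hf p = cong₂ V._∷_
  (ℤ.i-j≡0⇒i≡j x y (proj₂ both))
  (weight-injective X e f (ℕ.≤-trans (ℕ.m≤n+m (size e) ∣ x ∣) he) (ℕ.≤-trans (ℕ.m≤n+m (size f) ∣ y ∣) hf)
    (ℤ.i-j≡0⇒i≡j (weight W e) (weight W f) (proj₁ both)))
  where
  W = + suc (X ℕ.+ X)
  regroup : ∀ x y W a b → (x + - y) + W * (a + - b) ≡ (x + W * a) + - (y + W * b)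
  regroup = solve-∀
  both : (weight W e + - weight W f) ≡ 0ℤ × (x + - y) ≡ 0ℤ
  both = small-combination (suc (X ℕ.+ X)) (x + - y) (weight W e + - weight W f)
    (s≤s (∣i-j∣≤ x y (ℕ.≤-trans (ℕ.m≤m+n ∣ x ∣ (size e)) he) (ℕ.≤-trans (ℕ.m≤m+n ∣ y ∣ (size f)) hf)))
    (trans (regroup x y W (weight W e) (weight W f)) (ℤ.i≡j⇒i-j≡0 p))

module _ (N : ℤ) where
  open Congruence N

  val-+ : ∀ {k} (M M' : Vector ℤ k) → (∀ i → M i * M' i ≋ 1ℤ) → ∀ e f →
          val M M' (V.zipWith _+_ e f) ≋ val M M' e * val M M' f
  val-+ M M' inv V.[] V.[] = ≋-reflexive {1ℤ} refl
  val-+ M M' inv (x V.∷ e) (y V.∷ f) = ≋-trans (zp (x + y) * v (V.zipWith _+_ e f)) ((zp x * zp y) * (v e * v f)) ((zp x * v e) * (zp y * v f))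
    (≋-* (zp (x + y)) (zp x * zp y) (v (V.zipWith _+_ e f)) (v e * v f)
      (zpow-+ N (M zero) (M' zero) (inv zero) x y) (val-+ (M ∘ suc) (M' ∘ suc) (inv ∘ suc) e f))
    (≋-reflexive (regroup (zp x) (zp y) (v e) (v f)))
    where
    zp = zpow (M zero) (M' zero)
    v = val (M ∘ suc) (M' ∘ suc)
    regroup : ∀ a b c d → a * b * (c * d) ≡ a * c * (b * d)
    regroup = solve-∀

  ^-inverse : ∀ B T W → B * T ≋ 1ℤ → B ^ W * T ^ W ≋ 1ℤ
  ^-inverse B T zero inv = ≋-reflexive {1ℤ} refl
  ^-inverse B T (suc W) inv = ≋-trans (B * B ^ W * (T * T ^ W)) ((B * T) * (B ^ W * T ^ W)) 1ℤ
    (≋-reflexive (regroup B (B ^ W) T (T ^ W)))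
    (≋-* (B * T) 1ℤ (B ^ W * T ^ W) 1ℤ inv (^-inverse B T W inv))
    where
    regroup : ∀ a b c d → a * b * (c * d) ≡ a * c * (b * d)
    regroup = solve-∀

  kronecker-inverse : ∀ {k} W B T → B * T ≋ 1ℤ → ∀ i → kronecker {k} W B i * kronecker {k} W T i ≋ 1ℤ
  kronecker-inverse W B T inv zero = inv
  kronecker-inverse W B T inv (suc i) = kronecker-inverse W (B ^ W) (T ^ W) (^-inverse B T W inv) i

  val-kronecker : ∀ {k} W B T → B * T ≋ 1ℤ → (e : Vec ℤ k) →
                  val (kronecker W B) (kronecker W T) e ≋ zpow B T (weight (+ W) e)
  val-kronecker W B T inv V.[] = ≋-reflexive {1ℤ} refl
  val-kronecker W B T inv (x V.∷ e) = ≋-trans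
    (zpow B T x * rest) (zpow B T x * zpow B T (+ W * weight (+ W) e)) (zpow B T (x + + W * weight (+ W) e))
    (≋-*ˡ (zpow B T x) rest (zpow B T (+ W * weight (+ W) e))
      (subst (rest ≋_) (zpow-^ B T W (weight (+ W) e))
        (val-kronecker W (B ^ W) (T ^ W) (^-inverse B T W inv) e)))
    (≋-sym (zpow B T (x + + W * weight (+ W) e)) (zpow B T x * zpow B T (+ W * weight (+ W) e))
      (zpow-+ N B T inv x (+ W * weight (+ W) e)))
    where
    rest = val (kronecker W (B ^ W)) (kronecker W (T ^ W)) e

sumOver : {A : Set} → (A → ℕ) → List A → ℕ
sumOver f L.[] = 0
sumOver f (x L.∷ xs) = f x ℕ.+ sumOver f xs

∈⇒≤sumOver : {A : Set} (f : A → ℕ) {x : A} (xs : List A) → x ∈ xs → f x ℕ.≤ sumOver f xs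
∈⇒≤sumOver f (x L.∷ xs) (here refl) = ℕ.m≤m+n (f x) (sumOver f xs)
∈⇒≤sumOver f (y L.∷ xs) (there h) = ℕ.≤-trans (∈⇒≤sumOver f xs h) (ℕ.m≤n+m (sumOver f xs) (f y))

shift-nonnegative : ∀ E x → ∣ x ∣ ℕ.≤ E → + ∣ + E + x ∣ ≡ + E + x
shift-nonnegative E (+ n) _ = refl
shift-nonnegative E -[1+ n ] h = trans (cong (λ t → + ∣ t ∣) (ℤ.⊖-≥ h)) (sym (ℤ.⊖-≥ h))

module KroneckerSubstitution (k : ℕ) where
  open LaurentRing k

  dense : (Exponent → ℕ) → List (Monomial k) → List ℤ
  dense f L.[] = L.[]
  dense f ((c , e) L.∷ p) = addAt c (f e) (dense f p)

  horner-dense : ∀ f p x → horner (dense f p) x ≡ pair p (λ e → x ^ f e)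
  horner-dense f L.[] x = refl
  horner-dense f ((c , e) L.∷ p) x = trans (horner-addAt c (f e) (dense f p) x)
    (cong (λ t → c * x ^ f e + t) (horner-dense f p x))

  digitAt-dense : ∀ f p e₀ → (∀ {c e} → (c , e) ∈ p → f e ≡ f e₀ → e ≡ e₀) →
                  digitAt (dense f p) (f e₀) ≡ coeff p e₀
  digitAt-dense f L.[] e₀ inj = refl
  digitAt-dense f ((c , e) L.∷ p) e₀ inj with e ≟ᵉ e₀
  ... | yes refl = trans (digitAt-addAt c (f e) (dense f p)) (cong (λ t → c + t) (digitAt-dense f p e (inj ∘ there)))
  ... | no e≢e₀ = trans (digitAt-addAt-≢ c (f e) (dense f p) (f e₀) (e≢e₀ ∘ inj (here refl)))
                    (digitAt-dense f p e₀ (inj ∘ there))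

  pair-cong-∈ : ∀ p {h h'} → (∀ {c e} → (c , e) ∈ p → h e ≡ h' e) → pair p h ≡ pair p h'
  pair-cong-∈ L.[] hyp = refl
  pair-cong-∈ ((c , e) L.∷ p) hyp = cong₂ (λ s t → c * s + t) (hyp (here refl)) (pair-cong-∈ p (hyp ∘ there))

  module _ (N : ℤ) where
    open Congruence N

    pair-≋-∈ : ∀ p h h' → (∀ {c e} → (c , e) ∈ p → h e ≋ h' e) → pair p h ≋ pair p h'
    pair-≋-∈ L.[] h h' hyp = ≋-reflexive {0ℤ} refl
    pair-≋-∈ ((c , e) L.∷ p) h h' hyp = ≋-+ (c * h e) (c * h' e) (pair p h) (pair p h')
      (≋-*ˡ c (h e) (h' e) (hyp (here refl))) (pair-≋-∈ p h h' (hyp ∘ there))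

    pair-≋ : ∀ p h h' → (∀ e → h e ≋ h' e) → pair p h ≋ pair p h'
    pair-≋ p h h' hyp = pair-≋-∈ p h h' λ {_} {e} _ → hyp e

  sizes : List (Monomial k) → ℕ
  sizes = sumOver (size ∘ proj₂)

  weights : ℤ → List (Monomial k) → ℕ
  weights W = sumOver (λ m → ∣ weight W (proj₂ m) ∣)

  -- The shift by `E` clears negative exponents. When `E` bounds the weights, as it does at every
  -- exponent concerned, the absolute value merely passes from ℤ to ℕ.
  degree : ℕ → ℤ → Exponent → ℕ
  degree E W e = ∣ + E + weight W e ∣

  degree-injective : ∀ X E e f → let W = + suc (X ℕ.+ X) in size e ℕ.≤ X → size f ℕ.≤ X →
                     ∣ weight W e ∣ ℕ.≤ E → ∣ weight W f ∣ ℕ.≤ E → degree E W e ≡ degree E W f → e ≡ f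
  degree-injective X E e f he hf we wf p = weight-injective X e f he hf
    (cancel (+ E) (weight W e) (weight W f)
      (trans (sym (shift-nonnegative E (weight W e) we))
        (trans (cong +_ p) (shift-nonnegative E (weight W f) wf))))
    where
    W = + suc (X ℕ.+ X)
    isolate : ∀ E x → x ≡ - E + (E + x)
    isolate = solve-∀
    cancel : ∀ E x y → E + x ≡ E + y → x ≡ y
    cancel E x y h = trans (isolate E x) (trans (cong (λ t → - E + t) h) (sym (isolate E y)))

  small-multiple : ∀ N x → ∣ x ∣ ℕ.< ∣ N ∣ → N ∣ᶻ x → x ≡ 0ℤ
  small-multiple N x l h with x ℤ.≟ 0ℤ
  ... | yes p = p
  ... | no p = ⊥-elim (ℕ.<⇒≱ l (∣ᶻ⇒∣∣≤∣∣ N p h))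

  -- Substitution at one large Kronecker point, multiplied by B ^ E, gives an integer P whose base-B
  -- digits are the coefficients of `p`. It is 0 modulo an `N` larger than |P|, hence 0, and then
  -- all its digits are 0. Including `e₀` in the bounds keeps its degree apart from those of the
  -- other exponents.
  vanishes-at-points⇒0 : ∀ p → (∀ N (M M' : Vector ℤ k) → (∀ i → M i * M' i ≡ 1ℤ [mod N ]) →
                                pair p (val M M') ≡ 0ℤ [mod N ]) → ∀ e → coeff p e ≡ 0ℤ
  vanishes-at-points⇒0 p vanish e₀ = trans
    (sym (digitAt-dense f p e₀ λ {c} {e} m → degree-injective X E e e₀
      (ℕ.≤-trans (∈⇒≤sumOver (size ∘ proj₂) p m) (ℕ.m≤n+m (sizes p) (size e₀))) (ℕ.m≤m+n (size e₀) (sizes p))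
      (weight≤E m) (ℕ.m≤m+n ∣ weight (+ W) e₀ ∣ (weights (+ W) p))))
    (digits-vanish b (dense f p) (s≤s (ℕ.n≤1+n (norm (dense f p)))) (trans (horner-dense f p B) P≡0) (f e₀))
    where
    X = size e₀ ℕ.+ sizes p
    W = suc (X ℕ.+ X)
    E = ∣ weight (+ W) e₀ ∣ ℕ.+ weights (+ W) p
    f = degree E (+ W)
    weight≤E : ∀ {c e} → (c , e) ∈ p → ∣ weight (+ W) e ∣ ℕ.≤ E
    weight≤E m = ℕ.≤-trans (∈⇒≤sumOver (λ m → ∣ weight (+ W) (proj₂ m) ∣) p m)
      (ℕ.m≤n+m (weights (+ W) p) ∣ weight (+ W) e₀ ∣)
    -- Larger than the norm, so that the digits of P determine the coefficients, and at least 2, so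
    -- that b * t - 1 ≥ t > |P|.
    b = suc (suc (norm (dense f p)))
    B = + b
    P = pair p (λ e → B ^ f e)
    t = suc ∣ P ∣
    T = + t
    -- With this modulus `t` is an inverse of `b`, as the point requires.
    N = + (b ℕ.* t ℕ.∸ 1)
    BT≡ : B * T ≡ 1ℤ + N
    BT≡ = trans (sym (ℤ.pos-* b t)) (cong +_ (sym (ℕ.m+[n∸m]≡n {1} {b ℕ.* t} (s≤s z≤n))))
    open Congruence N
    inverse : B * T ≋ 1ℤ
    inverse = 1ℤ , trans (cong (λ t → t + - 1ℤ) BT≡) (collapse N)
      where
      collapse : ∀ N → (1ℤ + N) + - 1ℤ ≡ N * 1ℤ
      collapse = solve-∀
    v = val {k} (kronecker W B) (kronecker W T)
    v-eq : ∀ {c e} → (c , e) ∈ p → B ^ E * v e ≋ B ^ f e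
    v-eq {c} {e} m = ≋-trans (B ^ E * v e) (B ^ E * zpow B T (weight (+ W) e)) (B ^ f e)
      (≋-*ˡ (B ^ E) (v e) (zpow B T (weight (+ W) e)) (val-kronecker N W B T inverse e))
      (subst (λ z → B ^ E * zpow B T (weight (+ W) e) ≋ zpow B T z)
        (sym (shift-nonnegative E (weight (+ W) e) (weight≤E m)))
        (≋-sym (zpow B T (+ E + weight (+ W) e)) (B ^ E * zpow B T (weight (+ W) e))
          (zpow-+ N B T inverse (+ E) (weight (+ W) e))))
    P≋0 : P ≋ 0ℤ
    P≋0 = ≋-trans P (B ^ E * pair p v) 0ℤ
      (≋-sym (B ^ E * pair p v) P (subst (_≋ P) (pair-scale p v (B ^ E))
        (pair-≋-∈ N p (λ e → B ^ E * v e) (λ e → B ^ f e) v-eq)))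
      (subst (λ z → B ^ E * pair p v ≋ z) (ℤ.*-zeroʳ (B ^ E))
        (≋-*ˡ (B ^ E) (pair p v) 0ℤ
          (vanish N (kronecker W B) (kronecker W T) (kronecker-inverse N W B T inverse))))
    P<N : ∣ P ∣ ℕ.< b ℕ.* t ℕ.∸ 1
    P<N = ℕ.≤-trans (ℕ.m≤m+n t ((suc (norm (dense f p))) ℕ.* t ℕ.∸ 1)) (ℕ.≤-reflexive
      (trans (sym (ℕ.+-∸-assoc t {suc (norm (dense f p)) ℕ.* t} {1} (s≤s z≤n))) refl))
    P≡0 : P ≡ 0ℤ
    P≡0 = small-multiple N P P<N (subst (N ∣ᶻ_) (ℤ.+-identityʳ P) P≋0)

  -- Both factors are shifted by `E`, so their degrees add up to a degree shifted by 2E, and the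
  -- product of the dense polynomials takes the values of a single power. Its divisor `dense f p` is
  -- then a signed power, and injectivity of degrees on the exponents of `p` carries this back to
  -- `p`.
  unit⇒signed-monomial : ∀ p q → p *ᴸ q ≈ᴸ 1ᴸ → Σ ℤ λ ε → Σ Exponent λ e → Sign± ε × p ≈ᴸ monomial ε e
  unit⇒signed-monomial p q pq≈1 = conclude (divides-power (degree (E ℕ.+ E) W 𝟎) (dense f p) (dense f q) product)
    where
    X = sizes p ℕ.+ sizes q
    W = + suc (X ℕ.+ X)
    E = weights W p ℕ.+ weights W q
    f = degree E W
    p≤E : ∀ {c e} → (c , e) ∈ p → ∣ weight W e ∣ ℕ.≤ E
    p≤E m = ℕ.≤-trans (∈⇒≤sumOver (λ m → ∣ weight W (proj₂ m) ∣) p m) (ℕ.m≤m+n (weights W p) (weights W q))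
    q≤E : ∀ {c e} → (c , e) ∈ q → ∣ weight W e ∣ ℕ.≤ E
    q≤E m = ℕ.≤-trans (∈⇒≤sumOver (λ m → ∣ weight W (proj₂ m) ∣) q m) (ℕ.m≤n+m (weights W q) (weights W p))
    degree-+ : ∀ {c e c' e'} → (c , e) ∈ p → (c' , e') ∈ q → f e ℕ.+ f e' ≡ degree (E ℕ.+ E) W (e ⊹ e')
    degree-+ {c} {e} {c'} {e'} m m' = sym (ℤ.+-injective (cong (λ t → + ∣ t ∣) sum-eq))
      where
      regroup : ∀ E a b → E + E + (a + b) ≡ (E + a) + (E + b)
      regroup = solve-∀
      sum-eq : + (E ℕ.+ E) + weight W (e ⊹ e') ≡ + (f e ℕ.+ f e')
      sum-eq = trans (cong (λ t → + E + + E + t) (weight-+ W e e'))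
        (trans (regroup (+ E) (weight W e) (weight W e'))
          (sym (cong₂ _+_ (shift-nonnegative E (weight W e) (p≤E m)) (shift-nonnegative E (weight W e') (q≤E m')))))
    product : ∀ n → horner (dense f p) (+ suc n) * horner (dense f q) (+ suc n) ≡ (+ suc n) ^ degree (E ℕ.+ E) W 𝟎
    product n = begin
      horner (dense f p) B * horner (dense f q) B   ≡⟨ cong₂ _*_ (horner-dense f p B) (horner-dense f q B) ⟩
      pair p h * pair q h                           ≡⟨ ℤ.*-comm (pair p h) (pair q h) ⟩
      pair q h * pair p h                           ≡⟨ sym (pair-scale p h (pair q h)) ⟩
      pair p (λ e → pair q h * h e)                 ≡⟨ pair-cong-∈ p (λ {c} {e} m → trans (ℤ.*-comm (pair q h) (h e))
                                                         (trans (sym (pair-scale q h (h e))) (pair-cong-∈ q (powers m)))) ⟩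
      pair p (λ e → pair q (λ e' → h² (e ⊹ e')))    ≡⟨ sym (pair-* p q h²) ⟩
      pair (p *ᴸ q) h²                              ≡⟨ ≈⇒pair {p *ᴸ q} {1ᴸ} pq≈1 h² ⟩
      pair 1ᴸ h²                                    ≡⟨ pair-one h² ⟩
      h² 𝟎                                          ∎
      where
      open ≡.≡-Reasoning
      B = + suc n
      h h² : Exponent → ℤ
      h e = B ^ f e
      h² e = B ^ degree (E ℕ.+ E) W e
      powers : ∀ {c e} → (c , e) ∈ p → ∀ {c' e'} → (c' , e') ∈ q → h e * h e' ≡ h² (e ⊹ e')
      powers {c} {e} m {c'} {e'} m' = trans (sym (ℤ.^-distribˡ-+-* B (f e) (f e'))) (cong (B ^_) (degree-+ m m'))
    injective : ∀ {c e c' e'} → (c , e) ∈ p → (c' , e') ∈ p → f e ≡ f e' → e ≡ e'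
    injective {e = e} {e' = e'} m m' = degree-injective X E e e' (size≤X m) (size≤X m') (p≤E m) (p≤E m')
      where
      size≤X : ∀ {c e} → (c , e) ∈ p → size e ℕ.≤ X
      size≤X m = ℕ.≤-trans (∈⇒≤sumOver (size ∘ proj₂) p m) (ℕ.m≤m+n (sizes p) (sizes q))
    -- The coefficient ±1 of the signed power is nonzero, so its degree belongs to an exponent that
    -- occurs in `p`.
    find : ∀ r j → (Σ ℤ λ c → Σ Exponent λ e → (c , e) ∈ r × f e ≡ j) ⊎ digitAt (dense f r) j ≡ 0ℤ
    find L.[] j = inj₂ refl
    find ((c , e) L.∷ r) j with f e ℕ.≟ j
    ... | yes fe≡j = inj₁ (c , e , here refl , fe≡j)
    ... | no fe≢j with find r j
    ...   | inj₁ (c' , e' , m , h) = inj₁ (c' , e' , there m , h)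
    ...   | inj₂ h = inj₂ (trans (digitAt-addAt-≢ c (f e) (dense f r) j fe≢j) h)
    occurs? : ∀ r e → (Σ ℤ λ c → (c , e) ∈ r) ⊎ coeff r e ≡ 0ℤ
    occurs? L.[] e = inj₂ refl
    occurs? ((c , e') L.∷ r) e with e' ≟ᵉ e
    ... | yes refl = inj₁ (c , here refl)
    ... | no _ with occurs? r e
    ...   | inj₁ (c' , m) = inj₁ (c' , there m)
    ...   | inj₂ h = inj₂ h
    nonzero : ∀ {ε} → Sign± ε → ¬ ε ≡ 0ℤ
    nonzero (inj₁ refl) ()
    nonzero (inj₂ refl) ()
    conclude : IsSignedPower (dense f p) → Σ ℤ λ ε → Σ Exponent λ e → Sign± ε × p ≈ᴸ monomial ε e
    conclude (signedPower ε j ε± at off) with find p j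
    ... | inj₂ h = ⊥-elim (nonzero ε± (trans (sym at) h))
    ... | inj₁ (c , g , g∈p , fg≡j) = ε , g , ε± , equal
      where
      equal : p ≈ᴸ monomial ε g
      equal e with g ≟ᵉ e | occurs? p e
      ... | yes refl | _ = trans (sym (digitAt-dense f p g λ m → injective m g∈p))
                             (trans (cong (digitAt (dense f p)) fg≡j) (trans at (sym (ℤ.+-identityʳ ε))))
      ... | no g≢e | inj₂ h = h
      ... | no g≢e | inj₁ (c' , e∈p) = trans (sym (digitAt-dense f p e λ m → injective m e∈p))
              (off (f e) λ j≡fe → g≢e (injective g∈p e∈p (trans fg≡j j≡fe)))

-- The integers inside the Laurent polynomial ring

-- a is an integer iff for every unit s some unit w satisfies w ≡ 1 + a(s - 1) modulo (s - 1)²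
-- (take w = s ^ a).
constantᶠ : Fml (Fin 1)
constantᶠ = ∀ᶠ (∀ᶠ (eq (var (just nothing) ⊗ var nothing) 𝟙 ⇒ᶠ
  ∃ᶠ (∃ᶠ (∃ᶠ (eq (var (just (just nothing)) ⊗ var (just nothing)) 𝟙 ∧ᶠ
    eq (var (just (just nothing))) (𝟙 ⊕ σ ⊗ (var (just (just (just (just (just zero))))) ⊕ σ ⊗ var nothing)))))))
  where
  σ : Term (Maybe (Maybe (Maybe (Maybe (Maybe (Fin 1))))))
  σ = var (just (just (just (just nothing)))) ⊕ ⊝ 𝟙

-- Over an arbitrary commutative ring the identities in s - 1 go to the semiring solver, with s - 1
-- as a variable and negatives as atoms.
module UnitPowers (R : CommutativeRing 0ℓ 0ℓ) where
  open CommutativeRing R renaming (Carrier to C; _+_ to _⊞_; _*_ to _·_; -_ to ⊟_; _≈_ to _~_;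
    refl to ~-refl; sym to ~-sym; trans to ~-trans; zero to ·-zero)
  open import Relation.Binary.Reasoning.Setoid setoid
  open SemiringSolver commutativeSemiring using (solve; _:=_; _:+_; _:*_; con)

  Approximates : (σ a w w' y : C) → Set
  Approximates σ a w w' y = (w · w' ~ 1#) × (w ~ 1# ⊞ σ · (a ⊞ σ · y))

  HasPower : (σ a : C) → Set
  HasPower σ a = Σ C λ w → Σ C λ w' → Σ C λ y → Approximates σ a w w' y

  module _ (s s' : C) (unit : s · s' ~ 1#) where
    σ : C
    σ = s ⊞ ⊟ 1#

    private
      s≈ : s ~ 1# ⊞ σ
      s≈ = begin
        s                    ≈⟨ ~-sym (+-identityʳ s) ⟩
        s ⊞ 0#               ≈⟨ +-congˡ (~-sym (-‿inverseˡ 1#)) ⟩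
        s ⊞ (⊟ 1# ⊞ 1#)      ≈⟨ ~-sym (+-assoc s (⊟ 1#) 1#) ⟩
        σ ⊞ 1#               ≈⟨ +-comm σ 1# ⟩
        1# ⊞ σ               ∎

      times-s : ∀ a y → (1# ⊞ σ · (a ⊞ σ · y)) · s ~ 1# ⊞ σ · ((1# ⊞ a) ⊞ σ · (a ⊞ y ⊞ σ · y))
      times-s a y = ~-trans (*-congˡ s≈) (solve 3 (λ t a y →
        (con 1 :+ t :* (a :+ t :* y)) :* (con 1 :+ t) :=
        con 1 :+ t :* ((con 1 :+ a) :+ t :* (a :+ y :+ t :* y))) ~-refl σ a y)

      unit-* : ∀ {x x' y y'} → x · x' ~ 1# → y · y' ~ 1# → (x · y) · (x' · y') ~ 1#
      unit-* {x} {x'} {y} {y'} p q = begin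
        (x · y) · (x' · y') ≈⟨ solve 4 (λ x x' y y' → (x :* y) :* (x' :* y') := (x :* x') :* (y :* y')) ~-refl x x' y y' ⟩
        (x · x') · (y · y') ≈⟨ *-cong p q ⟩
        1# · 1#             ≈⟨ *-identityˡ 1# ⟩
        1#                  ∎

    hasPower-cong : ∀ {a b} → a ~ b → HasPower σ a → HasPower σ b
    hasPower-cong a~b (w , w' , y , u , e) = w , w' , y , u , ~-trans e (+-congˡ (*-congˡ (+-congʳ a~b)))

    hasPower-zero : HasPower σ 0#
    hasPower-zero = 1# , 1# , 0# , *-identityˡ 1# ,
      ~-sym (solve 1 (λ t → con 1 :+ t :* (con 0 :+ t :* con 0) := con 1) ~-refl σ)

    hasPower-suc : ∀ {a} → HasPower σ a → HasPower σ (1# ⊞ a)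
    hasPower-suc {a} (w , w' , y , u , e) = w · s , w' · s' , (a ⊞ y ⊞ σ · y) , unit-* u unit ,
      ~-trans (*-congʳ e) (times-s a y)

    -- Division by `s`. The remainder term y' = s'(y - a) solves a + s * y' = y, which is the
    -- condition under which `times-s` at (a , y') returns `w`.
    hasPower-pred : ∀ {a} → HasPower σ (1# ⊞ a) → HasPower σ a
    hasPower-pred {a} (w , w' , y , u , e) = w · s' , w' · s , y' , unit-* u (~-trans (*-comm s' s) unit) , (begin
      w · s'                                 ≈⟨ *-congʳ (~-trans e (~-sym shifted)) ⟩
      ((1# ⊞ σ · (a ⊞ σ · y')) · s) · s'     ≈⟨ *-assoc _ s s' ⟩
      (1# ⊞ σ · (a ⊞ σ · y')) · (s · s')     ≈⟨ *-congˡ unit ⟩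
      (1# ⊞ σ · (a ⊞ σ · y')) · 1#           ≈⟨ *-identityʳ _ ⟩
      1# ⊞ σ · (a ⊞ σ · y')                  ∎)
      where
      y' = s' · (y ⊞ ⊟ a)
      collect : a ⊞ y' ⊞ σ · y' ~ y
      collect = begin
        a ⊞ y' ⊞ σ · y'          ≈⟨ solve 3 (λ a y t → a :+ y :+ t :* y := a :+ (con 1 :+ t) :* y) ~-refl a y' σ ⟩
        a ⊞ (1# ⊞ σ) · y'        ≈⟨ +-congˡ (*-congʳ (~-sym s≈)) ⟩
        a ⊞ s · y'               ≈⟨ +-congˡ (~-sym (*-assoc s s' _)) ⟩
        a ⊞ (s · s') · (y ⊞ ⊟ a) ≈⟨ +-congˡ (~-trans (*-congʳ unit) (*-identityˡ _)) ⟩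
        a ⊞ (y ⊞ ⊟ a)            ≈⟨ solve 3 (λ a y b → a :+ (y :+ b) := y :+ (a :+ b)) ~-refl a y (⊟ a) ⟩
        y ⊞ (a ⊞ ⊟ a)            ≈⟨ +-congˡ (-‿inverseʳ a) ⟩
        y ⊞ 0#                   ≈⟨ +-identityʳ y ⟩
        y                        ∎
      shifted : (1# ⊞ σ · (a ⊞ σ · y')) · s ~ 1# ⊞ σ · ((1# ⊞ a) ⊞ σ · y)
      shifted = ~-trans (times-s a y') (+-congˡ (*-congˡ (+-congˡ (*-congˡ collect))))

module Constants (k : ℕ) where
  open LaurentRing k

  constant : ℤ → R
  constant n = monomial n 𝟎

  pair-constant : ∀ n h → pair (constant n) h ≡ n * h 𝟎
  pair-constant n h = pair-monomial n 𝟎 h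

  constant-injective : ∀ m n → constant m ≈ᴸ constant n → m ≡ n
  constant-injective m n h = trans (sym (ℤ.*-identityʳ m)) (trans (sym (pair-constant m (λ _ → 1ℤ)))
    (trans (≈⇒pair {constant m} {constant n} h (λ _ → 1ℤ)) (trans (pair-constant n (λ _ → 1ℤ)) (ℤ.*-identityʳ n))))

  constant-op : ∀ f (ns : Vector ℤ (arity f)) →
                ⟦_⟧ (Laurent k) f (constant ∘ ns) ≈ᴸ constant (⟦_⟧ ℤ-ring f ns)
  constant-op add ns = pair⇒≈ (constant m +ᴸ constant n) (constant (m + n)) λ h →
    trans (pair-++ (constant m) (constant n) h) (trans (cong₂ _+_ (pair-constant m h) (pair-constant n h))
      (trans (sym (ℤ.*-distribʳ-+ (h 𝟎) m n)) (sym (pair-constant (m + n) h))))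
    where
    m = ns zero
    n = ns (suc zero)
  constant-op mul ns = pair⇒≈ (constant m *ᴸ constant n) (constant (m * n)) λ h →
    trans (pair-* (constant m) (constant n) h) (trans (pair-constant m (λ e → pair (constant n) (λ e' → h (e ⊹ e'))))
      (trans (cong (λ t → m * t) (pair-constant n (λ e' → h (𝟎 ⊹ e'))))
        (trans (sym (ℤ.*-assoc m n (h (𝟎 ⊹ 𝟎)))) (trans (cong (λ e → m * n * h e) (⊹-identityˡ 𝟎))
          (sym (pair-constant (m * n) h))))))
    where
    m = ns zero
    n = ns (suc zero)
  constant-op neg ns = λ e → refl
  constant-op zer ns = pair⇒≈ 0ᴸ (constant 0ℤ) λ h → refl
  constant-op one ns = λ e → refl

  constant-satisfies : ∀ n → RichSemantics.Sem (Laurent k) constantᶠ (λ _ → constant n)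
  constant-satisfies n s s' unit = power n
    where
    open UnitPowers laurentRing
    successor : ∀ m → 1ᴸ +ᴸ constant m ≈ᴸ constant (1ℤ + m)
    successor m = constant-op add (1ℤ ∷ (λ _ → m))
    power : ∀ n → HasPower (σ s s' unit) (constant n)
    power (+ zero) = hasPower-cong s s' unit {0ᴸ} {constant 0ℤ} (constant-op zer []) (hasPower-zero s s' unit)
    power (+ suc n) = hasPower-cong s s' unit {1ᴸ +ᴸ constant (+ n)} {constant (+ suc n)} (successor (+ n))
      (hasPower-suc s s' unit {constant (+ n)} (power (+ n)))
    power -[1+ zero ] = hasPower-pred s s' unit {constant (- 1ℤ)}
      (hasPower-cong s s' unit {constant 0ℤ} {1ᴸ +ᴸ constant (- 1ℤ)}
        (λ e → sym (successor (- 1ℤ) e)) (power (+ zero)))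
    power -[1+ suc n ] = hasPower-pred s s' unit {constant -[1+ suc n ]}
      (hasPower-cong s s' unit {constant -[1+ n ]} {1ᴸ +ᴸ constant -[1+ suc n ]}
        (λ e → sym (successor -[1+ suc n ] e)) (power -[1+ n ]))

module ConstantsDefinable (l : ℕ) where
  private
    k = suc l
  open LaurentRing k
  open KroneckerSubstitution k
  open Constants k

  tail𝟎 : Vec ℤ l
  tail𝟎 = V.replicate l 0ℤ

  module Period (m : ℕ) where
    private
      M = + suc m

    μ μ' : Exponent
    μ = M V.∷ tail𝟎
    μ' = - M V.∷ tail𝟎

    InClass : Exponent → Exponent → Set
    InClass e e' = Σ ℤ λ x → e' ≡ (V.head e + M * x) V.∷ V.tail e

    inClass? : ∀ e e' → Dec (InClass e e')
    inClass? (y V.∷ e) (y' V.∷ e') with Vecₚ.≡-dec ℤ._≟_ e' e | M ∣ˢ? (y' + - y)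
    ... | no e'≢e | _ = no λ (x , p) → e'≢e (cong V.tail p)
    ... | yes _ | no ∤ = no λ (x , p) → ∤ (divides x (trans (cong (λ t → V.head t + - y) p) (cancel y M x)))
      where
      cancel : ∀ y M x → y + M * x + - y ≡ x * M
      cancel = solve-∀
    ... | yes refl | yes (divides x p) = yes (x , cong (V._∷ e) (trans (restore y y') (cong (λ t → y + t) (trans p (ℤ.*-comm x M)))))
      where
      restore : ∀ y y' → y' ≡ y + (y' + - y)
      restore = solve-∀

    inClass-unique : ∀ e {e'} (p q : InClass e e') → proj₁ p ≡ proj₁ q
    inClass-unique e (x , p) (x' , q) = ℤ.*-cancelˡ-≡ M x x' (trans (isolate (V.head e) (M * x))
      (trans (cong (λ t → - V.head e + t) (cong V.head (trans (sym p) q))) (sym (isolate (V.head e) (M * x')))))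
      where
      isolate : ∀ y z → z ≡ - y + (y + z)
      isolate = solve-∀

    -- Pairing with `indicator e` sums coefficients over the class of `e` and kills multiples of s -
    -- 1. `quotientIn e` is its discrete antiderivative under the shift by μ, so pairing it with a
    -- multiple (s - 1)d returns the class sum of d.
    quotientIn indicator : Exponent → Exponent → ℤ
    quotientIn e e' with inClass? e e'
    ... | yes (x , _) = x
    ... | no _ = 0ℤ
    indicator e e' with inClass? e e'
    ... | yes _ = 1ℤ
    ... | no _ = 0ℤ

    quotientIn-yes : ∀ e e' (p : InClass e e') → quotientIn e e' ≡ proj₁ p
    quotientIn-yes e e' p with inClass? e e'
    ... | yes q = inClass-unique e q p
    ... | no ¬p = ⊥-elim (¬p p)

    quotientIn-no : ∀ e e' → ¬ InClass e e' → quotientIn e e' ≡ 0ℤ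
    quotientIn-no e e' ¬p with inClass? e e'
    ... | yes q = ⊥-elim (¬p q)
    ... | no _ = refl

    indicator-yes : ∀ e e' → InClass e e' → indicator e e' ≡ 1ℤ
    indicator-yes e e' p with inClass? e e'
    ... | yes q = refl
    ... | no ¬p = ⊥-elim (¬p p)

    indicator-no : ∀ e e' → ¬ InClass e e' → indicator e e' ≡ 0ℤ
    indicator-no e e' ¬p with inClass? e e'
    ... | yes q = ⊥-elim (¬p q)
    ... | no _ = refl

    inClass-shift : ∀ e e' (p : InClass e e') → Σ (InClass e (μ ⊹ e')) λ q → proj₁ q ≡ proj₁ p + 1ℤ
    inClass-shift e e' (x , p) = (x + 1ℤ , trans (cong (μ ⊹_) p)
      (cong₂ V._∷_ (regroup M (V.head e) x) (Vecₚ.zipWith-identityˡ ℤ.+-identityˡ (V.tail e)))) , refl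
      where
      regroup : ∀ M y x → M + (y + M * x) ≡ y + M * (x + 1ℤ)
      regroup = solve-∀

    inClass-unshift : ∀ e e' → InClass e (μ ⊹ e') → InClass e e'
    inClass-unshift e (y' V.∷ e') (x , p) = x + - 1ℤ , cong₂ V._∷_
      (trans (isolate M y') (trans (cong (λ t → - M + V.head t) p) (regroup M (V.head e) x)))
      (trans (sym (Vecₚ.zipWith-identityˡ ℤ.+-identityˡ e')) (cong V.tail p))
      where
      isolate : ∀ M y → y ≡ - M + (M + y)
      isolate = solve-∀
      regroup : ∀ M y x → - M + (y + M * x) ≡ y + M * (x + - 1ℤ)
      regroup = solve-∀

    indicator-shift : ∀ e e' → indicator e (μ ⊹ e') + - indicator e e' ≡ 0ℤ
    indicator-shift e e' = ℤ.i≡j⇒i-j≡0 (shift (inClass? e e'))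
      where
      shift : Dec (InClass e e') → indicator e (μ ⊹ e') ≡ indicator e e'
      shift (yes p) = trans (indicator-yes e (μ ⊹ e') (proj₁ (inClass-shift e e' p))) (sym (indicator-yes e e' p))
      shift (no ¬p) = trans (indicator-no e (μ ⊹ e') (¬p ∘ inClass-unshift e e')) (sym (indicator-no e e' ¬p))

    quotientIn-shift : ∀ e e' → quotientIn e (μ ⊹ e') + - quotientIn e e' ≡ indicator e e'
    quotientIn-shift e e' = shift (inClass? e e')
      where
      collapse : ∀ x → (x + 1ℤ) + - x ≡ 1ℤ
      collapse = solve-∀
      shift : Dec (InClass e e') → quotientIn e (μ ⊹ e') + - quotientIn e e' ≡ indicator e e'
      shift (yes p) = trans
        (cong₂ (λ s t → s + - t) (trans (quotientIn-yes e (μ ⊹ e') (proj₁ (inClass-shift e e' p))) (proj₂ (inClass-shift e e' p)))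
          (quotientIn-yes e e' p))
        (trans (collapse (proj₁ p)) (sym (indicator-yes e e' p)))
      shift (no ¬p) = trans (cong₂ (λ s t → s + - t) (quotientIn-no e (μ ⊹ e') (¬p ∘ inClass-unshift e e')) (quotientIn-no e e' ¬p))
        (sym (indicator-no e e' ¬p))

    s s' : R
    s = monomial 1ℤ μ
    s' = monomial 1ℤ μ'

    pair-monomial-1 : ∀ e h → pair (monomial 1ℤ e) h ≡ h e
    pair-monomial-1 e h = trans (pair-monomial 1ℤ e h) (ℤ.*-identityˡ (h e))

    unit : s *ᴸ s' ≈ᴸ 1ᴸ
    unit = pair⇒≈ (s *ᴸ s') 1ᴸ λ h → trans (pair-* s s' h)
      (trans (pair-monomial-1 μ (λ e → pair s' (λ e' → h (e ⊹ e')))) (trans (pair-monomial-1 μ' (λ e' → h (μ ⊹ e')))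
        (trans (cong h (cong₂ V._∷_ (ℤ.+-inverseʳ M) (Vecₚ.zipWith-identityˡ ℤ.+-identityˡ tail𝟎))) (sym (pair-one h)))))

    σ : R
    σ = s +ᴸ -ᴸ 1ᴸ

    pair-σ : ∀ h → pair σ h ≡ h μ + - h 𝟎
    pair-σ h = trans (pair-++ s (-ᴸ 1ᴸ) h) (cong₂ _+_ (pair-monomial-1 μ h) (trans (pair-neg 1ᴸ h) (cong -_ (pair-one h))))

    pair-difference : ∀ d h → pair (σ *ᴸ d) h ≡ pair d (λ e → h (μ ⊹ e) + - h e)
    pair-difference d h = trans (pair-* σ d h) (trans (pair-σ (λ e → pair d (λ e' → h (e ⊹ e'))))
      (trans (cong (λ t → pair d (λ e → h (μ ⊹ e)) + - t) (pair-cong d λ e → cong h (⊹-identityˡ e)))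
        (trans (with-units (pair d (λ e → h (μ ⊹ e))) (pair d h)) (trans
          (sym (pair-linear d (λ e → h (μ ⊹ e)) h 1ℤ (- 1ℤ)))
          (pair-cong d λ e → sym (with-units (h (μ ⊹ e)) (h e)))))))
      where
      with-units : ∀ x y → x + - y ≡ 1ℤ * x + - 1ℤ * y
      with-units = solve-∀

    small-inClass : ∀ e e' → ∣ V.head e' + - V.head e ∣ ℕ.≤ m → InClass e e' → e' ≡ e
    small-inClass (y V.∷ e) e' h (x , p) = trans p (cong (V._∷ e) (trans (cong (λ t → y + t) Mx≡0) (ℤ.+-identityʳ y)))
      where
      cancel : ∀ y z → y + z + - y ≡ z
      cancel = solve-∀
      diff : V.head e' + - y ≡ M * x
      diff = trans (cong (λ t → V.head t + - y) p) (cancel y (M * x))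
      Mx≡0 : M * x ≡ 0ℤ
      Mx≡0 = small-multiple M (M * x) (s≤s (subst (λ t → ∣ t ∣ ℕ.≤ m) diff h)) (x , refl)

  -- Let s = x₁ ^ M. Pairing `w` with `indicator 𝟎` gives 1, so the exponent of the signed monomial
  -- `w` lies in the class of 𝟎. Pairing with `quotientIn e` therefore gives 0, because neither that
  -- exponent nor 𝟎 is in the class of `e`. By the equation for `w` the same pairing is the sum of
  -- the coefficients of `a` over the class of `e`, and for large M this is the coefficient at `e`.
  coeff-of-nonzero-exponent : ∀ a → RichSemantics.Sem (Laurent k) constantᶠ (λ _ → a) → ∀ e → ¬ e ≡ 𝟎 → coeff a e ≡ 0ℤ
  coeff-of-nonzero-exponent a sat e e≢𝟎 = vanish (sat s s' unit)
    where
    -- The period m + 1 exceeds the distance of the first entry of `e` from 0 and from that of any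
    -- exponent of `a`, so each class meets these exponents only in the expected one.
    m = size e ℕ.+ sizes a
    open Period m
    head≤size : ∀ (e : Exponent) → ∣ V.head e ∣ ℕ.≤ size e
    head≤size (y V.∷ e) = ℕ.m≤m+n ∣ y ∣ (size e)
    e-not-in-𝟎 : ¬ InClass 𝟎 e
    e-not-in-𝟎 = e≢𝟎 ∘ small-inClass 𝟎 e (subst (λ t → ∣ t ∣ ℕ.≤ m) (sym (ℤ.+-identityʳ (V.head e)))
      (ℕ.≤-trans (head≤size e) (ℕ.m≤m+n (size e) (sizes a))))
    inClass-𝟎 : ∀ g → InClass 𝟎 g → InClass e g → InClass 𝟎 e
    inClass-𝟎 g (x , p) (x' , p') = x + - x' , trans (η e)
      (cong₂ V._∷_ (trans (isolate (V.head e) (+ suc m) x')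
        (trans (cong (λ t → V.head t + - (+ suc m * x')) (trans (sym p') p)) (regroup (+ suc m) x x')))
        (cong V.tail (trans (sym p') p)))
      where
      η : ∀ (e : Exponent) → e ≡ V.head e V.∷ V.tail e
      η (_ V.∷ _) = refl
      isolate : ∀ y M x → y ≡ y + M * x + - (M * x)
      isolate = solve-∀
      regroup : ∀ M x x' → 0ℤ + M * x + - (M * x') ≡ 0ℤ + M * (x + - x')
      regroup = solve-∀
    𝟎-in-𝟎 : InClass 𝟎 𝟎
    𝟎-in-𝟎 = 0ℤ , cong (V._∷ tail𝟎) (sym (trans (ℤ.+-identityˡ (+ suc m * 0ℤ)) (ℤ.*-zeroʳ (+ suc m))))
    𝟎-not-in-e : ¬ InClass e 𝟎
    𝟎-not-in-e = e-not-in-𝟎 ∘ inClass-𝟎 𝟎 𝟎-in-𝟎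
    coeff-a : pair a (indicator e) ≡ coeff a e
    coeff-a = trans (pair-cong-∈ a agree) (sym (coeff-pair a e))
      where
      agree : ∀ {c e'} → (c , e') ∈ a → indicator e e' ≡ δ e e'
      agree {c} {e'} e'∈a with e' ≟ᵉ e
      ... | yes refl = indicator-yes e e (0ℤ , reflexive e)
        where
        reflexive : ∀ (e : Exponent) → e ≡ (V.head e + + suc m * 0ℤ) V.∷ V.tail e
        reflexive (y V.∷ e) = cong (V._∷ e) (sym (trans (cong (λ t → y + t) (ℤ.*-zeroʳ (+ suc m))) (ℤ.+-identityʳ y)))
      ... | no e'≢e = indicator-no e e' (e'≢e ∘ small-inClass e e' (ℕ.≤-trans
              (∣i-j∣≤ (V.head e') (V.head e) (head≤size e') (head≤size e))
              (ℕ.≤-trans (ℕ.≤-reflexive (ℕ.+-comm (size e') (size e)))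
                (ℕ.+-monoʳ-≤ (size e) (∈⇒≤sumOver (size ∘ proj₂) a e'∈a)))))
    vanish : (Σ (R) λ w → Σ (R) λ w' → Σ (R) λ y →
              w *ᴸ w' ≈ᴸ 1ᴸ × w ≈ᴸ 1ᴸ +ᴸ σ *ᴸ (a +ᴸ σ *ᴸ y)) → coeff a e ≡ 0ℤ
    vanish (w , w' , y , ww'≈1 , w≈) = signed (unit⇒signed-monomial w w' ww'≈1)
      where
      D = a +ᴸ σ *ᴸ y
      pair-w : ∀ h → pair w h ≡ h 𝟎 + pair D (λ e → h (μ ⊹ e) + - h e)
      pair-w h = trans (≈⇒pair {w} {1ᴸ +ᴸ σ *ᴸ D} w≈ h) (trans (pair-++ 1ᴸ (σ *ᴸ D) h)
        (cong₂ _+_ (pair-one h) (pair-difference D h)))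
      pair-D : pair D (indicator e) ≡ pair a (indicator e)
      pair-D = trans (pair-++ a (σ *ᴸ y) (indicator e)) (trans
        (cong (λ t → pair a (indicator e) + t) (trans (pair-difference y (indicator e))
          (trans (pair-cong y (indicator-shift e)) (pair-zero y)))) (ℤ.+-identityʳ (pair a (indicator e))))
      signed : (Σ ℤ λ ε → Σ Exponent λ g → Sign± ε × w ≈ᴸ monomial ε g) → coeff a e ≡ 0ℤ
      signed (ε , g , _ , w≈εg) = trans (sym coeff-a) (trans (sym pair-D) (trans (sym (pair-cong D (quotientIn-shift e)))
        (trans (sym (ℤ.+-identityˡ (pair D (λ e' → quotientIn e (μ ⊹ e') + - quotientIn e e'))))
          (trans (cong (λ t → t + pair D (λ e' → quotientIn e (μ ⊹ e') + - quotientIn e e')) (sym (quotientIn-no e 𝟎 𝟎-not-in-e)))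
            (trans (sym (pair-w (quotientIn e))) (trans (pair-ε (quotientIn e))
              (trans (cong (λ t → ε * t) (quotientIn-no e g g-not-in-e)) (ℤ.*-zeroʳ ε))))))))
        where
        pair-ε : ∀ h → pair w h ≡ ε * h g
        pair-ε h = trans (≈⇒pair {w} {monomial ε g} w≈εg h) (pair-monomial ε g h)
        pair-w-indicator : pair w (indicator 𝟎) ≡ 1ℤ
        pair-w-indicator = trans (pair-w (indicator 𝟎)) (cong₂ _+_ (indicator-yes 𝟎 𝟎 𝟎-in-𝟎)
          (trans (pair-cong D (indicator-shift 𝟎)) (pair-zero D)))
        ε*0≢1 : ∀ {t} → t ≡ 0ℤ → ¬ ε * t ≡ 1ℤ
        ε*0≢1 refl h = 0≢1 (trans (sym (ℤ.*-zeroʳ ε)) h)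
          where
          0≢1 : ¬ 0ℤ ≡ 1ℤ
          0≢1 ()
        g-in-𝟎 : InClass 𝟎 g
        g-in-𝟎 = decide (inClass? 𝟎 g)
          where
          decide : Dec (InClass 𝟎 g) → InClass 𝟎 g
          decide (yes p) = p
          decide (no ¬p) = ⊥-elim (ε*0≢1 (indicator-no 𝟎 g ¬p) (trans (sym (pair-ε (indicator 𝟎))) pair-w-indicator))
        g-not-in-e : ¬ InClass e g
        g-not-in-e = e-not-in-𝟎 ∘ inClass-𝟎 g g-in-𝟎

  satisfies⇒constant : ∀ a → RichSemantics.Sem (Laurent k) constantᶠ (λ _ → a) → constant (coeff a 𝟎) ≈ᴸ a
  satisfies⇒constant a sat e with 𝟎 ≟ᵉ e
  ... | yes refl = ℤ.+-identityʳ (coeff a 𝟎)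
  ... | no 𝟎≢e = sym (coeff-of-nonzero-exponent a sat e (𝟎≢e ∘ sym))

-- Laurent polynomials as results of programs

basis : ∀ {k} → Fin k → ℤ → Vec ℤ k
basis {suc k} zero c = c V.∷ V.replicate k 0ℤ
basis (suc i) c = 0ℤ V.∷ basis i c

val-𝟎 : ∀ {k} (M M' : Vector ℤ k) → val M M' (V.replicate k 0ℤ) ≡ 1ℤ
val-𝟎 {zero} M M' = refl
val-𝟎 {suc k} M M' = trans (ℤ.*-identityˡ (val (M ∘ suc) (M' ∘ suc) (V.replicate k 0ℤ))) (val-𝟎 (M ∘ suc) (M' ∘ suc))

val-basis : ∀ {k} (M M' : Vector ℤ k) i c → val M M' (basis i c) ≡ zpow (M i) (M' i) c
val-basis M M' zero c = trans (cong (λ t → zpow (M zero) (M' zero) c * t) (val-𝟎 (M ∘ suc) (M' ∘ suc))) (ℤ.*-identityʳ _)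
val-basis M M' (suc i) c = trans (ℤ.*-identityˡ (val (M ∘ suc) (M' ∘ suc) (basis i c))) (val-basis (M ∘ suc) (M' ∘ suc) i c)

basis-inverse : ∀ {k} (i : Fin k) → V.zipWith _+_ (basis i 1ℤ) (basis i (- 1ℤ)) ≡ V.replicate k 0ℤ
basis-inverse {suc k} zero = cong (0ℤ V.∷_) (Vecₚ.zipWith-identityˡ ℤ.+-identityˡ (V.replicate k 0ℤ))
basis-inverse (suc i) = cong (0ℤ V.∷_) (basis-inverse i)

generated-by-basis : ∀ {k} (P : Vec ℤ k → Set) → P (V.replicate k 0ℤ) → (∀ e f → P e → P f → P (V.zipWith _+_ e f)) →
                     (∀ i → P (basis i 1ℤ)) → (∀ i → P (basis i (- 1ℤ))) → ∀ e → P e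
generated-by-basis P P0 P+ Pb Pb' V.[] = P0
generated-by-basis {suc k} P P0 P+ Pb Pb' (n V.∷ e) = subst P
  (cong₂ V._∷_ (ℤ.+-identityʳ n) (Vecₚ.zipWith-identityˡ ℤ.+-identityˡ e))
  (P+ (n V.∷ 𝟎) (0ℤ V.∷ e) (multiple n) (generated-by-basis (λ f → P (0ℤ V.∷ f)) P0
    (λ f g → P+ (0ℤ V.∷ f) (0ℤ V.∷ g)) (Pb ∘ suc) (Pb' ∘ suc) e))
  where
  𝟎 = V.replicate k 0ℤ
  extend : ∀ x y → P (x V.∷ 𝟎) → P (y V.∷ 𝟎) → P ((x + y) V.∷ 𝟎)
  extend x y px py = subst (λ f → P ((x + y) V.∷ f)) (Vecₚ.zipWith-identityˡ ℤ.+-identityˡ 𝟎) (P+ (x V.∷ 𝟎) (y V.∷ 𝟎) px py)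
  multiple : ∀ n → P (n V.∷ 𝟎)
  multiple (+ zero) = P0
  multiple (+ suc n) = extend 1ℤ (+ n) (Pb zero) (multiple (+ n))
  multiple -[1+ zero ] = Pb' zero
  multiple -[1+ suc n ] = extend (- 1ℤ) -[1+ n ] (Pb' zero) (multiple -[1+ n ])

module LaurentPrograms (k : ℕ) where
  open LaurentRing k
  open KroneckerSubstitution k
  open Constants k
  open Programs k
  open Evaluation k using (exec; evalAt)
  private module R = CommutativeRing laurentRing
  open import Relation.Binary.Reasoning.Setoid R.setoid

  gen gen⁻¹ : Fin k → R
  gen i = monomial 1ℤ (basis i 1ℤ)
  gen⁻¹ i = monomial 1ℤ (basis i (- 1ℤ))

  execᴸ : Instr k → R → R
  execᴸ noop p = p
  execᴸ inc p = p +ᴸ 1ᴸ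
  execᴸ dec p = p +ᴸ -ᴸ 1ᴸ
  execᴸ (times i) p = gen i *ᴸ p
  execᴸ (over i) p = gen⁻¹ i *ᴸ p

  open Run execᴸ renaming (run to runᴸ)

  polynomial : ℤ → R
  polynomial u = runᴸ (program u) 0ᴸ

  monomial-* : ∀ c e d f → monomial c e *ᴸ monomial d f ≈ᴸ monomial (c * d) (e ⊹ f)
  monomial-* c e d f = pair⇒≈ (monomial c e *ᴸ monomial d f) (monomial (c * d) (e ⊹ f)) λ h →
    trans (pair-* (monomial c e) (monomial d f) h) (trans (pair-monomial c e (λ e → pair (monomial d f) (λ e' → h (e ⊹ e'))))
      (trans (cong (λ t → c * t) (pair-monomial d f (λ e' → h (e ⊹ e'))))
        (trans (sym (ℤ.*-assoc c d (h (e ⊹ f)))) (sym (pair-monomial (c * d) (e ⊹ f) h)))))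

  gen-inverse : ∀ i → gen i *ᴸ gen⁻¹ i ≈ᴸ 1ᴸ
  gen-inverse i = begin
    gen i *ᴸ gen⁻¹ i                              ≈⟨ monomial-* 1ℤ (basis i 1ℤ) 1ℤ (basis i (- 1ℤ)) ⟩
    monomial 1ℤ (basis i 1ℤ ⊹ basis i (- 1ℤ))     ≡⟨ cong (monomial 1ℤ) (basis-inverse i) ⟩
    1ᴸ                                            ∎

  execute : List (Instr k) → R → R
  execute L.[] p = p
  execute (i L.∷ is) p = execute is (execᴸ i p)

  execute-++ : ∀ is js p → execute (is L.++ js) p ≡ execute js (execute is p)
  execute-++ L.[] js p = refl
  execute-++ (i L.∷ is) js p = execute-++ is js (execᴸ i p)

  run-encode : ∀ is p → runᴸ (L.map encode is) p ≡ execute is p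
  run-encode L.[] p = refl
  run-encode (i L.∷ is) p = trans (cong (λ j → runᴸ (L.map encode is) (execᴸ j p)) (decode-encode i)) (run-encode is (execᴸ i p))

  run-↝ : ∀ {rs rs'} → rs ↝ rs' → ∀ p → runᴸ rs p ≡ runᴸ rs' p
  run-↝ nil p = refl
  run-↝ (strip h) p = run-↝ h p
  run-↝ (keep {r} h) p = run-↝ h (execᴸ (decode r) p)

  X : Exponent → R
  X = monomial 1ℤ

  Multiplies : Exponent → Set
  Multiplies e = Σ (List (Instr k)) λ is → ∀ p → execute is p ≈ᴸ X e *ᴸ p

  multiplies : ∀ e → Multiplies e
  multiplies = generated-by-basis Multiplies
    (L.[] , λ p e → sym (*ᴸ-identityˡ p e))
    (λ { e f (is , h) (js , h') → is L.++ js , λ p → begin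
      execute (is L.++ js) p                  ≡⟨ execute-++ is js p ⟩
      execute js (execute is p)               ≈⟨ h' (execute is p) ⟩
      X f *ᴸ execute is p                     ≈⟨ *ᴸ-cong {X f} {X f} {execute is p} {X e *ᴸ p} (λ _ → refl) (h p) ⟩
      X f *ᴸ (X e *ᴸ p)                       ≈⟨ R.sym {(X f *ᴸ X e) *ᴸ p} {X f *ᴸ (X e *ᴸ p)} (*ᴸ-assoc (X f) (X e) p) ⟩
      (X f *ᴸ X e) *ᴸ p                       ≈⟨ *ᴸ-cong {X f *ᴸ X e} {X (f ⊹ e)} {p} {p} (monomial-* 1ℤ f 1ℤ e) (λ _ → refl) ⟩
      X (f ⊹ e) *ᴸ p                          ≡⟨ cong (λ g → X g *ᴸ p) (⊹-comm f e) ⟩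
      X (e ⊹ f) *ᴸ p                          ∎ })
    (λ i → times i L.∷ L.[] , λ p _ → refl)
    (λ i → over i L.∷ L.[] , λ p _ → refl)

  -- Required for every accumulator `p`, so that programs for the single monomials can be
  -- concatenated.
  Adds : R → Set
  Adds a = Σ (List (Instr k)) λ is → ∀ p → execute is p ≈ᴸ p +ᴸ a

  adds-+ : ∀ a b c → Adds a → Adds b → a +ᴸ b ≈ᴸ c → Adds c
  adds-+ a b c (is , h) (js , h') a+b≈c = is L.++ js , λ p → begin
    execute (is L.++ js) p     ≡⟨ execute-++ is js p ⟩
    execute js (execute is p)  ≈⟨ h' (execute is p) ⟩
    execute is p +ᴸ b          ≈⟨ +ᴸ-cong {execute is p} {p +ᴸ a} {b} {b} (h p) (λ _ → refl) ⟩
    (p +ᴸ a) +ᴸ b              ≈⟨ R.+-assoc p a b ⟩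
    p +ᴸ (a +ᴸ b)              ≈⟨ +ᴸ-cong {p} {p} {a +ᴸ b} {c} (λ _ → refl) a+b≈c ⟩
    p +ᴸ c                     ∎

  adds-constant : ∀ n → Adds (constant n)
  adds-constant (+ zero) = L.[] , λ p d → sym (trans
    (+ᴸ-cong {p} {p} {constant 0ℤ} {0ᴸ} (λ _ → refl) (λ e → sym (constant-op zer [] e)) d) (R.+-identityʳ p d))
  adds-constant (+ suc n) = adds-+ 1ᴸ (constant (+ n)) (constant (+ suc n)) (inc L.∷ L.[] , λ p _ → refl) (adds-constant (+ n))
    (constant-op add (1ℤ ∷ λ _ → + n))
  adds-constant -[1+ zero ] = dec L.∷ L.[] , λ p _ → refl
  adds-constant -[1+ suc n ] = adds-+ (-ᴸ 1ᴸ) (constant -[1+ n ]) (constant -[1+ suc n ]) (dec L.∷ L.[] , λ p _ → refl) (adds-constant -[1+ n ])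
    (constant-op add (- 1ℤ ∷ λ _ → -[1+ n ]))

  -- With one accumulator a monomial is added by conjugation: multiply by the inverse monomial, add
  -- the constant, multiply back.
  adds-monomial : ∀ c e → Adds (monomial c e)
  adds-monomial c e = moveBack (multiplies (V.map -_ e)) (adds-constant c) (multiplies e)
    where
    e' = V.map -_ e
    x = X e
    y = X e'
    xy≈1 : x *ᴸ y ≈ᴸ 1ᴸ
    xy≈1 = begin
      x *ᴸ y            ≈⟨ monomial-* 1ℤ e 1ℤ e' ⟩
      X (e ⊹ e')        ≡⟨ cong X (Vecₚ.zipWith-inverseʳ {⁻¹ = -_} ℤ.+-inverseʳ e) ⟩
      1ᴸ                ∎
    xc : x *ᴸ constant c ≈ᴸ monomial c e
    xc = begin
      x *ᴸ constant c            ≈⟨ monomial-* 1ℤ e c 𝟎 ⟩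
      monomial (1ℤ * c) (e ⊹ 𝟎)  ≡⟨ cong₂ monomial (ℤ.*-identityˡ c) (Vecₚ.zipWith-identityʳ ℤ.+-identityʳ e) ⟩
      monomial c e               ∎
    cancel : ∀ p → x *ᴸ (y *ᴸ p) ≈ᴸ p
    cancel p = begin
      x *ᴸ (y *ᴸ p)  ≈⟨ R.sym {(x *ᴸ y) *ᴸ p} {x *ᴸ (y *ᴸ p)} (*ᴸ-assoc x y p) ⟩
      (x *ᴸ y) *ᴸ p  ≈⟨ *ᴸ-cong {x *ᴸ y} {1ᴸ} {p} {p} xy≈1 (λ _ → refl) ⟩
      1ᴸ *ᴸ p        ≈⟨ *ᴸ-identityˡ p ⟩
      p              ∎
    moveBack : Multiplies e' → Adds (constant c) → Multiplies e → Adds (monomial c e)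
    moveBack (is , h) (js , h') (ks , h'') = is L.++ (js L.++ ks) , λ p → let q = execute is p in begin
      execute (is L.++ (js L.++ ks)) p   ≡⟨ trans (execute-++ is (js L.++ ks) p) (execute-++ js ks q) ⟩
      execute ks (execute js q)          ≈⟨ h'' (execute js q) ⟩
      x *ᴸ execute js q                  ≈⟨ *ᴸ-cong {x} {x} {execute js q} {q +ᴸ constant c} (λ _ → refl) (h' q) ⟩
      x *ᴸ (q +ᴸ constant c)             ≈⟨ *ᴸ-distribˡ x q (constant c) ⟩
      x *ᴸ q +ᴸ x *ᴸ constant c          ≈⟨ +ᴸ-cong {x *ᴸ q} {x *ᴸ (y *ᴸ p)} {x *ᴸ constant c} {monomial c e}
                                              (*ᴸ-cong {x} {x} {q} {y *ᴸ p} (λ _ → refl) (h p)) xc ⟩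
      x *ᴸ (y *ᴸ p) +ᴸ monomial c e      ≈⟨ +ᴸ-cong {x *ᴸ (y *ᴸ p)} {p} {monomial c e} {monomial c e} (cancel p) (λ _ → refl) ⟩
      p +ᴸ monomial c e                  ∎

  adds : ∀ a → Adds a
  adds L.[] = L.[] , λ p d → sym (R.+-identityʳ p d)
  adds ((c , e) L.∷ a) = adds-+ (monomial c e) a ((c , e) L.∷ a) (adds-monomial c e) (adds a) (λ _ → refl)

  polynomial-surjective : ∀ a → Σ ℤ λ u → polynomial u ≈ᴸ a
  polynomial-surjective a = coded (adds a)
    where
    coded : Adds a → Σ ℤ λ u → polynomial u ≈ᴸ a
    coded (is , h) = + code rs , λ d → trans (cong (λ q → coeff q d) run-eq) (h 0ᴸ d)
      where
      rs = L.map encode is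
      expansion = digits-code rs
      run-eq : polynomial (+ code rs) ≡ execute is 0ᴸ
      run-eq = trans (cong (λ ds → runᴸ ds 0ᴸ) (digits-unique (proj₂ (digits (+ code rs))) (proj₁ (proj₂ expansion))))
        (trans (sym (run-↝ (proj₂ (proj₂ expansion)) 0ᴸ)) (run-encode is 0ᴸ))

  module _ (N : ℤ) (M M' : Vector ℤ k) (inverse : ∀ i → M i * M' i ≡ 1ℤ [mod N ]) where
    open Congruence N
    private
      v = val M M'

    value : R → ℤ
    value p = pair p v

    -- A congruence only, since `M'` inverts `M` modulo `N`: `val` turns sums of exponents into
    -- products just modulo `N`.
    value-* : ∀ p q → value (p *ᴸ q) ≋ value p * value q
    value-* p q = subst (_≋ value p * value q) (sym (pair-* p q v))
      (subst (pair p (λ e → pair q (λ e' → v (e ⊹ e'))) ≋_)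
        (trans (pair-cong p λ e → trans (pair-scale q v (v e)) (ℤ.*-comm (v e) (pair q v)))
          (trans (pair-scale p v (pair q v)) (ℤ.*-comm (pair q v) (pair p v))))
        (pair-≋ N p (λ e → pair q (λ e' → v (e ⊹ e'))) (λ e → pair q (λ e' → v e * v e'))
          λ e → pair-≋ N q (λ e' → v (e ⊹ e')) (λ e' → v e * v e') (val-+ N M M' inverse e)))

    value-1 : value 1ᴸ ≡ 1ℤ
    value-1 = trans (pair-one v) (val-𝟎 M M')

    value-op : ∀ f (ps : Vector R (arity f)) → value (⟦_⟧ (Laurent k) f ps) ≋ ⟦_⟧ ℤ-ring f (value ∘ ps)
    value-op add ps = ≋-reflexive (pair-++ (ps zero) (ps (suc zero)) v)
    value-op mul ps = value-* (ps zero) (ps (suc zero))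
    value-op neg ps = ≋-reflexive (pair-neg (ps zero) v)
    value-op zer ps = ≋-reflexive {0ℤ} refl
    value-op one ps = ≋-reflexive value-1

    value-gen : ∀ i → value (gen i) ≡ M i
    value-gen i = trans (pair-monomial 1ℤ (basis i 1ℤ) v) (trans (ℤ.*-identityˡ (v (basis i 1ℤ)))
      (trans (val-basis M M' i 1ℤ) (ℤ.*-identityʳ (M i))))

    value-gen⁻¹ : ∀ i → value (gen⁻¹ i) ≡ M' i
    value-gen⁻¹ i = trans (pair-monomial 1ℤ (basis i (- 1ℤ)) v) (trans (ℤ.*-identityˡ (v (basis i (- 1ℤ))))
      (trans (val-basis M M' i (- 1ℤ)) (ℤ.*-identityʳ (M' i))))

    value-constant : ∀ n → value (constant n) ≡ n
    value-constant n = trans (pair-constant n v) (trans (cong (λ t → n * t) (val-𝟎 M M')) (ℤ.*-identityʳ n))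

    value-exec : ∀ i p n → value p ≋ n → value (execᴸ i p) ≋ exec M M' i n
    value-exec noop p n h = h
    value-exec inc p n h = subst (_≋ n + 1ℤ) (sym (trans (pair-++ p 1ᴸ v) (cong (λ t → value p + t) value-1)))
      (≋-+ (value p) n 1ℤ 1ℤ h (≋-reflexive {1ℤ} refl))
    value-exec dec p n h = subst (_≋ n + - 1ℤ)
      (sym (trans (pair-++ p (-ᴸ 1ᴸ) v) (cong (λ t → value p + t) (trans (pair-neg 1ᴸ v) (cong -_ value-1)))))
      (≋-+ (value p) n (- 1ℤ) (- 1ℤ) h (≋-reflexive { - 1ℤ} refl))
    value-exec (times i) p n h = ≋-trans (value (gen i *ᴸ p)) (value (gen i) * value p) (M i * n) (value-* (gen i) p)
      (≋-* (value (gen i)) (M i) (value p) n (≋-reflexive (value-gen i)) h)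
    value-exec (over i) p n h = ≋-trans (value (gen⁻¹ i *ᴸ p)) (value (gen⁻¹ i) * value p) (M' i * n) (value-* (gen⁻¹ i) p)
      (≋-* (value (gen⁻¹ i)) (M' i) (value p) n (≋-reflexive (value-gen⁻¹ i)) h)

    -- Each instruction commutes with evaluation, so the run on integers shadows the run on
    -- polynomials. This is what lets formulas over ℤ speak of decoded polynomials.
    value-polynomial : ∀ u → value (polynomial u) ≋ evalAt M M' u
    value-polynomial u = along (program u) 0ᴸ 0ℤ (≋-reflexive {0ℤ} refl)
      where
      along : ∀ rs p n → value p ≋ n → value (runᴸ rs p) ≋ Run.run (exec M M') rs n
      along L.[] p n h = h
      along (r L.∷ rs) p n h = along rs (execᴸ (decode r) p) (exec M M' (decode r) n) (value-exec (decode r) p n h)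

  SameValues : R → R → Set
  SameValues p q = ∀ N M M' inverse → value N M M' inverse p ≡ value N M M' inverse q [mod N ]

  sameValues⇔≈ : ∀ p q → SameValues p q ⇔ p ≈ᴸ q
  sameValues⇔≈ p q = mk⇔
    (λ h e → ℤ.i-j≡0⇒i≡j (coeff p e) (coeff q e) (trans (sym (coeff-difference e))
      (vanishes-at-points⇒0 (p +ᴸ -ᴸ q) (λ N M M' inverse → subst (N ∣ᶻ_)
        (trans (sym (pair-difference-eq (val M M'))) (sym (ℤ.+-identityʳ (pair (p +ᴸ -ᴸ q) (val M M')))))
        (h N M M' inverse)) e)))
    (λ h N M M' inverse → Congruence.≋-reflexive N (≈⇒pair {p} {q} h (val M M')))
    where
    pair-difference-eq : ∀ h → pair (p +ᴸ -ᴸ q) h ≡ pair p h + - pair q h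
    pair-difference-eq h = trans (pair-++ p (-ᴸ q) h) (cong (λ t → pair p h + t) (pair-neg q h))
    coeff-difference : ∀ e → coeff (p +ᴸ -ᴸ q) e ≡ coeff p e + - coeff q e
    coeff-difference e = trans (coeff-pair (p +ᴸ -ᴸ q) e) (trans (pair-difference-eq (δ e))
      (sym (cong₂ (λ s t → s + - t) (coeff-pair p e) (coeff-pair q e))))

-- Finitely generated ideals and the ideal of a point

module FinitelyGeneratedIdeal (R : CommutativeRing 0ℓ 0ℓ) where
  open CommutativeRing R renaming (Carrier to C; _+_ to _⊞_; _*_ to _·_; -_ to ⊟_; _≈_ to _~_;
    refl to ~-refl; sym to ~-sym; trans to ~-trans; zero to ·-zero)
  open import Relation.Binary.Reasoning.Setoid setoid
  open import Algebra.Properties.Ring ring using (-‿distribʳ-*; -‿distribˡ-*; -‿+-comm; -‿involutive; -0#≈0#)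
  open SemiringSolver commutativeSemiring using (solve; _:=_; _:+_; _:*_; con)

  total : ∀ n → (Fin n → C) → C
  total zero f = 0#
  total (suc n) f = f zero ⊞ total n (f ∘ suc)

  total-cong : ∀ n {f g} → (∀ i → f i ~ g i) → total n f ~ total n g
  total-cong zero h = ~-refl
  total-cong (suc n) h = +-cong (h zero) (total-cong n (h ∘ suc))

  total-+ : ∀ n f g → total n (λ i → f i ⊞ g i) ~ total n f ⊞ total n g
  total-+ zero f g = ~-sym (+-identityˡ 0#)
  total-+ (suc n) f g = ~-trans (+-congˡ (total-+ n (f ∘ suc) (g ∘ suc)))
    (solve 4 (λ a b c d → (a :+ b) :+ (c :+ d) := (a :+ c) :+ (b :+ d)) ~-refl
      (f zero) (g zero) (total n (f ∘ suc)) (total n (g ∘ suc)))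

  total-* : ∀ n c f → total n (λ i → c · f i) ~ c · total n f
  total-* zero c f = ~-sym (zeroʳ c)
  total-* (suc n) c f = ~-trans (+-congˡ (total-* n c (f ∘ suc))) (~-sym (distribˡ c (f zero) (total n (f ∘ suc))))

  total-0 : ∀ n (d : Fin n → C) → total n (λ i → 0# · d i) ~ 0#
  total-0 n d = ~-trans (total-* n 0# d) (zeroˡ (total n d))

  unitVector : ∀ {n} → Fin n → Fin n → C
  unitVector zero zero = 1#
  unitVector zero (suc j) = 0#
  unitVector (suc i) zero = 0#
  unitVector (suc i) (suc j) = unitVector i j

  total-unitVector : ∀ {n} (j : Fin n) (d : Fin n → C) → total n (λ i → unitVector j i · d i) ~ d j
  total-unitVector {suc n} zero d = ~-trans (+-cong (*-identityˡ (d zero)) (total-0 n (d ∘ suc))) (+-identityʳ (d zero))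
  total-unitVector {suc n} (suc j) d = ~-trans (+-cong (zeroˡ (d zero)) (total-unitVector j (d ∘ suc))) (+-identityˡ (d (suc j)))

  module Ideal (k : ℕ) (N : C) (d : Fin k → C) where
    InIdeal : C → Set
    InIdeal a = Σ C λ r → Σ (Vector C k) λ rs → a ~ N · r ⊞ total k (λ i → rs i · d i)

    inIdeal-cong : ∀ {a b} → a ~ b → InIdeal a → InIdeal b
    inIdeal-cong a~b (r , rs , e) = r , rs , ~-trans (~-sym a~b) e

    inIdeal-+ : ∀ {a b} → InIdeal a → InIdeal b → InIdeal (a ⊞ b)
    inIdeal-+ {a} {b} (r , rs , e) (r' , rs' , e') = r ⊞ r' , (λ i → rs i ⊞ rs' i) , (begin
      a ⊞ b ≈⟨ +-cong e e' ⟩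
      (N · r ⊞ T) ⊞ (N · r' ⊞ T') ≈⟨ solve 5 (λ n r r' t t' → (n :* r :+ t) :+ (n :* r' :+ t') := n :* (r :+ r') :+ (t :+ t')) ~-refl N r r' T T' ⟩
      N · (r ⊞ r') ⊞ (T ⊞ T') ≈⟨ +-congˡ (~-sym (total-+ k _ _)) ⟩
      N · (r ⊞ r') ⊞ total k (λ i → rs i · d i ⊞ rs' i · d i) ≈⟨ +-congˡ (total-cong k λ i → ~-sym (distribʳ (d i) (rs i) (rs' i))) ⟩
      N · (r ⊞ r') ⊞ total k (λ i → (rs i ⊞ rs' i) · d i) ∎)
      where
      T = total k (λ i → rs i · d i)
      T' = total k (λ i → rs' i · d i)

    inIdeal-* : ∀ c {a} → InIdeal a → InIdeal (c · a)
    inIdeal-* c {a} (r , rs , e) = c · r , (λ i → c · rs i) , (begin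
      c · a ≈⟨ *-congˡ e ⟩
      c · (N · r ⊞ T) ≈⟨ solve 4 (λ c n r t → c :* (n :* r :+ t) := n :* (c :* r) :+ c :* t) ~-refl c N r T ⟩
      N · (c · r) ⊞ c · T ≈⟨ +-congˡ (~-sym (total-* k c _)) ⟩
      N · (c · r) ⊞ total k (λ i → c · (rs i · d i)) ≈⟨ +-congˡ (total-cong k λ i → ~-sym (*-assoc c (rs i) (d i))) ⟩
      N · (c · r) ⊞ total k (λ i → (c · rs i) · d i) ∎)
      where
      T = total k (λ i → rs i · d i)

    inIdeal-multiple : ∀ q → InIdeal (N · q)
    inIdeal-multiple q = q , (λ _ → 0#) , ~-sym (~-trans (+-congˡ (total-0 k d)) (+-identityʳ (N · q)))

    inIdeal-generator : ∀ i → InIdeal (d i)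
    inIdeal-generator i = 0# , unitVector i , ~-sym (~-trans (+-cong (zeroʳ N) (total-unitVector i d)) (+-identityˡ (d i)))

    infix 4 _∼_
    _∼_ : C → C → Set
    a ∼ b = InIdeal (a ⊞ ⊟ b)

    ∼-cong : ∀ {a a' b b'} → a ~ a' → b ~ b' → a ∼ b → a' ∼ b'
    ∼-cong p q = inIdeal-cong (+-cong p (-‿cong q))

    ∼-reflexive : ∀ {a b} → a ~ b → a ∼ b
    ∼-reflexive {a} {b} a~b = inIdeal-cong (~-trans (zeroˡ N) (~-sym (~-trans (+-congʳ a~b) (-‿inverseʳ b))))
      (inIdeal-* 0# (inIdeal-cong (*-identityʳ N) (inIdeal-multiple 1#)))

    ∼-trans : ∀ {a b c} → a ∼ b → b ∼ c → a ∼ c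
    ∼-trans {a} {b} {c} p q = inIdeal-cong (begin
      (a ⊞ ⊟ b) ⊞ (b ⊞ ⊟ c) ≈⟨ solve 4 (λ a b' b c' → (a :+ b') :+ (b :+ c') := (a :+ c') :+ (b' :+ b)) ~-refl a (⊟ b) b (⊟ c) ⟩
      (a ⊞ ⊟ c) ⊞ (⊟ b ⊞ b) ≈⟨ +-congˡ (-‿inverseˡ b) ⟩
      (a ⊞ ⊟ c) ⊞ 0# ≈⟨ +-identityʳ _ ⟩
      a ⊞ ⊟ c ∎) (inIdeal-+ p q)

    ∼-*ˡ : ∀ c {a b} → a ∼ b → c · a ∼ c · b
    ∼-*ˡ c {a} {b} p = inIdeal-cong (~-trans (distribˡ c a (⊟ b)) (+-congˡ (~-sym (-‿distribʳ-* c b)))) (inIdeal-* c p)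

    ∼-+ : ∀ {a b c e} → a ∼ b → c ∼ e → a ⊞ c ∼ b ⊞ e
    ∼-+ {a} {b} {c} {e} p q = inIdeal-cong (begin
      (a ⊞ ⊟ b) ⊞ (c ⊞ ⊟ e) ≈⟨ solve 4 (λ a b c e → (a :+ b) :+ (c :+ e) := (a :+ c) :+ (b :+ e)) ~-refl a (⊟ b) c (⊟ e) ⟩
      (a ⊞ c) ⊞ (⊟ b ⊞ ⊟ e) ≈⟨ +-congˡ (-‿+-comm b e) ⟩
      (a ⊞ c) ⊞ ⊟ (b ⊞ e) ∎) (inIdeal-+ p q)

    ∼-sym : ∀ {a b} → a ∼ b → b ∼ a
    ∼-sym {a} {b} p = inIdeal-cong (begin
      ⊟ 1# · (a ⊞ ⊟ b) ≈⟨ ~-sym (-‿distribˡ-* 1# _) ⟩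
      ⊟ (1# · (a ⊞ ⊟ b)) ≈⟨ -‿cong (*-identityˡ _) ⟩
      ⊟ (a ⊞ ⊟ b) ≈⟨ ~-sym (-‿+-comm a (⊟ b)) ⟩
      ⊟ a ⊞ ⊟ (⊟ b) ≈⟨ +-congˡ (-‿involutive b) ⟩
      ⊟ a ⊞ b ≈⟨ +-comm (⊟ a) b ⟩
      b ⊞ ⊟ a ∎) (inIdeal-* (⊟ 1#) p)

    ∼-* : ∀ {a b c e} → a ∼ b → c ∼ e → a · c ∼ b · e
    ∼-* {a} {b} {c} {e} p q = ∼-trans (∼-*ˡ a q) (∼-cong (*-comm e a) (*-comm e b) (∼-*ˡ e p))

    -- x ∼ m and m·m' ∼ 1 force x⁻¹ ∼ m'.
    ∼-inverse : ∀ {x x' m m'} → x · x' ~ 1# → x ∼ m → m · m' ∼ 1# → x' ∼ m'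
    ∼-inverse {x} {x'} {m} {m'} xx'~1 x∼m mm'∼1 = ∼-sym (∼-trans
      (∼-cong (begin
          x · (x' · m') ≈⟨ ~-sym (*-assoc x x' m') ⟩
          (x · x') · m' ≈⟨ *-congʳ xx'~1 ⟩
          1# · m' ≈⟨ *-identityˡ m' ⟩
          m' ∎)
        (solve 3 (λ m x' m' → m :* (x' :* m') := x' :* (m :* m')) ~-refl m x' m')
        (∼-* x∼m (∼-reflexive ~-refl)))
      (∼-cong ~-refl (*-identityʳ x') (∼-*ˡ x' mm'∼1)))

module PointIdeal (k : ℕ) where
  open LaurentRing k
  open LaurentPrograms k
  open Constants k
  open Programs k
  open Evaluation k using (exec; evalAt)
  open FinitelyGeneratedIdeal laurentRing public

  module _ (N : ℤ) (M M' : Vector ℤ k) (inverse : ∀ i → M i * M' i ≡ 1ℤ [mod N ]) where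
    generators : Fin k → R
    generators i = gen i +ᴸ -ᴸ constant (M i)

    open Ideal k (constant N) generators

    InPointIdeal : R → Set
    InPointIdeal = InIdeal

    open Congruence N
    private
      val' = value N M M' inverse

      pair-total : ∀ n (f : Fin n → R) → (∀ i → val' (f i) ≋ 0ℤ) → val' (total n f) ≋ 0ℤ
      pair-total zero f h = ≋-reflexive {0ℤ} refl
      pair-total (suc n) f h = subst (_≋ 0ℤ) (sym (pair-++ (f zero) (total n (f ∘ suc)) (val M M')))
        (≋-+ (val' (f zero)) 0ℤ (val' (total n (f ∘ suc))) 0ℤ (h zero) (pair-total n (f ∘ suc) (h ∘ suc)))

      vanishing-* : ∀ a b → val' b ≋ 0ℤ → val' (a *ᴸ b) ≋ 0ℤ
      vanishing-* a b h = ≋-trans (val' (a *ᴸ b)) (val' a * val' b) 0ℤ (value-* N M M' inverse a b)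
        (subst (λ t → val' a * val' b ≋ t) (ℤ.*-zeroʳ (val' a)) (≋-*ˡ (val' a) (val' b) 0ℤ h))

    -- Evaluation at the point is a homomorphism modulo `N` that kills `N` and each xᵢ - Mᵢ.
    value-in-ideal : ∀ a → InPointIdeal a → val' a ≋ 0ℤ
    value-in-ideal a (r , rs , e) = subst (_≋ 0ℤ) (sym (trans (≈⇒pair {a} {Nr +ᴸ T} e (val M M')) (pair-++ Nr T (val M M'))))
      (≋-+ (val' Nr) 0ℤ (val' T) 0ℤ
        (≋-trans (val' Nr) (val' (r *ᴸ constant N)) 0ℤ
          (≋-reflexive (≈⇒pair {Nr} {r *ᴸ constant N} (*ᴸ-comm (constant N) r) (val M M')))
          (vanishing-* r (constant N) (subst (_≋ 0ℤ) (sym (value-constant N M M' inverse N))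
            (1ℤ , trans (ℤ.+-identityʳ N) (sym (ℤ.*-identityʳ N))))))
        (pair-total k (λ i → rs i *ᴸ generators i) λ i → vanishing-* (rs i) (generators i)
          (≋-reflexive (trans (pair-++ (gen i) (-ᴸ constant (M i)) (val M M'))
            (trans (cong₂ _+_ (value-gen N M M' inverse i)
              (trans (pair-neg (constant (M i)) (val M M')) (cong -_ (value-constant N M M' inverse (M i)))))
              (ℤ.+-inverseʳ (M i)))))))
      where
      Nr = constant N *ᴸ r
      T = total k (λ i → rs i *ᴸ generators i)

    private
      gen∼ : ∀ i → gen i ∼ constant (M i)
      gen∼ i = inIdeal-generator i

      inverse∼ : ∀ i → constant (M i) *ᴸ constant (M' i) ∼ 1ᴸ
      inverse∼ i = let (q , e) = inverse i in
        inIdeal-cong {constant N *ᴸ constant q} {constant (M i) *ᴸ constant (M' i) +ᴸ -ᴸ 1ᴸ}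
          (λ d → trans (constant-op mul (N ∷ λ _ → q) d) (trans (cong (λ t → coeff (constant t) d) (sym e))
            (sym (trans (+ᴸ-cong {constant (M i) *ᴸ constant (M' i)} {constant (M i * M' i)} { -ᴸ 1ᴸ} {constant (- 1ℤ)}
              (constant-op mul (M i ∷ λ _ → M' i)) (λ _ → refl) d) (constant-op add (M i * M' i ∷ λ _ → - 1ℤ) d)))))
          (inIdeal-multiple (constant q))

      gen⁻¹∼ : ∀ i → gen⁻¹ i ∼ constant (M' i)
      gen⁻¹∼ i = ∼-inverse {gen i} {gen⁻¹ i} {constant (M i)} {constant (M' i)}
        (gen-inverse i) (gen∼ i) (inverse∼ i)

      +∼ : ∀ p q m n → p ∼ constant m → q ∼ constant n → p +ᴸ q ∼ constant (m + n)
      +∼ p q m n h h' = ∼-cong {p +ᴸ q} {p +ᴸ q} {constant m +ᴸ constant n} {constant (m + n)} (λ _ → refl)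
        (constant-op add (m ∷ λ _ → n)) (∼-+ {p} {constant m} {q} {constant n} h h')

      *∼ : ∀ p q m n → p ∼ constant m → q ∼ constant n → p *ᴸ q ∼ constant (m * n)
      *∼ p q m n h h' = ∼-cong {p *ᴸ q} {p *ᴸ q} {constant m *ᴸ constant n} {constant (m * n)} (λ _ → refl)
        (constant-op mul (m ∷ λ _ → n)) (∼-* {p} {constant m} {q} {constant n} h h')

      exec∼ : ∀ i p n → p ∼ constant n → execᴸ i p ∼ constant (exec M M' i n)
      exec∼ noop p n h = h
      exec∼ inc p n h = +∼ p 1ᴸ n 1ℤ h (∼-reflexive {1ᴸ} {constant 1ℤ} (λ _ → refl))
      exec∼ dec p n h = +∼ p (-ᴸ 1ᴸ) n (- 1ℤ) h (∼-reflexive { -ᴸ 1ᴸ} {constant (- 1ℤ)} (λ _ → refl))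
      exec∼ (times i) p n h = *∼ (gen i) p (M i) n (gen∼ i) h
      exec∼ (over i) p n h = *∼ (gen⁻¹ i) p (M' i) n (gen⁻¹∼ i) h

    -- Modulo the ideal the variables become the integers `M` and their inverses become `M'`, so the
    -- run in the ring follows the run in ℤ instruction by instruction.
    polynomial-in-ideal : ∀ u → InPointIdeal (polynomial u +ᴸ -ᴸ constant (evalAt M M' u))
    polynomial-in-ideal u = along (program u) 0ᴸ 0ℤ
      (∼-reflexive {0ᴸ} {constant 0ℤ} (constant-op zer []))
      where
      open Run execᴸ renaming (run to runᴸ)
      along : ∀ rs p n → p ∼ constant n → runᴸ rs p ∼ constant (Run.run (exec M M') rs n)
      along L.[] p n h = h
      along (r L.∷ rs) p n h = along rs (execᴸ (decode r) p) (exec M M' (decode r) n) (exec∼ (decode r) p n h)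

    ≈polynomial⇒inIdeal : ∀ a u → polynomial u ≈ᴸ a → InPointIdeal (a +ᴸ -ᴸ constant (evalAt M M' u))
    ≈polynomial⇒inIdeal a u h = ∼-cong {polynomial u} {a} {constant (evalAt M M' u)} {constant (evalAt M M' u)}
      h (λ _ → refl) (polynomial-in-ideal u)

    inIdeal⇒value : ∀ a n → InPointIdeal (a +ᴸ -ᴸ constant n) → val' a ≋ n
    inIdeal⇒value a n h = subst (N ∣ᶻ_) (trans (ℤ.+-identityʳ (val' (a +ᴸ -ᴸ constant n)))
      (trans (pair-++ a (-ᴸ constant n) (val M M')) (cong (λ t → val' a + t)
        (trans (pair-neg (constant n) (val M M')) (cong -_ (value-constant N M M' inverse n))))))
      (value-in-ideal (a +ᴸ -ᴸ constant n) h)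

-- The two interpretations

relation-argument : {A : Set} {n P : ℕ} (xs : Vector (Vector A 1) n) (x : Vector A 1) (p : Vector A P) (i : Fin n) →
                    ((concat xs ++ x) ++ p) ((combine i zero ↑ˡ 1) ↑ˡ P) ≡ xs i zero
relation-argument xs x p i = trans (lookup-++ˡ (concat xs ++ x) p (combine i zero ↑ˡ 1))
  (trans (lookup-++ˡ (concat xs) x (combine i zero)) (concat-combine xs i zero))

relation-result : {A : Set} {n P : ℕ} (xs : Vector (Vector A 1) n) (x : Vector A 1) (p : Vector A P) →
                  ((concat xs ++ x) ++ p) (((n ℕ.* 1) ↑ʳ zero) ↑ˡ P) ≡ x zero
relation-result {n = n} xs x p = trans (lookup-++ˡ (concat xs ++ x) p ((n ℕ.* 1) ↑ʳ zero)) (lookup-++ʳ (concat xs) x zero)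

sumᵗ : {V : Set} (n : ℕ) → (Fin n → Term V) → Term V
sumᵗ zero ts = 𝟘
sumᵗ (suc n) ts = ts zero ⊕ sumᵗ n (ts ∘ suc)

module PointFormulas (k : ℕ) where
  open Evaluation k

  slots : {A : Set} → (u v : A) (M M' : Fin k → A) → Slot → A
  slots u v M M' uˢ = u
  slots u v M M' vˢ = v
  slots u v M M' (Mˢ i) = M i
  slots u v M M' (M'ˢ i) = M' i

  evaluatesᶠ : {V : Set} → (u v : Term V) (M M' : Fin k → Term V) → Fml V
  evaluatesᶠ u v M M' = inst evalᶠ (slots u v M M')

  inverseᶠ : {V : Set} → Term V → (M M' : Fin k → Term V) → Fml V
  inverseᶠ N M M' = ⋀ᶠ k λ i → divᶠ N (M i ⊗ M' i ⊕ ⊝ 𝟙)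

  -- variables: values of the coded polynomials, M', M, N, outer variables
  Scope : ℕ → Set → Set
  Scope n V = Fin n ⊎ (Fin k ⊎ (Fin k ⊎ Maybe V))

  -- The values of the programs are quantified universally under the hypothesis that they are the
  -- values. Evaluation is a function, so this amounts to substituting them in `t`.
  atPointsᶠ : {V : Set} (n : ℕ) → (Fin n → V) → Term (Scope n V) → Fml V
  atPointsᶠ n codes t = ∀ᶠ (∀ᶠⁿ k (∀ᶠⁿ k (
    inverseᶠ (var (inj₂ (inj₂ nothing))) (var ∘ inj₂ ∘ inj₁) (var ∘ inj₁) ⇒ᶠ
    ∀ᶠⁿ n (⋀ᶠ n (λ i → evaluatesᶠ (var (inj₂ (inj₂ (inj₂ (just (codes i)))))) (var (inj₁ i))
        (var ∘ inj₂ ∘ inj₂ ∘ inj₁) (var ∘ inj₂ ∘ inj₁)) ⇒ᶠ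
      divᶠ (var (inj₂ (inj₂ (inj₂ nothing)))) t))))

  open RichSemantics ℤ-ring
  open CompileCorrect ℤ-ring ℤ-alg

  Sem-evaluates : ∀ {V} (u v : Term V) M M' (ρ : V → ℤ) → Sem (evaluatesᶠ u v M M') ρ ⇔
    eval v ρ ≡ evalAt (λ i → eval (M i) ρ) (λ i → eval (M' i) ρ) (eval u ρ)
  Sem-evaluates u v M M' ρ = Sem-evalᶠ λ s → eval (slots u v M M' s) ρ

  evalVars : {A : Set} → (u v : A) (M M' : Fin k → A) → Vector A (2 ℕ.+ (k ℕ.+ k))
  evalVars u v M M' = u ∷ v ∷ (M ++ M')

  slotTerms : Slot → Term (Fin (2 ℕ.+ (k ℕ.+ k)))
  slotTerms = slots (var zero) (var (suc zero)) (λ i → var (suc (suc (i ↑ˡ k)))) (λ i → var (suc (suc (k ↑ʳ i))))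

  slotTerms-value : ∀ u v M M' s → eval (slotTerms s) (evalVars u v M M') ≡ slots u v M M' s
  slotTerms-value u v M M' uˢ = refl
  slotTerms-value u v M M' vˢ = refl
  slotTerms-value u v M M' (Mˢ i) = lookup-++ˡ M M' i
  slotTerms-value u v M M' (M'ˢ i) = lookup-++ʳ M M' i

  -- Evaluation compiled over a fixed finite list of variables, the form that the translation along
  -- an interpretation accepts; the Laurent ring will read this formula on its constants.
  evalFormula : Formula (2 ℕ.+ (k ℕ.+ k))
  evalFormula = formula evalᶠ slotTerms

  Sat-eval : ∀ u v M M' → Sat ℤ-ring evalFormula (evalVars u v M M') ⇔ v ≡ evalAt M M' u
  Sat-eval u v M M' =
    Sat-formula evalᶠ slotTerms (evalVars u v M M') ⇔∘
    Sem-cong evalᶠ {λ s → eval (slotTerms s) (evalVars u v M M')} {slots u v M M'} (slotTerms-value u v M M') ⇔∘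
    Sem-evalᶠ (slots u v M M')

  scope : {V : Set} {n : ℕ} → (V → ℤ) → ℤ → (M M' : Vector ℤ k) → Vector ℤ n → Scope n V → ℤ
  scope ρ N M M' vs = [ vs , [ M' , [ M , maybe′ ρ N ]′ ]′ ]′

  Sem-atPoints : ∀ {V} n (codes : Fin n → V) t (ρ : V → ℤ) → Sem (atPointsᶠ n codes t) ρ ⇔
    (∀ N M M' → (∀ i → M i * M' i ≡ 1ℤ [mod N ]) →
      N ∣ᶻ eval t (scope ρ N M M' (λ i → evalAt M M' (ρ (codes i)))))
  Sem-atPoints n codes t ρ = mk⇔
    (λ h N M M' inv → h N M M' inv (λ i → evalAt M M' (ρ (codes i)))
      (λ i → from (evaluates N M M' _ i) refl))
    (λ h N M M' inv vs vs-eq → subst (N ∣ᶻ_)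
      (eval-cong t {scope ρ N M M' (λ i → evalAt M M' (ρ (codes i)))} {scope ρ N M M' vs}
        λ { (inj₁ i) → sym (to (evaluates N M M' vs i) (vs-eq i)) ; (inj₂ _) → refl })
      (h N M M' inv))
    where
    evaluates : ∀ N M M' vs i → _
    evaluates N M M' vs i = Sem-evaluates (var (inj₂ (inj₂ (inj₂ (just (codes i)))))) (var (inj₁ i))
        (var ∘ inj₂ ∘ inj₂ ∘ inj₁) (var ∘ inj₂ ∘ inj₁) (scope ρ N M M' vs)

  AtPoints : Set₁
  AtPoints = (N : ℤ) (M M' : Vector ℤ k) → (∀ i → M i * M' i ≡ 1ℤ [mod N ]) → Set

  pointwise : {φ χ : AtPoints} → (∀ N M M' inv → φ N M M' inv ⇔ χ N M M' inv) →
              (∀ N M M' inv → φ N M M' inv) ⇔ (∀ N M M' inv → χ N M M' inv)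
  pointwise e = Π-⇔ λ N → Π-⇔ λ M → Π-⇔ λ M' → Π-⇔ λ inv → e N M M' inv

module Interpretations (l : ℕ) where
  k : ℕ
  k = suc l

  open LaurentRing k
  open LaurentPrograms k
  open Constants k
  open ConstantsDefinable l using (satisfies⇒constant)
  open PointFormulas k
  open Evaluation k

  private
    module ℤᶠ = CompileCorrect ℤ-ring ℤ-alg
    module Rᶠ = CompileCorrect (Laurent k) Laurent-alg
    module ℤˢ = RichSemantics ℤ-ring
    module Rˢ = RichSemantics (Laurent k)

  op-congᴸ : ∀ f (ps qs : Vector R (arity f)) → (∀ i → ps i ≈ᴸ qs i) → ⟦_⟧ (Laurent k) f ps ≈ᴸ ⟦_⟧ (Laurent k) f qs
  op-congᴸ f ps qs h = IsSetoidAlgebra.op-cong Laurent-alg f {ps} {qs} h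

  ≈-⇔ᴸ : ∀ p p' q q' → p ≈ᴸ p' → q ≈ᴸ q' → p ≈ᴸ q ⇔ p' ≈ᴸ q'
  ≈-⇔ᴸ p p' q q' = IsSetoidAlgebra.≈-⇔ Laurent-alg {p} {p'} {q} {q'}

  relationVars : {P : ℕ} (f : Op) → Fin (suc (arity f)) → Fin (arity f ℕ.* 1 ℕ.+ 1 ℕ.+ P)
  relationVars {P} f zero = ((arity f ℕ.* 1) ↑ʳ zero) ↑ˡ P
  relationVars {P} f (suc i) = (combine i zero ↑ˡ 1) ↑ˡ P

  sameCode : Term (Scope 2 (Fin 2))
  sameCode = var (inj₁ zero) ⊕ ⊝ var (inj₁ (suc zero))

  operationEquation : (f : Op) → Term (Scope (suc (arity f)) (Fin (suc (arity f))))
  operationEquation f = op f (var ∘ inj₁ ∘ suc) ⊕ ⊝ var (inj₁ zero)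

  sameCodeFormula : Formula 2
  sameCodeFormula = formula (atPointsᶠ 2 id sameCode) var

  operationFormula : (f : Op) → Formula (arity f ℕ.* 1 ℕ.+ 1 ℕ.+ 0)
  operationFormula f = formula (atPointsᶠ (suc (arity f)) id (operationEquation f)) (var ∘ relationVars f)

  constantFormula : Formula (1 ℕ.+ k)
  constantFormula = formula constantᶠ (λ _ → var zero)

  Sat-sameCode : (ρ : Vector ℤ 2) → Sat ℤ-ring sameCodeFormula ρ ⇔
    (∀ N M M' → (∀ i → M i * M' i ≡ 1ℤ [mod N ]) → evalAt M M' (ρ zero) ≡ evalAt M M' (ρ (suc zero)) [mod N ])
  Sat-sameCode ρ = ℤᶠ.Sat-formula (atPointsᶠ 2 id sameCode) var ρ ⇔∘ Sem-atPoints 2 id sameCode ρ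

  Sat-operation : ∀ f (ρ : Vector ℤ (arity f ℕ.* 1 ℕ.+ 1 ℕ.+ 0)) (u : ℤ) (us : Vector ℤ (arity f)) →
    ρ (relationVars f zero) ≡ u → (∀ i → ρ (relationVars f (suc i)) ≡ us i) → Sat ℤ-ring (operationFormula f) ρ ⇔
    (∀ N M M' → (∀ i → M i * M' i ≡ 1ℤ [mod N ]) →
      ⟦_⟧ ℤ-ring f (λ i → evalAt M M' (us i)) ≡ evalAt M M' u [mod N ])
  Sat-operation f ρ u us h hs =
    ℤᶠ.Sat-formula (atPointsᶠ (suc (arity f)) id (operationEquation f)) (var ∘ relationVars f) ρ ⇔∘
    ℤᶠ.Sem-cong (atPointsᶠ (suc (arity f)) id (operationEquation f)) {ρ ∘ relationVars f} {u ∷ us}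
      (λ { zero → h ; (suc i) → hs i }) ⇔∘
    Sem-atPoints (suc (arity f)) id (operationEquation f) (u ∷ us)

  Sat-constant : (ρ : Vector R (1 ℕ.+ k)) → Sat (Laurent k) constantFormula ρ ⇔ Rˢ.Sem constantᶠ (λ _ → ρ zero)
  Sat-constant ρ = Rᶠ.Sat-formula constantᶠ (λ _ → var zero) ρ

  -- Every integer, negative ones included, is a program, so the domain is everything; equality and
  -- operations are tested at all points modulo all `N`.
  Γ : Interp
  Γ = record
    { dim = 1
    ; par = 0
    ; dom = tt
    ; eqv = sameCodeFormula
    ; rel = operationFormula
    }

  -- The parameters are candidates for the variables xᵢ, carried along for `θA`. Equality and
  -- operations are those of the ring, restricted to the definable copy of ℤ.
  Δ : Interp
  Δ = record
    { dim = 1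
    ; par = k
    ; dom = constantFormula
    ; eqv = zero ≐ suc zero
    ; rel = λ f → app f (relationVars f ∘ suc) (relationVars f zero)
    }

  constantTerm : R → ℤ
  constantTerm a = coeff a 𝟎

  IsConstant : R → Set
  IsConstant a = Rˢ.Sem constantᶠ (λ _ → a)

  constantTerm-constant : ∀ n a → constant n ≈ᴸ a → constantTerm a ≡ n
  constantTerm-constant n a h = trans (sym (h 𝟎)) (constantTerm-constant' n)
    where
    constantTerm-constant' : ∀ n → constantTerm (constant n) ≡ n
    constantTerm-constant' n with 𝟎 ≟ᵉ 𝟎
    ... | yes _ = ℤ.+-identityʳ n
    ... | no h = ⊥-elim (h refl)

  constant⇒IsConstant : ∀ n a → constant n ≈ᴸ a → IsConstant a
  constant⇒IsConstant n a h = to (Rᶠ.Sem-cong constantᶠ {λ _ → constant n} {λ _ → a} (λ _ → h)) (constant-satisfies n)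

  Sat-domΔ : ∀ (x : Vector R 1) (p : Vector R k) → Sat (Laurent k) (dom Δ) (x ++ p) ⇔ IsConstant (x zero)
  Sat-domΔ x p = Sat-constant (x ++ p)

  coordΔ : (p : Vector R k) → CoordMap Δ (Laurent k) p ℤ-ring
  coordΔ p = record
    { π = λ x _ → constantTerm (x zero)
    ; surj = λ n → (λ _ → constant n) , from (Sat-domΔ (λ _ → constant n) p) (constant-satisfies n) ,
               constantTerm-constant n (constant n) (λ _ → refl)
    ; π-eqv = λ x x' d d' → mk⇔ (λ h → h 𝟎) λ h e → trans (sym (isConstant x d e))
        (trans (cong (λ n → coeff (constant n) e) h) (isConstant x' d' e))
    ; π-op = operation
    }
    where
    isConstant : ∀ x → Sat (Laurent k) (dom Δ) (x ++ p) → constant (constantTerm (x zero)) ≈ᴸ x zero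
    isConstant x d = satisfies⇒constant (x zero) (to (Sat-domΔ x p) d)

    operation : ∀ f xs (ds : ∀ i → Sat (Laurent k) (dom Δ) (xs i ++ p)) x (d : Sat (Laurent k) (dom Δ) (x ++ p)) →
                Sat (Laurent k) (rel Δ f) ((concat {n = arity f} xs ++ x) ++ p) ⇔
                ⟦_⟧ ℤ-ring f (λ i → constantTerm (xs i zero)) ≡ constantTerm (x zero)
    operation f xs ds x d =
      ≈-⇔ᴸ (⟦_⟧ (Laurent k) f arguments) (constant n) result (constant (constantTerm (x zero)))
        (λ e → trans (op-congᴸ f arguments (constant ∘ ns) (λ i e → trans
            (cong (λ y → coeff y e) (relation-argument xs x p i)) (sym (isConstant (xs i) (ds i) e))) e)
          (constant-op f ns e))
        (λ e → trans (cong (λ y → coeff y e) (relation-result {n = arity f} xs x p)) (sym (isConstant x d e))) ⇔∘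
      mk⇔ (constant-injective n (constantTerm (x zero))) (λ h e → cong (λ n → coeff (constant n) e) h)
      where
      ns = λ i → constantTerm (xs i zero)
      n = ⟦_⟧ ℤ-ring f ns
      arguments = λ i → ((concat {n = arity f} xs ++ x) ++ p) (relationVars f (suc i))
      result = ((concat {n = arity f} xs ++ x) ++ p) (relationVars {k} f zero)

  -- Each equivalence passes from the formula to congruences between values of programs, then to
  -- values of polynomials, and finally to equality because points separate polynomials.
  coordΓ : (p : Vector ℤ 0) → CoordMap Γ ℤ-ring p (Laurent k)
  coordΓ p = record
    { π = λ x _ → polynomial (x zero)
    ; surj = λ a → let (u , h) = polynomial-surjective a in (λ _ → u) , _ , h
    ; π-eqv = λ x x' _ _ →
        Sat-sameCode ((x ++ x') ++ p) ⇔∘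
        pointwise (λ N M M' inv → same N M M' inv (x zero) (x' zero)) ⇔∘
        sameValues⇔≈ (polynomial (x zero)) (polynomial (x' zero))
    ; π-op = λ f xs _ x _ →
        let us = λ i → xs i zero in
        Sat-operation f ((concat {n = arity f} xs ++ x) ++ p) (x zero) us
          (relation-result {n = arity f} xs x p) (relation-argument xs x p) ⇔∘
        pointwise (λ N M M' inv → operation N M M' inv f us (x zero)) ⇔∘
        sameValues⇔≈ (⟦_⟧ (Laurent k) f (polynomial ∘ us)) (polynomial (x zero))
    }
    where
    module _ (N : ℤ) (M M' : Vector ℤ k) (inv : ∀ i → M i * M' i ≡ 1ℤ [mod N ]) where
      open Congruence N
      private
        ev = evalAt M M'
        val' = value N M M' inv
        value≋ = value-polynomial N M M' inv

      same : ∀ u u' → (ev u ≋ ev u') ⇔ (val' (polynomial u) ≋ val' (polynomial u'))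
      same u u' = ⇔-sym (≋-⇔ (val' (polynomial u)) (ev u) (val' (polynomial u')) (ev u') (value≋ u) (value≋ u'))

      op-≋ : ∀ f (ms ns : Vector ℤ (arity f)) → (∀ i → ms i ≋ ns i) → ⟦_⟧ ℤ-ring f ms ≋ ⟦_⟧ ℤ-ring f ns
      op-≋ add ms ns h = ≋-+ (ms zero) (ns zero) (ms (suc zero)) (ns (suc zero)) (h zero) (h (suc zero))
      op-≋ mul ms ns h = ≋-* (ms zero) (ns zero) (ms (suc zero)) (ns (suc zero)) (h zero) (h (suc zero))
      op-≋ neg ms ns h = ≋-neg (ms zero) (ns zero) (h zero)
      op-≋ zer ms ns h = ≋-reflexive {0ℤ} refl
      op-≋ one ms ns h = ≋-reflexive {1ℤ} refl

      operation : ∀ f (us : Vector ℤ (arity f)) u →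
        (⟦_⟧ ℤ-ring f (ev ∘ us) ≋ ev u) ⇔ (val' (⟦_⟧ (Laurent k) f (polynomial ∘ us)) ≋ val' (polynomial u))
      operation f us u = ⇔-sym (≋-⇔ (val' result) computed (val' (polynomial u)) (ev u)
        (≋-trans (val' result) (⟦_⟧ ℤ-ring f (val' ∘ polynomial ∘ us)) computed
          (value-op N M M' inv f (polynomial ∘ us)) (op-≋ f (val' ∘ polynomial ∘ us) (ev ∘ us) (value≋ ∘ us)))
        (value≋ u))
        where
        result = ⟦_⟧ (Laurent k) f (polynomial ∘ us)
        computed = ⟦_⟧ ℤ-ring f (ev ∘ us)

-- The definable coordinate maps and the bi-interpretation

module BiInterpretation (l : ℕ) where
  open Interpretations l
  open LaurentRing k
  open LaurentPrograms k
  open Constants k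
  open ConstantsDefinable l using (satisfies⇒constant)
  open PointFormulas k
  open PointIdeal k
  open Evaluation k

  private
    module ℤᶠ = CompileCorrect ℤ-ring ℤ-alg
    module Rᶠ = CompileCorrect (Laurent k) Laurent-alg
    module ℤˢ = RichSemantics ℤ-ring
    module Rˢ = RichSemantics (Laurent k)
    module Rᴹ = Semantics (Laurent k) Laurent-alg
    module RR = CompositeCoordMap (Laurent k) ℤ-ring (Laurent k) Laurent-alg ℤ-alg Laurent-alg Γ tt Δ tt
    module ZZ = CompositeCoordMap ℤ-ring (Laurent k) ℤ-ring ℤ-alg Laurent-alg ℤ-alg Δ tt Γ tt

  ΓΔ ΔΓ : Interp
  ΓΔ = Compose.ΓΔ Γ tt Δ tt
  ΔΓ = Compose.ΓΔ Δ tt Γ tt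

  -- Evaluation of programs translated along Δ. Its blocks have length 1, so every variable
  -- represents itself.
  evalFormulaᴸ : Formula (2 ℕ.+ (k ℕ.+ k) ℕ.+ k)
  evalFormulaᴸ = Translate.tr Δ evalFormula (λ j _ → j ↑ˡ k) ((2 ℕ.+ (k ℕ.+ k)) ↑ʳ_)

  IsInteger : R → ℤ → Set
  IsInteger a n = constant n ≈ᴸ a

  Sat-evalᴸ : ∀ u v (M M' t : Vector R k) u₀ v₀ M₀ M'₀ → IsInteger u u₀ → IsInteger v v₀ →
    (∀ i → IsInteger (M i) (M₀ i)) → (∀ i → IsInteger (M' i) (M'₀ i)) →
    Sat (Laurent k) evalFormulaᴸ (evalVars u v M M' ++ t) ⇔ v₀ ≡ evalAt M₀ M'₀ u₀
  Sat-evalᴸ u v M M' t u₀ v₀ M₀ M'₀ hu hv hM hM' =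
    Through.Sat-tr evalFormula (λ j _ → j ↑ˡ k) ((2 ℕ.+ (k ℕ.+ k)) ↑ʳ_) (evalVars u v M M' ++ t) (evalVars u₀ v₀ M₀ M'₀)
      (lookup-++ʳ (evalVars u v M M') t)
      (λ j → represents j (subst (λ a → IsInteger a (evalVars u₀ v₀ M₀ M'₀ j)) (sym (lookup-++ˡ (evalVars u v M M') t j)) (integers j))) ⇔∘
    Sat-eval u₀ v₀ M₀ M'₀
    where
    module Through = RR.Through t (coordΔ t)
    integers : ∀ j → IsInteger (evalVars u v M M' j) (evalVars u₀ v₀ M₀ M'₀ j)
    integers zero = hu
    integers (suc zero) = hv
    integers (suc (suc j)) with splitAt k j
    ... | inj₁ i = hM i
    ... | inj₂ i = hM' i
    represents : ∀ j {n} → IsInteger ((evalVars u v M M' ++ t) (j ↑ˡ k)) n →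
                 Through.Represents (λ _ → (evalVars u v M M' ++ t) (j ↑ˡ k)) n
    represents j {n} h = from (Sat-domΔ (λ _ → a) t) (constant⇒IsConstant n a h) , constantTerm-constant n a h
      where
      a = (evalVars u v M M' ++ t) (j ↑ˡ k)

  ThetaScope : Set
  ThetaScope = Fin k ⊎ (Fin k ⊎ Maybe (Maybe (Fin 2 ⊎ Fin k)))

  private
    Nᵗ vᵗ uᵗ aᵗ : Term ThetaScope
    Nᵗ = var (inj₂ (inj₂ (just nothing)))
    vᵗ = var (inj₂ (inj₂ nothing))
    uᵗ = var (inj₂ (inj₂ (just (just (inj₁ zero)))))
    aᵗ = var (inj₂ (inj₂ (just (just (inj₁ (suc zero))))))
    Mᵗ M'ᵗ tᵗ : Fin k → Term ThetaScope
    Mᵗ = var ∘ inj₂ ∘ inj₁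
    M'ᵗ = var ∘ inj₁
    tᵗ = var ∘ inj₂ ∘ inj₂ ∘ just ∘ just ∘ inj₂

    integerᶠ : {V : Set} → Term V → Fml V
    integerᶠ t = inst constantᶠ (λ _ → t)

    inner : ThetaScope → Term (Fin k ⊎ Maybe ThetaScope)
    inner = var ∘ inj₂ ∘ just

    summand : Fin k → Term (Fin k ⊎ Maybe ThetaScope)
    summand i = var (inj₁ i) ⊗ (inner (inj₂ (inj₂ (just (just (inj₂ i))))) ⊕ ⊝ inner (inj₂ (inj₁ i)))

  -- a ≡ v modulo the ideal (N , t₁ - M₁ , … , t_k - M_k)
  congruentᶠ : Fml ThetaScope
  congruentᶠ = ∃ᶠ (∃ᶠⁿ k (eq (inner (inj₂ (inj₂ (just (just (inj₁ (suc zero)))))) ⊕ ⊝ inner (inj₂ (inj₂ nothing)))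
    (inner (inj₂ (inj₂ (just nothing))) ⊗ var (inj₂ nothing) ⊕ sumᵗ k summand)))

  -- `a` is the polynomial coded by the integer `u` iff at each point modulo each `N` it is
  -- congruent to the value v of the program, modulo the ideal of the point. That ideal is finitely
  -- generated, so the congruence is first order, with `t` in place of the variables.
  thetaᶠ : Fml (Fin 2 ⊎ Fin k)
  thetaᶠ = ∀ᶠ (∀ᶠ (∀ᶠⁿ k (∀ᶠⁿ k (
    integerᶠ Nᵗ ∧ᶠ integerᶠ vᵗ ∧ᶠ ⋀ᶠ k (integerᶠ ∘ Mᵗ) ∧ᶠ ⋀ᶠ k (integerᶠ ∘ M'ᵗ) ∧ᶠ inverseᶠ Nᵗ Mᵗ M'ᵗ ∧ᶠ
    emb evalFormulaᴸ (evalVars uᵗ vᵗ Mᵗ M'ᵗ ++ tᵗ) ⇒ᶠ congruentᶠ))))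

  thetaScope : R → R → Vector R k → R → R → (M M' : Vector R k) → ThetaScope → R
  thetaScope u a t N v M M' = [ M' , [ M , maybe′ (maybe′ [ u ∷ a ∷ [] , t ]′ N) v ]′ ]′

  private
    eval-sum : ∀ {V} n (ts : Fin n → Term V) (ρ : V → R) → Rˢ.eval (sumᵗ n ts) ρ ≡ total n (λ i → Rˢ.eval (ts i) ρ)
    eval-sum zero ts ρ = refl
    eval-sum (suc n) ts ρ = cong (Rˢ.eval (ts zero) ρ +ᴸ_) (eval-sum n (ts ∘ suc) ρ)

    eval-evalVars : ∀ (t : Vector R k) (ρ : ThetaScope → R) → (∀ i → Rˢ.eval (tᵗ i) ρ ≡ t i) → ∀ i →
      Rˢ.eval ((evalVars uᵗ vᵗ Mᵗ M'ᵗ ++ tᵗ) i) ρ ≡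
      (evalVars (Rˢ.eval uᵗ ρ) (Rˢ.eval vᵗ ρ) (λ i → Rˢ.eval (Mᵗ i) ρ) (λ i → Rˢ.eval (M'ᵗ i) ρ) ++ t) i
    eval-evalVars t ρ h i = trans (∘-++ (λ s → Rˢ.eval s ρ) (evalVars uᵗ vᵗ Mᵗ M'ᵗ) tᵗ i)
      (++-cong₂ _≡_ {u' = evalVars (Rˢ.eval uᵗ ρ) (Rˢ.eval vᵗ ρ) (λ i → Rˢ.eval (Mᵗ i) ρ) (λ i → Rˢ.eval (M'ᵗ i) ρ)}
        (λ { zero → refl ; (suc zero) → refl ; (suc (suc j)) → ∘-++ (λ s → Rˢ.eval s ρ) Mᵗ M'ᵗ j }) h i)

    -- The augmentation sending each variable to 1, a homomorphism that fixes the integers. It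
    -- brings a divisibility between constants, witnessed by a Laurent polynomial, back to ℤ.
    augment : R → ℤ
    augment p = pair p (λ _ → 1ℤ)

    augment-* : ∀ p q → augment (p *ᴸ q) ≡ augment p * augment q
    augment-* p q = trans (pair-* p q (λ _ → 1ℤ)) (trans (pair-cong p λ _ → sym (ℤ.*-identityʳ (augment q)))
      (trans (pair-scale p (λ _ → 1ℤ) (augment q)) (ℤ.*-comm (augment q) (augment p))))

    augment-integer : ∀ a n → IsInteger a n → augment a ≡ n
    augment-integer a n h = trans (sym (≈⇒pair {constant n} {a} h (λ _ → 1ℤ)))
      (trans (pair-constant n (λ _ → 1ℤ)) (ℤ.*-identityʳ n))

    integer-inverse : ∀ N M M' N₀ M₀ M'₀ → IsInteger N N₀ → IsInteger M M₀ → IsInteger M' M'₀ →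
      (Σ R λ q → M *ᴸ M' +ᴸ -ᴸ 1ᴸ ≈ᴸ N *ᴸ q) → M₀ * M'₀ ≡ 1ℤ [mod N₀ ]
    integer-inverse N M M' N₀ M₀ M'₀ hN hM hM' (q , e) = augment q , trans (sym left)
      (trans (≈⇒pair {M *ᴸ M' +ᴸ -ᴸ 1ᴸ} {N *ᴸ q} e (λ _ → 1ℤ)) (trans (augment-* N q)
        (cong (λ t → t * augment q) (augment-integer N N₀ hN))))
      where
      left : augment (M *ᴸ M' +ᴸ -ᴸ 1ᴸ) ≡ M₀ * M'₀ + - 1ℤ
      left = trans (pair-++ (M *ᴸ M') (-ᴸ 1ᴸ) (λ _ → 1ℤ)) (cong (λ t → t + - 1ℤ)
        (trans (augment-* M M') (cong₂ _*_ (augment-integer M M₀ hM) (augment-integer M' M'₀ hM'))))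

    constant-inverse : ∀ N M M' → M * M' ≡ 1ℤ [mod N ] → Σ R λ q → constant M *ᴸ constant M' +ᴸ -ᴸ 1ᴸ ≈ᴸ constant N *ᴸ q
    constant-inverse N M M' (q , e) = constant q , λ d → trans
      (+ᴸ-cong {constant M *ᴸ constant M'} {constant (M * M')} { -ᴸ 1ᴸ} {constant (- 1ℤ)}
        (constant-op mul (M ∷ λ _ → M')) (λ _ → refl) d) (trans (constant-op add (M * M' ∷ λ _ → - 1ℤ) d)
        (trans (cong (λ t → coeff (constant t) d) e) (sym (constant-op mul (N ∷ λ _ → q) d))))

  Sem-congruent : ∀ u a N v M M' inverse →
    Rˢ.Sem congruentᶠ (thetaScope u a gen (constant N) (constant v) (constant ∘ M) (constant ∘ M')) ⇔
    InPointIdeal N M M' inverse (a +ᴸ -ᴸ constant v)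
  Sem-congruent u a N v M M' inverse = Σ-⇔ λ r → Σ-⇔ λ rs → mk⇔
    (λ h d → trans (h d) (cong (λ t → coeff (constant N *ᴸ r +ᴸ t) d) (eval-sum k summand (env r rs))))
    (λ h d → trans (h d) (sym (cong (λ t → coeff (constant N *ᴸ r +ᴸ t) d) (eval-sum k summand (env r rs)))))
    where
    env : R → Vector R k → Fin k ⊎ Maybe ThetaScope → R
    env r rs = [ rs , maybe′ (thetaScope u a gen (constant N) (constant v) (constant ∘ M) (constant ∘ M')) r ]′

  -- In one direction the formula is instantiated at genuine constants, and membership in the ideals
  -- yields equal values at all points. In the other, elements satisfying `constantᶠ` are constants
  -- up to equality, so each quantified point is an integer point, where `polynomial-in-ideal`
  -- applies.
  Sem-theta : ∀ u a m → IsInteger u m → Rˢ.Sem thetaᶠ [ u ∷ a ∷ [] , gen ]′ ⇔ polynomial m ≈ᴸ a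
  Sem-theta u a m hu = mk⇔ sound complete
    where
    sound : Rˢ.Sem thetaᶠ [ u ∷ a ∷ [] , gen ]′ → polynomial m ≈ᴸ a
    sound h = to (sameValues⇔≈ (polynomial m) a) λ N M M' inverse →
      let v = evalAt M M' m
          in-ideal = h (constant N) (constant v) (constant ∘ M) (constant ∘ M')
            (constant-satisfies N , constant-satisfies v , constant-satisfies ∘ M , constant-satisfies ∘ M' ,
             (λ i → constant-inverse N (M i) (M' i) (inverse i)) ,
             from (Rᴹ.Sat-cong≡ evalFormulaᴸ (eval-evalVars gen _ (λ _ → refl)))
               (from (Sat-evalᴸ u (constant v) (constant ∘ M) (constant ∘ M') gen m v M M' hu (λ _ → refl) (λ _ _ → refl) (λ _ _ → refl)) refl))
          open Congruence N
      in ≋-trans (value N M M' inverse (polynomial m)) v (value N M M' inverse a)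
           (value-polynomial N M M' inverse m)
           (≋-sym (value N M M' inverse a) v
             (inIdeal⇒value N M M' inverse a v (to (Sem-congruent u a N v M M' inverse) in-ideal)))
    complete : polynomial m ≈ᴸ a → Rˢ.Sem thetaᶠ [ u ∷ a ∷ [] , gen ]′
    complete h N v M M' (cN , cv , cM , cM' , inv , evaluates) =
      to (Rᶠ.Sem-cong congruentᶠ {thetaScope u a gen (constant N₀) (constant v₀) (constant ∘ M₀) (constant ∘ M'₀)} {thetaScope u a gen N v M M'}
          (λ { (inj₁ i) → satisfies⇒constant (M' i) (cM' i) ; (inj₂ (inj₁ i)) → satisfies⇒constant (M i) (cM i)
             ; (inj₂ (inj₂ nothing)) → satisfies⇒constant v cv ; (inj₂ (inj₂ (just nothing))) → satisfies⇒constant N cN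
             ; (inj₂ (inj₂ (just (just _)))) → λ _ → refl }))
        (from (Sem-congruent u a N₀ v₀ M₀ M'₀ inverse)
          (subst (λ n → InPointIdeal N₀ M₀ M'₀ inverse (a +ᴸ -ᴸ constant n)) (sym v₀-eq)
            (≈polynomial⇒inIdeal N₀ M₀ M'₀ inverse a m h)))
      where
      N₀ = constantTerm N
      v₀ = constantTerm v
      M₀ = constantTerm ∘ M
      M'₀ = constantTerm ∘ M'
      inverse : ∀ i → M₀ i * M'₀ i ≡ 1ℤ [mod N₀ ]
      inverse i = integer-inverse N (M i) (M' i) N₀ (M₀ i) (M'₀ i) (satisfies⇒constant N cN)
        (satisfies⇒constant (M i) (cM i)) (satisfies⇒constant (M' i) (cM' i)) (inv i)
      v₀-eq : v₀ ≡ evalAt M₀ M'₀ m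
      v₀-eq = to (Sat-evalᴸ u v M M' gen m v₀ M₀ M'₀ hu (satisfies⇒constant v cv)
          (λ i → satisfies⇒constant (M i) (cM i)) (λ i → satisfies⇒constant (M' i) (cM' i)))
        (to (Rᴹ.Sat-cong≡ evalFormulaᴸ (eval-evalVars gen (thetaScope u a gen N v M M') (λ _ → refl))) evaluates)

  thetaVars : Fin 2 ⊎ Fin k → Term (Fin (1 ℕ.+ 1 ℕ.+ (k ℕ.+ 0)))
  thetaVars (inj₁ zero) = var zero
  thetaVars (inj₁ (suc zero)) = var (suc zero)
  thetaVars (inj₂ i) = var (suc (suc (i ↑ˡ 0)))

  θA : Formula (dim ΓΔ ℕ.+ 1 ℕ.+ par ΓΔ)
  θA = formula thetaᶠ thetaVars

  codeValue : Term (Scope 1 (Fin 2))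
  codeValue = var (inj₁ zero) ⊕ ⊝ var (inj₂ (inj₂ (inj₂ (just (suc zero)))))

  codeVars : Fin 2 → Term (Fin (1 ℕ.+ 1 ℕ.+ (0 ℕ.+ k ℕ.* 1)))
  codeVars zero = var zero
  codeVars (suc zero) = var (suc zero)

  θB : Formula (dim ΔΓ ℕ.+ 1 ℕ.+ par ΔΓ)
  θB = formula (atPointsᶠ 1 (λ _ → zero) codeValue) codeVars

  left : Fin k ⊎ Fin 0 → Fin k
  left (inj₁ i) = i

  -- The composite has k + 0 parameters, which does not reduce to `k`.
  strip : Fin (k ℕ.+ 0) → Fin k
  strip i = left (splitAt k i)

  strip-↑ˡ : ∀ i → strip i ↑ˡ 0 ≡ i
  strip-↑ˡ i = trans (inverse (splitAt k i)) (Finₚ.join-splitAt k 0 i)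
    where
    inverse : ∀ (x : Fin k ⊎ Fin 0) → left x ↑ˡ 0 ≡ join k 0 x
    inverse (inj₁ i) = refl

  module Coordinate = CoordMapFormula ΓΔ θA

  -- The composite code is built from Γ and Δ alone, so `ΓΔ` can be formed with `tt` before ψ
  -- exists, and letting ψ speak about it is not circular.
  ψ : Formula k
  ψ = formula Coordinate.coordMapᶠ (var ∘ strip)

  Sat-ψ : (t : Vector R k) → Sat (Laurent k) ψ t ⇔ Rˢ.Sem Coordinate.coordMapᶠ (t ∘ strip)
  Sat-ψ t = Rᶠ.Sat-formula Coordinate.coordMapᶠ (var ∘ strip) t

  generatorParams : Vector R (par ΓΔ)
  generatorParams = gen ∘ strip

  coordΓΔ : (r : Vector R (par ΓΔ)) → CoordMap ΓΔ (Laurent k) r (Laurent k)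
  coordΓΔ r = RR.compositeMap r (coordΔ (RR.objectParams r)) [] (λ ()) (coordΓ [])

  θA-generators : DefinesCoordMap ΓΔ (Laurent k) generatorParams θA
  θA-generators = coordΓΔ generatorParams , λ u D a →
    Rᶠ.Sat-formula thetaᶠ thetaVars ((u ++ (a ∷ [])) ++ generatorParams) ⇔∘
    Rᶠ.Sem-cong thetaᶠ {λ v → Rˢ.eval (thetaVars v) ((u ++ (a ∷ [])) ++ generatorParams)} {[ u zero ∷ a ∷ [] , gen ]′}
      (λ { (inj₁ zero) → λ _ → refl ; (inj₁ (suc zero)) → λ _ → refl
         ; (inj₂ i) → λ e → cong (λ j → coeff (gen (left j)) e) (Finₚ.splitAt-↑ˡ k i 0) }) ⇔∘
    Sem-theta (u zero) a (constantTerm (u zero)) (satisfies⇒constant (u zero) (isConstant u D))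
    where
    isConstant : ∀ (u : Vector R 1) → Sat (Laurent k) (dom ΓΔ) (u ++ generatorParams) → IsConstant (u zero)
    isConstant u D = to (Sat-domΔ (blocks {n = 1} u zero) (RR.objectParams generatorParams))
      (RR.block-dom generatorParams (coordΔ (RR.objectParams generatorParams)) [] (λ ()) (coordΓ []) u D zero)

  Γ-regular : IsRegularInterp Γ tt (Laurent k) ℤ-ring
  Γ-regular = record { nonempty = [] , _ ; iso = λ p _ → coordΓ p }

  Δ-regular : IsRegularInterp Δ ψ ℤ-ring (Laurent k)
  Δ-regular = record
    { nonempty = gen , from (Sat-ψ gen)
        (Coordinate.definesCoordMap⇒Sem (Laurent k) Laurent-alg generatorParams θA-generators)
    ; iso = λ p _ → coordΔ p
    }

  -- The coordinate map is read off from θ itself, whichever admissible tuple `r` is. The generators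
  -- are only needed to see that an admissible tuple exists.
  θA-coordinate : (r : Vector R (par ΓΔ)) → Sat (Laurent k) ψ (λ i → r (i ↑ˡ 0)) → DefinesCoordMap ΓΔ (Laurent k) r θA
  θA-coordinate r s = Coordinate.Sem⇒definesCoordMap (Laurent k) Laurent-alg r
    (to (Rᶠ.Sem-cong Coordinate.coordMapᶠ {λ v → r (strip v ↑ˡ 0)} {r} (λ v e → cong (λ j → coeff (r j) e) (strip-↑ˡ v)))
      (to (Sat-ψ (λ i → r (i ↑ˡ 0))) s))

  -- Any parameters work: they code Laurent polynomials, and `coordΔ` accepts every tuple of these.
  -- The formula says that the program has value `a` at every point modulo every `N`, hence that the
  -- decoded polynomial is the constant `a`.
  θB-coordinate : (r : Vector ℤ (par ΔΓ)) → DefinesCoordMap ΔΓ ℤ-ring r θB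
  θB-coordinate r = ZZ.compositeMap r (coordΓ objects) params represented (coordΔ params) , λ u D a →
    ℤᶠ.Sat-formula (atPointsᶠ 1 (λ _ → zero) codeValue) codeVars ((u ++ (a ∷ [])) ++ r) ⇔∘
    Sem-atPoints 1 (λ _ → zero) codeValue (λ v → ℤˢ.eval (codeVars v) ((u ++ (a ∷ [])) ++ r)) ⇔∘
    values u a ⇔∘ sameValues⇔≈ (polynomial (u zero)) (constant a) ⇔∘
    mk⇔ (λ h → constantTerm-constant a (polynomial (u zero)) (λ e → sym (h e)))
        (λ h e → trans (sym (satisfies⇒constant (polynomial (u zero)) (isConstant u D) e)) (cong (λ n → coeff (constant n) e) h))
    where
    objects = ZZ.objectParams r
    params : Vector R k
    params p = polynomial (ZZ.codedParams r p zero)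
    represented : ∀ p → ZZ.Through.Represents objects (coordΓ objects) (ZZ.codedParams r p) (params p)
    represented p = _ , λ _ → refl
    isConstant : ∀ (u : Vector ℤ 1) → Sat ℤ-ring (dom ΔΓ) (u ++ r) → IsConstant (polynomial (u zero))
    isConstant u D = to (Sat-domΔ (λ _ → polynomial (u zero)) params)
      (to (Semantics.Sat-cong (Laurent k) Laurent-alg (dom Δ)
            (++-cong₂ _≈ᴸ_ {u = ZZ.values r (coordΓ objects) params represented (coordΔ params) u D}
              {u' = λ _ → polynomial (u zero)} {v = params} {v' = params} (λ { zero _ → refl }) (λ _ _ → refl)))
        (ZZ.values-dom r (coordΓ objects) params represented (coordΔ params) u D))
    values : ∀ (u : Vector ℤ 1) (a : ℤ) →
      (∀ N M M' → (∀ i → M i * M' i ≡ 1ℤ [mod N ]) → evalAt M M' (u zero) ≡ a [mod N ]) ⇔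
      SameValues (polynomial (u zero)) (constant a)
    values u a = pointwise λ N M M' inv → let open Congruence N in
      ⇔-sym (≋-⇔ (value N M M' inv (polynomial (u zero))) (evalAt M M' (u zero)) (value N M M' inv (constant a)) a
        (value-polynomial N M M' inv (u zero)) (≋-reflexive (value-constant N M M' inv a)))

  biInterpretable : RegularlyBiInterpretable (Laurent k) ℤ-ring
  biInterpretable = record
    { Γ = Γ
    ; φ = tt
    ; Δ = Δ
    ; ψ = ψ
    ; Γ-reg = Γ-regular
    ; Δ-reg = Δ-regular
    ; θA = θA
    ; θB = θB
    ; θA-coord = λ r s → θA-coordinate r (to (Rᴹ.Sat-rename (λ i → i ↑ˡ 0) ψ) (proj₁ s))
    ; θB-coord = λ r _ → θB-coordinate r
    }

theorem6p6 : (k : ℕ) → 1 ≤ k → RegularlyBiInterpretable (Laurent k) ℤ-ring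
theorem6p6 (suc l) _ = BiInterpretation.biInterpretable l
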